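{- Let $p>3$ be a prime. When passing from $\mathcal{G}_2(\mathbb{F}_p)$ to the spine $\mathcal{S}\subset\mathcal{G}_2(\overline{\mathbb{F}}_p)$, only stacking, folding, or at most one attachment by a new edge are possible. That is: every connected component of $\mathcal{G}_2(\mathbb{F}_p)$ either stacks with another component or folds, and there is at most one unordered pair $\{a,b\}$ of $j$-invariants in $\mathbb{F}_p$ for which components are attached by a new edge $[a,b]$. In particular, no two components attach along a $j$-invariant.
   Context: Let $p>3$ and $\ell\neq p$ be primes (here $\ell=2$), and let $\Phi_\ell(X,Y)\in\mathbb{Z}[X,Y]$ be the classical $\ell$-th modular polynomial. $\mathcal{G}_\ell(\overline{\mathbb{F}}_p)$: vertices are $\overline{\mathbb{F}}_p$-isomorphism classes of supersingular elliptic curves, labelled by their $j$-invariants (which lie in $\mathbb{F}_{p^2}$); the edges from $j$ are the pairs $(j,j')$ with $j'$ a root of $\Phi_\ell(j,Y)$, counted with multiplicity. The spine $\mathcal{S}$ is the full subgraph on the vertices with $j\in\mathbb{F}_p$. $\mathcal{G}_\ell(\mathbb{F}_p)$: vertices are $\mathbb{F}_p$-isomorphism classes of supersingular elliptic curves over $\mathbb{F}_p$; edges are $\ell$-isogenies defined over $\mathbb{F}_p$, up to $\mathbb{F}_p$-isomorphism, taken as undirected by identifying an isogeny with its dual. Every supersingular $a\in\mathbb{F}_p$ is the $j$-invariant of exactly two vertices, denoted $v_a,w_a$; for $a\ne1728$ they are quadratic twists of each other. Passing from $\mathcal{G}_\ell(\mathbb{F}_p)$ to $\mathcal{S}$: first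 identify vertices with the same $j$-invariant (and equivalent edges), then add the edges of $\mathcal{G}_\ell(\overline{\mathbb{F}}_p)$ between vertices in $\mathbb{F}_p$ that are not defined over $\mathbb{F}_p$. Two distinct components $V,W$ of $\mathcal{G}_\ell(\mathbb{F}_p)$ stack if, after relabelling each vertex by its $j$-invariant, they become isomorphic as (labelled) graphs. A component $V$ folds if it contains the vertices corresponding to both quadratic twists of every $j$-invariant on $V$, i.e. for every vertex $E$ of $V$ the vertex of the quadratic twist $E^t$ is in $V$ (when $p\equiv3\pmod 4$, a curve with $j=1728$ is $\mathbb{F}_p$-isomorphic to its quadratic twist). A new edge is an edge $[a,b]$ of $\mathcal{S}$, $a\neq b$, such that no edge of $\mathcal{G}_\ell(\mathbb{F}_p)$ joins a vertex with $j$-invariant $a$ to a vertex with $j$-invariant $b$. Components $V,W$ of $\mathcal{G}_\ell(\mathbb{F}_p)$ are attached by a new edge if there is a new edge $[a,b]$ corresponding to an isogeny, not defined over $\mathbb{F}_p$, between a vertex $v_a\in V$ and a vertex $w_b\in W$. Two distinct components $V,W$ attach along the $j$-invariant $a$ if $v_a\in V$, $w_a\in W$ for the two vertices with $j$-invariant $a$, some neighbour of $v_a$ has a $j$-invariant that is not the $j$-invariant of any neighbour of $w_a$, and vice versa. -}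

module Defs where

open import Level using (Level; _⊔_) renaming (suc to lsuc)
open import Algebra.Bundles using (CommutativeRing)
open import Data.Nat.Base as ℕ using (ℕ; zero; suc)
open import Data.List.Base using (List; []; _∷_; map)
open import Data.Product using (Σ; ∃; ∃-syntax; _×_; _,_; proj₁; proj₂)
open import Data.Sum using (_⊎_)
open import Function.Bundles using (Inverse)
open import Relation.Nullary using (¬_; yes; no)
open import Relation.Binary.Bundles using (Setoid)
open import Relation.Binary.Definitions using (Decidable)
open import Relation.Binary.PropositionalEquality using (_≡_)
open import Relation.Binary.Structures using (IsEquivalence)
open import Relation.Binary.Construct.Closure.Equivalence as EqC using (EqClosure)
import Relation.Binary.Construct.On as On
import Algebra.Properties.Semiring.Mult as Mult
import Algebra.Properties.CommutativeSemiring.Exp as Exp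
import Relation.Binary.Reasoning.Setoid as SetoidReasoning

-- Univariate polynomials as lists of coefficients, constant term first.
-- Trailing zeros are allowed, so equality is coefficientwise.
module Polynomial {c ℓ} (R : CommutativeRing c ℓ) where
  open CommutativeRing R

  Poly : Set c
  Poly = List Carrier

  coeff : Poly → ℕ → Carrier
  coeff []      _       = 0#
  coeff (a ∷ f) zero    = a
  coeff (a ∷ f) (suc i) = coeff f i

  infix  4 _≈ᴾ_ _∣ᴾ_
  infixl 6 _+ᴾ_
  infixl 7 _*ᴾ_
  infixr 8 _^ᴾ_

  _≈ᴾ_ : Poly → Poly → Set ℓ
  f ≈ᴾ g = ∀ i → coeff f i ≈ coeff g i

  1ᴾ : Poly
  1ᴾ = 1# ∷ []

  _+ᴾ_ : Poly → Poly → Poly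
  []      +ᴾ g       = g
  (a ∷ f) +ᴾ []      = a ∷ f
  (a ∷ f) +ᴾ (b ∷ g) = (a + b) ∷ (f +ᴾ g)

  scale : Carrier → Poly → Poly
  scale a = map (a *_)

  _*ᴾ_ : Poly → Poly → Poly
  []      *ᴾ g = []
  (a ∷ f) *ᴾ g = scale a g +ᴾ (0# ∷ (f *ᴾ g))

  _^ᴾ_ : Poly → ℕ → Poly
  f ^ᴾ zero  = 1ᴾ
  f ^ᴾ suc n = f *ᴾ (f ^ᴾ n)

  eval : Poly → Carrier → Carrier
  eval []      x = 0#
  eval (a ∷ f) x = a + x * eval f x

  _∣ᴾ_ : Poly → Poly → Set (c ⊔ ℓ)
  f ∣ᴾ g = ∃[ q ] q *ᴾ f ≈ᴾ g

  Coprime : Poly → Poly → Set (c ⊔ ℓ)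
  Coprime f g = ∀ d → d ∣ᴾ f → d ∣ᴾ g → d ∣ᴾ 1ᴾ

  HasDegree : Poly → ℕ → Set ℓ
  HasDegree f n = ¬ coeff f n ≈ 0# × (∀ i → n ℕ.< i → coeff f i ≈ 0#)

  Monic : Poly → Set ℓ
  Monic f = ∃[ n ] HasDegree f n × coeff f n ≈ 1#

-- The prime subfield when R is a field of characteristic p > 0: the image of ℕ.
module PrimeSubfield {c ℓ} (R : CommutativeRing c ℓ) where
  open CommutativeRing R hiding (_*_)
  open Mult semiring using () renaming (_×_ to _·_)

  ι : ℕ → Carrier
  ι n = n · 1#

  InPrimeField : Carrier → Set ℓ
  InPrimeField x = ∃[ n ] x ≈ ι n

-- An algebraic closure of 𝔽ₚ (p prime).  𝔽ₚ itself is its prime subfield.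
record AlgebraicClosure𝔽 (c ℓ : Level) (p : ℕ) : Set (lsuc (c ⊔ ℓ)) where
  field
    commutativeRing : CommutativeRing c ℓ

  open CommutativeRing commutativeRing
  open Polynomial commutativeRing
  open PrimeSubfield commutativeRing

  field
    _≟_       : Decidable _≈_
    1≉0       : ¬ 1# ≈ 0#
    inverse   : ∀ x → ¬ x ≈ 0# → ∃[ y ] x * y ≈ 1#
    char-p    : ι p ≈ 0#
    closed    : ∀ f n → HasDegree f (suc n) → ∃[ x ] eval f x ≈ 0#
    algebraic : ∀ x → ∃[ f ] (∃[ n ] HasDegree f n)
                           × (∀ i → InPrimeField (coeff f i))
                           × eval f x ≈ 0#

module SupersingularGraphs {c ℓ : Level} (p : ℕ) (K : AlgebraicClosure𝔽 c ℓ p) where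
  open AlgebraicClosure𝔽 K
  open CommutativeRing commutativeRing renaming (Carrier to ∣K∣)
  open Polynomial commutativeRing
  open PrimeSubfield commutativeRing
  open Exp commutativeSemiring using (_^_; ^-congˡ; ^-distrib-*)

  infixl 7 _/_

  -- Total division, with the usual convention x / 0 = 0.
  _/_ : ∣K∣ → ∣K∣ → ∣K∣
  x / y with y ≟ 0#
  ... | yes _   = 0#
  ... | no  y≉0 = x * proj₁ (inverse y y≉0)

  -- Elliptic curves y² = x³ + Ax + B.  Since p > 3, every elliptic curve
  -- over 𝔽ₚ or its closure has a model of this shape.

  record Weierstrass : Set c where
    constructor weierstrass
    field A B : ∣K∣

  open Weierstrass public

  disc : Weierstrass → ∣K∣
  disc E = ι 4 * A E ^ 3 + ι 27 * B E ^ 2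

  IsElliptic : Weierstrass → Set ℓ
  IsElliptic E = ¬ disc E ≈ 0#

  jInv : Weierstrass → ∣K∣
  jInv E = (ι 1728 * (ι 4 * A E ^ 3)) / disc E

  cubic : Weierstrass → Poly
  cubic E = B E ∷ A E ∷ 0# ∷ 1# ∷ []

  data Point : Set c where
    ∞   : Point
    aff : ∣K∣ → ∣K∣ → Point

  data _≈ₚ_ : Point → Point → Set (c ⊔ ℓ) where
    ∞   : ∞ ≈ₚ ∞
    aff : ∀ {x y x′ y′} → x ≈ x′ → y ≈ y′ → aff x y ≈ₚ aff x′ y′

  data _∈ₑ_ : Point → Weierstrass → Set (c ⊔ ℓ) where
    ∞   : ∀ {E} → ∞ ∈ₑ E
    aff : ∀ {E x y} → y ^ 2 ≈ x ^ 3 + A E * x + B E → aff x y ∈ₑ E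

  -- Third point of the line of slope m through aff x₁ y₁ and a point with
  -- abscissa x₂, reflected in the x-axis.
  chord : ∣K∣ → ∣K∣ → ∣K∣ → ∣K∣ → Point
  chord m x₁ y₁ x₂ = aff x₃ (m * (x₁ - x₃) - y₁)
    where x₃ = m ^ 2 - x₁ - x₂

  add : Weierstrass → Point → Point → Point
  add E ∞ Q = Q
  add E P@(aff _ _) ∞ = P
  add E (aff x₁ y₁) (aff x₂ y₂) with x₁ ≟ x₂ | y₁ ≟ (- y₂)
  ... | yes _ | yes _ = ∞
  ... | yes _ | no  _ = chord ((ι 3 * x₁ ^ 2 + A E) / (ι 2 * y₁)) x₁ y₁ x₂
  ... | no  _ | _     = chord ((y₂ - y₁) / (x₂ - x₁)) x₁ y₁ x₂

  mult : Weierstrass → ℕ → Point → Point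
  mult E zero    P = ∞
  mult E (suc n) P = add E P (mult E n P)

  -- E[p] is trivial over the algebraic closure.
  Supersingular : Weierstrass → Set (c ⊔ ℓ)
  Supersingular E = ∀ P → P ∈ₑ E → mult E p P ≡ ∞ → P ≡ ∞

  -- 𝔽ₚ-isomorphisms (x , y) ↦ (u²x , u³y) with u ∈ 𝔽ₚˣ

  record _≅_ (E E′ : Weierstrass) : Set (c ⊔ ℓ) where
    field
      u u⁻¹   : ∣K∣
      u∈𝔽ₚ    : InPrimeField u
      u⁻¹∈𝔽ₚ  : InPrimeField u⁻¹
      inv     : u * u⁻¹ ≈ 1#
      A-eq    : A E′ ≈ u ^ 4 * A E
      B-eq    : B E′ ≈ u ^ 6 * B E

  isoMap : ∀ {E E′} → E ≅ E′ → Point → Point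
  isoMap α ∞         = ∞
  isoMap α (aff x y) = aff (u ^ 2 * x) (u ^ 3 * y)
    where
    open _≅_ α

  private
    module M = Mult semiring
    open SetoidReasoning setoid

    1^ : ∀ n → 1# ^ n ≈ 1#
    1^ zero    = refl
    1^ (suc n) = trans (*-identityˡ _) (1^ n)

    ∈-* : ∀ {x y} → InPrimeField x → InPrimeField y → InPrimeField (x * y)
    ∈-* (m , e) (n , f) = m ℕ.* n , trans (*-cong e f) (sym (M.×1-homo-* m n))

    scale-refl : ∀ n a → a ≈ 1# ^ n * a
    scale-refl n a = sym (trans (*-congʳ (1^ n)) (*-identityˡ a))

    scale-sym : ∀ n {x y a b} → x * y ≈ 1# → b ≈ x ^ n * a → a ≈ y ^ n * b
    scale-sym n {x} {y} {a} {b} xy eq = sym (begin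
      y ^ n * b             ≈⟨ *-congˡ eq ⟩
      y ^ n * (x ^ n * a)   ≈⟨ *-assoc _ _ _ ⟨
      (y ^ n * x ^ n) * a   ≈⟨ *-congʳ (^-distrib-* y x n) ⟨
      (y * x) ^ n * a       ≈⟨ *-congʳ (^-congˡ n (trans (*-comm y x) xy)) ⟩
      1# ^ n * a            ≈⟨ scale-refl n a ⟨
      a                     ∎)

    scale-trans : ∀ n {x y a b d} → b ≈ x ^ n * a → d ≈ y ^ n * b → d ≈ (y * x) ^ n * a
    scale-trans n {x} {y} {a} {b} {d} eq eq′ = begin
      d                     ≈⟨ eq′ ⟩
      y ^ n * b             ≈⟨ *-congˡ eq ⟩
      y ^ n * (x ^ n * a)   ≈⟨ *-assoc _ _ _ ⟨
      (y ^ n * x ^ n) * a   ≈⟨ *-congʳ (^-distrib-* y x n) ⟨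
      (y * x) ^ n * a       ∎

    inv-trans : ∀ {x x′ y y′} → x * x′ ≈ 1# → y * y′ ≈ 1# → (y * x) * (x′ * y′) ≈ 1#
    inv-trans {x} {x′} {y} {y′} e f = begin
      (y * x) * (x′ * y′)   ≈⟨ *-assoc y x _ ⟩
      y * (x * (x′ * y′))   ≈⟨ *-congˡ (*-assoc x x′ y′) ⟨
      y * ((x * x′) * y′)   ≈⟨ *-congˡ (trans (*-congʳ e) (*-identityˡ y′)) ⟩
      y * y′                ≈⟨ f ⟩
      1#                    ∎

    1∈ : InPrimeField 1#
    1∈ = 1 , sym (M.×-homo-1 1#)

  ≅-refl : ∀ {E} → E ≅ E
  ≅-refl = record
    { u = 1# ; u⁻¹ = 1# ; u∈𝔽ₚ = 1∈ ; u⁻¹∈𝔽ₚ = 1∈ ; inv = *-identityˡ 1#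
    ; A-eq = scale-refl 4 _ ; B-eq = scale-refl 6 _ }

  ≅-sym : ∀ {E F} → E ≅ F → F ≅ E
  ≅-sym α = record
    { u = α .u⁻¹ ; u⁻¹ = α .u ; u∈𝔽ₚ = α .u⁻¹∈𝔽ₚ ; u⁻¹∈𝔽ₚ = α .u∈𝔽ₚ
    ; inv = trans (*-comm (α .u⁻¹) (α .u)) (α .inv)
    ; A-eq = scale-sym 4 (α .inv) (α .A-eq) ; B-eq = scale-sym 6 (α .inv) (α .B-eq) }
    where
    open _≅_

  ≅-trans : ∀ {E F G} → E ≅ F → F ≅ G → E ≅ G
  ≅-trans α β = record
    { u = β .u * α .u ; u⁻¹ = α .u⁻¹ * β .u⁻¹
    ; u∈𝔽ₚ = ∈-* (β .u∈𝔽ₚ) (α .u∈𝔽ₚ) ; u⁻¹∈𝔽ₚ = ∈-* (α .u⁻¹∈𝔽ₚ) (β .u⁻¹∈𝔽ₚ)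
    ; inv = inv-trans (α .inv) (β .inv)
    ; A-eq = scale-trans 4 (α .A-eq) (β .A-eq) ; B-eq = scale-trans 6 (α .B-eq) (β .B-eq) }
    where
    open _≅_

  ≅-isEquivalence : IsEquivalence _≅_
  ≅-isEquivalence = record { refl = ≅-refl ; sym = ≅-sym ; trans = ≅-trans }

  -- Isogenies over the closure, in standard form
  --   (x , y) ↦ (u(x) / v(x) , y · s(x) / t(x))
  -- with both fractions in lowest terms and monic denominators, so that u, v,
  -- s, t are determined by the map.  Every isogeny has this form;
  -- deg v < deg u says that the map is non-constant and fixes the point at
  -- infinity.

  record Isogeny (E E′ : Weierstrass) : Set (c ⊔ ℓ) where
    field
      u v s t       : Poly
      degᵤ degᵥ     : ℕ
      degree-u      : HasDegree u degᵤ
      degree-v      : HasDegree v degᵥ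
      degᵥ<degᵤ     : degᵥ ℕ.< degᵤ
      v-monic       : Monic v
      t-monic       : Monic t
      u-v-coprime   : Coprime u v
      s-t-coprime   : Coprime s t
      -- E′ is satisfied by the image of the generic point, denominators
      -- cleared and y² replaced by the cubic of E.
      equation      : s ^ᴾ 2 *ᴾ cubic E *ᴾ v ^ᴾ 3
                        ≈ᴾ t ^ᴾ 2 *ᴾ (u ^ᴾ 3 +ᴾ scale (A E′) (u *ᴾ v ^ᴾ 2) +ᴾ scale (B E′) (v ^ᴾ 3))

    degree : ℕ
    degree = degᵤ ℕ.⊔ degᵥ

    -- On E, t(x) = 0 only if v(x) = 0, so the junk value of _/_ is not used.
    apply : Point → Point
    apply ∞ = ∞
    apply (aff x y) with eval v x ≟ 0#
    ... | yes _ = ∞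
    ... | no  _ = aff (eval u x / eval v x) (y * (eval s x / eval t x))

    DefinedOver𝔽ₚ : Set ℓ
    DefinedOver𝔽ₚ = ∀ i → InPrimeField (coeff u i) × InPrimeField (coeff v i)
                        × InPrimeField (coeff s i) × InPrimeField (coeff t i)

  -- Isomorphism classes are represented by curves, with equality _≈ᵛ_.
  record Vertex : Set (c ⊔ ℓ) where
    field
      curve         : Weierstrass
      A∈𝔽ₚ          : InPrimeField (A curve)
      B∈𝔽ₚ          : InPrimeField (B curve)
      elliptic      : IsElliptic curve
      supersingular : Supersingular curve

  open Vertex public using (curve)

  j : Vertex → ∣K∣
  j v = jInv (curve v)

  vertexSetoid : Setoid (c ⊔ ℓ) (c ⊔ ℓ)
  vertexSetoid = record
    { Carrier       = Vertex
    ; _≈_           = λ v w → curve v ≅ curve w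
    ; isEquivalence = On.isEquivalence curve ≅-isEquivalence
    }

  open Setoid vertexSetoid public using () renaming (_≈_ to _≈ᵛ_)

  record Edge : Set (c ⊔ ℓ) where
    field
      source target : Vertex
      isogeny       : Isogeny (curve source) (curve target)
      degree-2      : Isogeny.degree isogeny ≡ 2
      over-𝔽ₚ       : Isogeny.DefinedOver𝔽ₚ isogeny

    ⟦_⟧ : Point → Point
    ⟦_⟧ = Isogeny.apply isogeny

  open Edge public

  -- Commuting squares are tested on points over the (infinite) closure, which
  -- is the same as equality of isogenies.
  record IsomorphicEdges (e f : Edge) : Set (c ⊔ ℓ) where
    field
      α       : source e ≈ᵛ source f
      β       : target e ≈ᵛ target f
      commute : ∀ P → P ∈ₑ curve (source e) →
                isoMap β (⟦ e ⟧ P) ≈ₚ ⟦ f ⟧ (isoMap α P)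

  -- f is the dual of e, up to 𝔽ₚ-isomorphisms of the end points.
  record DualEdges (e f : Edge) : Set (c ⊔ ℓ) where
    field
      α       : target e ≈ᵛ source f
      β       : target f ≈ᵛ source e
      dual    : ∀ P → P ∈ₑ curve (source e) →
                isoMap β (⟦ f ⟧ (isoMap α (⟦ e ⟧ P))) ≈ₚ mult (curve (source e)) 2 P

  edgeSetoid : Setoid (c ⊔ ℓ) (c ⊔ ℓ)
  edgeSetoid = EqC.setoid (λ e f → IsomorphicEdges e f ⊎ DualEdges e f)

  Joins : Edge → Vertex → Vertex → Set (c ⊔ ℓ)
  Joins e v w = (source e ≈ᵛ v × target e ≈ᵛ w) ⊎ (source e ≈ᵛ w × target e ≈ᵛ v)

  Adjacent : Vertex → Vertex → Set (c ⊔ ℓ)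
  Adjacent v w = ∃[ e ] Joins e v w

  Connected : Vertex → Vertex → Set (c ⊔ ℓ)
  Connected = EqClosure (λ v w → v ≈ᵛ w ⊎ Adjacent v w)

  -- A connected component is given by any one of its vertices; two of them are
  -- the same component when these vertices are connected.
  Component : Set (c ⊔ ℓ)
  Component = Vertex

  _∈_ : Vertex → Component → Set (c ⊔ ℓ)
  v ∈ V = Connected v V

  Distinct : Component → Component → Set (c ⊔ ℓ)
  Distinct V W = ¬ Connected V W

  verticesOf : Component → Setoid (c ⊔ ℓ) (c ⊔ ℓ)
  verticesOf V = On.setoid vertexSetoid (proj₁ {B = _∈ V})

  edgesOf : Component → Setoid (c ⊔ ℓ) (c ⊔ ℓ)
  edgesOf V = On.setoid edgeSetoid (proj₁ {B = λ e → source e ∈ V × target e ∈ V})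

  IsSupersingularJ : ∣K∣ → Set (c ⊔ ℓ)
  IsSupersingularJ a = ∃[ E ] IsElliptic E × Supersingular E × jInv E ≈ a

  InSpine : ∣K∣ → Set (c ⊔ ℓ)
  InSpine a = InPrimeField a × IsSupersingularJ a

  -- The classical modular polynomial
  --   Φ₂(X,Y) = X³ + Y³ - X²Y² + 1488 (X²Y + XY²) - 162000 (X² + Y²)
  --             + 40773375 XY + 8748000000 (X + Y) - 157464000000000
  -- at X = a, as a polynomial in Y.
  Φ₂ : ∣K∣ → Poly
  Φ₂ a = (a ^ 3 - ι 162000 * a ^ 2 + ι 8748000000 * a - ι 157464000000000)
       ∷ (ι 1488 * a ^ 2 + ι 40773375 * a + ι 8748000000)
       ∷ (- (a ^ 2) + ι 1488 * a - ι 162000)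
       ∷ 1#
       ∷ []

  -- The number of i with (Y - b)ⁱ⁺¹ ∣ Φ₂(a,Y) is the multiplicity of the root
  -- b, so the indices i count the edges from a to b.
  Edgeᴷ : ∣K∣ → ∣K∣ → Set (c ⊔ ℓ)
  Edgeᴷ a b = Σ ℕ λ i → ((- b) ∷ 1# ∷ []) ^ᴾ suc i ∣ᴾ Φ₂ a

  record LabelledIsomorphism (V W : Component) : Set (c ⊔ ℓ) where
    field
      vertices  : Inverse (verticesOf V) (verticesOf W)
      edges     : Inverse (edgesOf V) (edgesOf W)

    onVertices : Σ Vertex (_∈ V) → Vertex
    onVertices v = proj₁ (Inverse.to vertices v)

    field
      labels    : ∀ v → j (onVertices v) ≈ j (proj₁ v)
      incidence : ∀ e (s∈ : source e ∈ V) (t∈ : target e ∈ V) →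
                  Joins (proj₁ (Inverse.to edges (e , s∈ , t∈)))
                        (onVertices (source e , s∈)) (onVertices (target e , t∈))

  Stack : Component → Component → Set (c ⊔ ℓ)
  Stack V W = Distinct V W × LabelledIsomorphism V W

  -- w is a short model of d y² = x³ + Ax + B for a non-square d of 𝔽ₚ.
  IsQuadraticTwist : Vertex → Vertex → Set (c ⊔ ℓ)
  IsQuadraticTwist v w =
    ∃[ d ] InPrimeField d × (∀ r → InPrimeField r → ¬ r ^ 2 ≈ d)
         × (weierstrass (d ^ 2 * A (curve v)) (d ^ 3 * B (curve v)) ≅ curve w)

  Folds : Component → Set (c ⊔ ℓ)
  Folds V = ∀ v → v ∈ V → ∃[ w ] IsQuadraticTwist v w × w ∈ V

  NewEdge : ∣K∣ → ∣K∣ → Set (c ⊔ ℓ)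
  NewEdge a b = InSpine a × InSpine b × ¬ a ≈ b × Edgeᴷ a b
              × ¬ (∃[ v ] ∃[ w ] j v ≈ a × j w ≈ b × Adjacent v w)

  AttachedByNewEdge : Component → Component → ∣K∣ → ∣K∣ → Set (c ⊔ ℓ)
  AttachedByNewEdge V W a b =
    NewEdge a b ×
    (∃[ v ] ∃[ w ] v ∈ V × j v ≈ a × w ∈ W × j w ≈ b ×
      Σ (Isogeny (curve v) (curve w)) λ φ →
        Isogeny.degree φ ≡ 2 × ¬ Isogeny.DefinedOver𝔽ₚ φ)

  HasNeighbourUnlike : Vertex → Vertex → Set (c ⊔ ℓ)
  HasNeighbourUnlike v w =
    ∃[ v′ ] Adjacent v v′ × (∀ w′ → Adjacent w w′ → ¬ j v′ ≈ j w′)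

  AttachAlong : Component → Component → ∣K∣ → Set (c ⊔ ℓ)
  AttachAlong V W a =
    Distinct V W ×
    (∃[ v ] ∃[ w ] v ∈ V × j v ≈ a × w ∈ W × j w ≈ a ×
      HasNeighbourUnlike v w × HasNeighbourUnlike w v)

  SameUnorderedPair : ∣K∣ → ∣K∣ → ∣K∣ → ∣K∣ → Set ℓ
  SameUnorderedPair a b a′ b′ = (a ≈ a′ × b ≈ b′) ⊎ (a ≈ b′ × b ≈ a′)

{-# OPTIONS --safe #-}
module Submission where

-- In coordinates centred at a root r of the cubic of E, a degree-2 isogeny out
-- of E becomes a polynomial identity whose only nonsingular solutions are
-- Vélu's quotient by (r , 0), scaled by some δ, and it is defined over 𝔽ₚ iff
-- r and δ are.  Vélu's map is a homomorphism and has a dual of the same shape,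
-- so supersingularity passes to neighbours, and connectedness is decidable
-- because there are finitely many curves over 𝔽ₚ.
--
-- Twisting by a nonsquare is an automorphism of the graph preserving j.  A
-- component connected to its twist folds; otherwise it stacks with its twist.
--
-- Two vertices with the same j ≠ 0, 1728 are twists of each other, hence have
-- neighbours with the same j; all neighbours of j = 0 have j = 54000, and those
-- of j = 1728 have j = 1728 or 287496.  So nothing attaches along a j-invariant.
--
-- A new edge [a , b] comes from a root r ∉ 𝔽ₚ.  Its conjugate rᵖ also leads to
-- b, and equality of the two j-invariants factors.  The factors vanish only for
-- a singular curve, for a = 0 or 1728 (where b is also reached over 𝔽ₚ), for
-- a = b = -3375, or if a and b are the two roots of the Hilbert class
-- polynomial of discriminant -15, which determines {a , b}.

open import Defs
open import Level using (Level)
open import Algebra.Bundles using (CommutativeRing)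
import Algebra.Properties.CommutativeSemigroup as CommutativeSemigroupProperties
import Algebra.Properties.CommutativeSemiring.Binomial as Binomial
import Algebra.Properties.CommutativeSemiring.Exp as Exp
import Algebra.Properties.Monoid.Sum as Sum
import Algebra.Properties.Ring as RingProperties
import Algebra.Properties.Semiring.Mult as Mult
open import Data.Bool.Base as Bool using (Bool; true; _∧_)
open import Data.Empty using (⊥; ⊥-elim)
open import Data.Fin.Base using (Fin; zero; suc; toℕ; fromℕ; fromℕ<; inject₁)
open import Data.Fin.Properties using (any?; toℕ<n; toℕ-fromℕ; toℕ-fromℕ<; toℕ-inject₁)
open import Data.List.Base using (List; []; _∷_; length; applyUpTo; cartesianProductWith)
open import Data.List.Membership.Propositional using (_∈_)
open import Data.List.Membership.Propositional.Properties using (∈-applyUpTo⁺; ∈-applyUpTo⁻; ∈-cartesianProductWith⁺; ∈-cartesianProductWith⁻)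
open import Data.List.Properties using (length-applyUpTo)
open import Data.List.Relation.Unary.All as All using (All; []; _∷_)
import Data.List.Relation.Unary.All.Properties as All
open import Data.List.Relation.Unary.AllPairs using (AllPairs; []; _∷_)
import Data.List.Relation.Unary.AllPairs.Properties as AllPairs
open import Data.List.Relation.Unary.Any using (here; there)
open import Data.Nat.Base as ℕ using (ℕ; zero; suc; z≤n; s≤s; _!; _<_)
open import Data.Nat.Combinatorics using (_C_; k![n∸k]!∣n!; nCk≡n!/k![n-k]!; nCn≡1)
open import Data.Nat.Coprimality using (prime⇒coprime; coprime-Bézout)
open import Data.Nat.Divisibility as ℕ using (_∣_; divides)
open import Data.Nat.DivMod as ℕ using (m≡m%n+[m/n]*n; m%n<n; m/n*n≡m)
open import Data.Nat.GCD using (module Bézout)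
open import Data.Nat.Primality using (Prime; prime⇒irreducible; euclidsLemma; prime⇒nonZero; prime⇒nonTrivial)
import Data.Nat.Properties as ℕ
open import Data.Product using (∃-syntax; _×_; _,_; proj₁; proj₂)
open import Data.Sum using (_⊎_; inj₁; inj₂; [_,_]′)
open import Data.Unit.Base using (tt)
open import Data.Vec.Base as Vec using (Vec; []; _∷_; lookup; allFin)
open import Data.Vec.N-ary using (N-ary; _$ⁿ_; curryⁿ; ∀ⁿ)
open import Relation.Binary.Bundles using (Setoid)
import Relation.Binary.Construct.Closure.Equivalence as EqC
open import Relation.Binary.Construct.Closure.ReflexiveTransitive as Star using (_◅_)
open import Relation.Binary.Construct.Closure.Symmetric using (SymClosure; fwd; bwd)
open import Relation.Binary.Definitions using (Decidable)
open import Relation.Binary.PropositionalEquality as ≡ using (_≡_)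
import Relation.Binary.Reasoning.Setoid as SetoidReasoning
open import Relation.Nullary using (¬_; yes; no; Dec; contradiction)
open import Relation.Nullary.Decidable using (map′; decidable-stable; _×-dec_; _⊎-dec_; ¬?)

-- The exceptional cases in the last step come from complex multiplication. The quotient of E by (r
-- , 0), followed by the dual of the quotient by the conjugate root, is an endomorphism of degree 4
-- other than 2 and -2, so its trace t satisfies t² < 16. The discriminants t² - 16 are -16, -15,
-- -12 and -7. The first and third account for j = 1728 and j = 0, the last for the loop at -3375;
-- only -15, of class number 2, leaves two different j-invariants. The code uses no endomorphism
-- rings: it finds the same cases as factors of one polynomial in two roots of the cubic.
--
-- An isogeny is given by arbitrary fractions, with no theory of kernels or duals behind it, so
-- degree 2 is classified by cancelling linear factors and comparing coefficients. Supersingularity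
-- speaks of p-torsion points, so carrying it along an edge takes a genuine homomorphism for the
-- addition law with all its case distinctions.

-- Certificates for polynomial identities

module Expressions where

  infixl 6 _:+_ _:-_
  infixl 7 _:*_
  infixr 9 _:^_
  infix  8 :-_
  infix  4 _:=_
  infix  3 _by_ _⊢_

  -- `con 1` denotes `1# + 0#`; the separate `:1` denotes the `1#` that occurs in goals.
  data Expr (n : ℕ) : Set where
    var  : Fin n → Expr n
    :1   : Expr n
    con  : ℕ → Expr n
    _:+_ : Expr n → Expr n → Expr n
    _:*_ : Expr n → Expr n → Expr n
    :-_  : Expr n → Expr n
    _:^_ : Expr n → ℕ → Expr n

  _:-_ : ∀ {n} → Expr n → Expr n → Expr n
  e :- f = e :+ (:- f)

  data Equation (n : ℕ) : Set where
    _:=_ : Expr n → Expr n → Equation n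

  -- An equation together with the cofactor by which it enters a derivation.
  data Hypothesis (n : ℕ) : Set where
    _by_ : Expr n → Equation n → Hypothesis n

  data Entailment (n : ℕ) : Set where
    _⊢_ : List (Hypothesis n) → Equation n → Entailment n

  -- Dense polynomials in n variables; the pair (a , b) stands for a - b.
  Normal : ℕ → Set
  Normal zero    = ℕ × ℕ
  Normal (suc n) = List (Normal n)

  const : ∀ n → ℕ → Normal n
  const zero    k = k , 0
  const (suc n) k = const n k ∷ []

  variable′ : ∀ {n} → Fin n → Normal n
  variable′ {suc n} zero    = const n 0 ∷ const n 1 ∷ []
  variable′ {suc n} (suc i) = variable′ i ∷ []

  -- The list versions make termination visible: entering a coefficient lowers the number of
  -- variables, and at a fixed level the list shrinks.
  mutual
    plus : ∀ n → Normal n → Normal n → Normal n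
    plus zero    (a , b) (c , d) = (a ℕ.+ c) , (b ℕ.+ d)
    plus (suc n) f       g       = plusᴸ n f g

    plusᴸ : ∀ n → List (Normal n) → List (Normal n) → List (Normal n)
    plusᴸ n []      g       = g
    plusᴸ n (a ∷ f) []      = a ∷ f
    plusᴸ n (a ∷ f) (b ∷ g) = plus n a b ∷ plusᴸ n f g

  mutual
    minus : ∀ n → Normal n → Normal n
    minus zero    (a , b) = b , a
    minus (suc n) f       = minusᴸ n f

    minusᴸ : ∀ n → List (Normal n) → List (Normal n)
    minusᴸ n []      = []
    minusᴸ n (a ∷ f) = minus n a ∷ minusᴸ n f

  mutual
    times : ∀ n → Normal n → Normal n → Normal n
    times zero    (a , b) (c , d) = (a ℕ.* c ℕ.+ b ℕ.* d) , (a ℕ.* d ℕ.+ b ℕ.* c)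
    times (suc n) f       g       = timesᴸ n f g

    timesᴸ : ∀ n → List (Normal n) → List (Normal n) → List (Normal n)
    timesᴸ n []      g = []
    timesᴸ n (a ∷ f) g = plusᴸ n (scaleᴸ n a g) (const n 0 ∷ timesᴸ n f g)

    scaleᴸ : ∀ n → Normal n → List (Normal n) → List (Normal n)
    scaleᴸ n a []      = []
    scaleᴸ n a (b ∷ g) = times n a b ∷ scaleᴸ n a g

  power : ∀ n → Normal n → ℕ → Normal n
  power n f zero    = const n 1
  power n f (suc k) = times n f (power n f k)

  mutual
    isZero : ∀ n → Normal n → Bool
    isZero zero    (a , b) = a ℕ.≡ᵇ b
    isZero (suc n) f       = isZeroᴸ n f

    isZeroᴸ : ∀ n → List (Normal n) → Bool
    isZeroᴸ n []      = true
    isZeroᴸ n (a ∷ f) = isZero n a ∧ isZeroᴸ n f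

  normalise : ∀ {n} → Expr n → Normal n
  normalise         (var i)  = variable′ i
  normalise {n = n} :1       = const n 1
  normalise {n = n} (con k)  = const n k
  normalise {n = n} (e :+ f) = plus n (normalise e) (normalise f)
  normalise {n = n} (e :* f) = times n (normalise e) (normalise f)
  normalise {n = n} (:- e)   = minus n (normalise e)
  normalise {n = n} (e :^ k) = power n (normalise e) k

  combination : ∀ {n} → List (Hypothesis n) → Expr n
  combination []                    = con 0
  combination ((c by (l := r)) ∷ hs) = c :* (l :- r) :+ combination hs

  -- The certificate is checked once as an identity over the integers in independent unknowns, and
  -- so specialises to every commutative ring.
  valid : ∀ {n} → Entailment n → Bool
  valid {n} (hs ⊢ l := r) = isZero n (normalise ((l :- r) :- combination hs))

  close : ∀ n → N-ary n (Expr n) (Entailment n) → Entailment n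
  close n f = f $ⁿ Vec.map var (allFin n)

-- Soundness of the certificates

module CommutativeRingSolver {c ℓ} (R : CommutativeRing c ℓ) where
  open CommutativeRing R hiding (zero)
  open Expressions public using (Expr; var; :1; con; _:+_; _:*_; :-_; _:^_; _:-_; Equation; _:=_; Hypothesis; _by_; Entailment; _⊢_)
  open Expressions hiding (Expr; var; :1; con; _:+_; _:*_; :-_; _:^_; _:-_; Equation; _:=_; Hypothesis; _by_; Entailment; _⊢_)
  open Mult semiring using () renaming (_×_ to _·_)
  open Exp commutativeSemiring using (_^_; ^-congˡ)
  open RingProperties ring using (-0#≈0#; -‿+-comm; -‿distribˡ-*; -‿distribʳ-*; -‿involutive; x∙y⁻¹≈ε⇒x≈y; x≈y⇒x∙y⁻¹≈ε)
  open CommutativeSemigroupProperties +-commutativeSemigroup using (interchange; x∙yz≈y∙xz)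
  open SetoidReasoning setoid
  private
    module M = Mult semiring
    module * = CommutativeSemigroupProperties *-commutativeSemigroup

  ⟦_⟧ : ∀ {n} → Expr n → Vec Carrier n → Carrier
  ⟦ var i ⟧  ρ = lookup ρ i
  ⟦ :1 ⟧     ρ = 1#
  ⟦ con k ⟧  ρ = k · 1#
  ⟦ e :+ f ⟧ ρ = ⟦ e ⟧ ρ + ⟦ f ⟧ ρ
  ⟦ e :* f ⟧ ρ = ⟦ e ⟧ ρ * ⟦ f ⟧ ρ
  ⟦ :- e ⟧   ρ = - ⟦ e ⟧ ρ
  ⟦ e :^ k ⟧ ρ = ⟦ e ⟧ ρ ^ k

  private
    mutual
      ⟦_⟧ⁿ : ∀ {n} → Normal n → Vec Carrier n → Carrier
      ⟦_⟧ⁿ {zero}  (a , b) ρ       = a · 1# - b · 1#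
      ⟦_⟧ⁿ {suc n} f       (x ∷ ρ) = ⟦ f ⟧ᴸ x ρ

      ⟦_⟧ᴸ : ∀ {n} → List (Normal n) → Carrier → Vec Carrier n → Carrier
      ⟦ [] ⟧ᴸ    x ρ = 0#
      ⟦ a ∷ f ⟧ᴸ x ρ = ⟦ a ⟧ⁿ ρ + x * ⟦ f ⟧ᴸ x ρ

    const-correct : ∀ n k ρ → ⟦ const n k ⟧ⁿ ρ ≈ k · 1#
    const-correct zero    k ρ       = trans (+-congˡ -0#≈0#) (+-identityʳ _)
    const-correct (suc n) k (x ∷ ρ) = trans (+-cong (const-correct n k ρ) (zeroʳ x)) (+-identityʳ _)

    variable-correct : ∀ {n} (i : Fin n) ρ → ⟦ variable′ i ⟧ⁿ ρ ≈ lookup ρ i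
    variable-correct {suc n} zero (x ∷ ρ) = begin
      ⟦ const n 0 ⟧ⁿ ρ + x * (⟦ const n 1 ⟧ⁿ ρ + x * 0#)
        ≈⟨ +-cong (const-correct n 0 ρ) (*-congˡ (+-cong (const-correct n 1 ρ) (zeroʳ x))) ⟩
      0# + x * (1 · 1# + 0#)
        ≈⟨ +-identityˡ _ ⟩
      x * (1 · 1# + 0#)
        ≈⟨ *-congˡ (trans (+-identityʳ _) (+-identityʳ _)) ⟩
      x * 1#
        ≈⟨ *-identityʳ x ⟩
      x ∎
    variable-correct (suc i) (x ∷ ρ) =
      trans (+-cong (variable-correct i ρ) (zeroʳ x)) (+-identityʳ _)

    mutual
      plus-correct : ∀ n f g ρ → ⟦ plus n f g ⟧ⁿ ρ ≈ ⟦ f ⟧ⁿ ρ + ⟦ g ⟧ⁿ ρ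
      plus-correct zero (a , b) (c , d) ρ = begin
        (a ℕ.+ c) · 1# - (b ℕ.+ d) · 1#
          ≈⟨ +-cong (M.×-homo-+ 1# a c) (trans (-‿cong (M.×-homo-+ 1# b d)) (sym (-‿+-comm _ _))) ⟩
        (a · 1# + c · 1#) + (- (b · 1#) + - (d · 1#))
          ≈⟨ interchange _ _ _ _ ⟩
        (a · 1# - b · 1#) + (c · 1# - d · 1#) ∎
      plus-correct (suc n) f g (x ∷ ρ) = plusᴸ-correct n f g x ρ

      plusᴸ-correct : ∀ n f g x ρ → ⟦ plusᴸ n f g ⟧ᴸ x ρ ≈ ⟦ f ⟧ᴸ x ρ + ⟦ g ⟧ᴸ x ρ
      plusᴸ-correct n []      g       x ρ = sym (+-identityˡ _)
      plusᴸ-correct n (a ∷ f) []      x ρ = sym (+-identityʳ _)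
      plusᴸ-correct n (a ∷ f) (b ∷ g) x ρ = begin
        ⟦ plus n a b ⟧ⁿ ρ + x * ⟦ plusᴸ n f g ⟧ᴸ x ρ
          ≈⟨ +-cong (plus-correct n a b ρ) (trans (*-congˡ (plusᴸ-correct n f g x ρ)) (distribˡ x _ _)) ⟩
        (⟦ a ⟧ⁿ ρ + ⟦ b ⟧ⁿ ρ) + (x * ⟦ f ⟧ᴸ x ρ + x * ⟦ g ⟧ᴸ x ρ)
          ≈⟨ interchange _ _ _ _ ⟩
        ⟦ a ∷ f ⟧ᴸ x ρ + ⟦ b ∷ g ⟧ᴸ x ρ ∎

    mutual
      minus-correct : ∀ n f ρ → ⟦ minus n f ⟧ⁿ ρ ≈ - ⟦ f ⟧ⁿ ρ
      minus-correct zero (a , b) ρ = begin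
        b · 1# - a · 1#         ≈⟨ +-comm _ _ ⟩
        - (a · 1#) + b · 1#     ≈⟨ +-congˡ (-‿involutive _) ⟨
        - (a · 1#) + - - (b · 1#) ≈⟨ -‿+-comm _ _ ⟩
        - (a · 1# - b · 1#)     ∎
      minus-correct (suc n) f (x ∷ ρ) = minusᴸ-correct n f x ρ

      minusᴸ-correct : ∀ n f x ρ → ⟦ minusᴸ n f ⟧ᴸ x ρ ≈ - ⟦ f ⟧ᴸ x ρ
      minusᴸ-correct n []      x ρ = sym -0#≈0#
      minusᴸ-correct n (a ∷ f) x ρ = begin
        ⟦ minus n a ⟧ⁿ ρ + x * ⟦ minusᴸ n f ⟧ᴸ x ρ
          ≈⟨ +-cong (minus-correct n a ρ) (trans (*-congˡ (minusᴸ-correct n f x ρ)) (sym (-‿distribʳ-* x _))) ⟩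
        - ⟦ a ⟧ⁿ ρ + - (x * ⟦ f ⟧ᴸ x ρ)
          ≈⟨ -‿+-comm _ _ ⟩
        - ⟦ a ∷ f ⟧ᴸ x ρ ∎

    difference-* : ∀ x y z w → (x * z + y * w) - (x * w + y * z) ≈ (x - y) * (z - w)
    difference-* x y z w = sym (begin
      (x - y) * (z - w)
        ≈⟨ distribˡ _ z (- w) ⟩
      (x - y) * z + (x - y) * - w
        ≈⟨ +-cong (distribʳ z x (- y)) (distribʳ (- w) x (- y)) ⟩
      (x * z + - y * z) + (x * - w + - y * - w)
        ≈⟨ +-cong (+-congˡ (-‿distribˡ-* y z)) (+-cong (-‿distribʳ-* x w) (trans (sym (-‿involutive _)) (trans (-‿cong (-‿distribʳ-* y w)) (-‿distribˡ-* y (- w))))) ⟨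
      (x * z - y * z) + (- (x * w) + y * w)
        ≈⟨ +-congˡ (+-comm _ _) ⟩
      (x * z - y * z) + (y * w - x * w)
        ≈⟨ interchange _ _ _ _ ⟩
      (x * z + y * w) + (- (y * z) - x * w)
        ≈⟨ +-congˡ (trans (+-comm _ _) (-‿+-comm _ _)) ⟩
      (x * z + y * w) - (x * w + y * z) ∎)

    mutual
      times-correct : ∀ n f g ρ → ⟦ times n f g ⟧ⁿ ρ ≈ ⟦ f ⟧ⁿ ρ * ⟦ g ⟧ⁿ ρ
      times-correct zero (a , b) (c , d) ρ =
        trans (+-cong (expand a c b d) (-‿cong (expand a d b c))) (difference-* _ _ _ _)
        where
        expand : ∀ i j k l → (i ℕ.* j ℕ.+ k ℕ.* l) · 1# ≈ (i · 1#) * (j · 1#) + (k · 1#) * (l · 1#)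
        expand i j k l = trans (M.×-homo-+ 1# (i ℕ.* j) (k ℕ.* l)) (+-cong (M.×1-homo-* i j) (M.×1-homo-* k l))
      times-correct (suc n) f g (x ∷ ρ) = timesᴸ-correct n f g x ρ

      timesᴸ-correct : ∀ n f g x ρ → ⟦ timesᴸ n f g ⟧ᴸ x ρ ≈ ⟦ f ⟧ᴸ x ρ * ⟦ g ⟧ᴸ x ρ
      timesᴸ-correct n []      g x ρ = sym (zeroˡ _)
      timesᴸ-correct n (a ∷ f) g x ρ = begin
        ⟦ plusᴸ n (scaleᴸ n a g) (const n 0 ∷ timesᴸ n f g) ⟧ᴸ x ρ
          ≈⟨ plusᴸ-correct n (scaleᴸ n a g) _ x ρ ⟩
        ⟦ scaleᴸ n a g ⟧ᴸ x ρ + (⟦ const n 0 ⟧ⁿ ρ + x * ⟦ timesᴸ n f g ⟧ᴸ x ρ)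
          ≈⟨ +-cong (scaleᴸ-correct n a g x ρ) (trans (+-congʳ (const-correct n 0 ρ)) (+-identityˡ _)) ⟩
        ⟦ a ⟧ⁿ ρ * ⟦ g ⟧ᴸ x ρ + x * ⟦ timesᴸ n f g ⟧ᴸ x ρ
          ≈⟨ +-congˡ (trans (*-congˡ (timesᴸ-correct n f g x ρ)) (sym (*-assoc x _ _))) ⟩
        ⟦ a ⟧ⁿ ρ * ⟦ g ⟧ᴸ x ρ + x * ⟦ f ⟧ᴸ x ρ * ⟦ g ⟧ᴸ x ρ
          ≈⟨ distribʳ _ _ _ ⟨
        ⟦ a ∷ f ⟧ᴸ x ρ * ⟦ g ⟧ᴸ x ρ ∎

      scaleᴸ-correct : ∀ n a g x ρ → ⟦ scaleᴸ n a g ⟧ᴸ x ρ ≈ ⟦ a ⟧ⁿ ρ * ⟦ g ⟧ᴸ x ρ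
      scaleᴸ-correct n a []      x ρ = sym (zeroʳ _)
      scaleᴸ-correct n a (b ∷ g) x ρ = begin
        ⟦ times n a b ⟧ⁿ ρ + x * ⟦ scaleᴸ n a g ⟧ᴸ x ρ
          ≈⟨ +-cong (times-correct n a b ρ) (trans (*-congˡ (scaleᴸ-correct n a g x ρ)) (*.x∙yz≈y∙xz x _ _)) ⟩
        ⟦ a ⟧ⁿ ρ * ⟦ b ⟧ⁿ ρ + ⟦ a ⟧ⁿ ρ * (x * ⟦ g ⟧ᴸ x ρ)
          ≈⟨ distribˡ _ _ _ ⟨
        ⟦ a ⟧ⁿ ρ * ⟦ b ∷ g ⟧ᴸ x ρ ∎

    power-correct : ∀ n f k ρ → ⟦ power n f k ⟧ⁿ ρ ≈ ⟦ f ⟧ⁿ ρ ^ k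
    power-correct n f zero    ρ = trans (const-correct n 1 ρ) (+-identityʳ _)
    power-correct n f (suc k) ρ = trans (times-correct n f (power n f k) ρ) (*-congˡ (power-correct n f k ρ))

    mutual
      isZero-correct : ∀ n f ρ → Bool.T (isZero n f) → ⟦ f ⟧ⁿ ρ ≈ 0#
      isZero-correct zero    (a , b) ρ       t = trans (-‿congʳ′ (ℕ.≡ᵇ⇒≡ a b t)) (-‿inverseʳ _)
        where
        -‿congʳ′ : a ≡ b → a · 1# - b · 1# ≈ b · 1# - b · 1#
        -‿congʳ′ ≡.refl = refl
      isZero-correct (suc n) f       (x ∷ ρ) t = isZeroᴸ-correct n f x ρ t

      isZeroᴸ-correct : ∀ n f x ρ → Bool.T (isZeroᴸ n f) → ⟦ f ⟧ᴸ x ρ ≈ 0#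
      isZeroᴸ-correct n []      x ρ t = refl
      isZeroᴸ-correct n (a ∷ f) x ρ t with isZero n a in eq
      ... | true = begin
        ⟦ a ⟧ⁿ ρ + x * ⟦ f ⟧ᴸ x ρ
          ≈⟨ +-cong (isZero-correct n a ρ (≡.subst Bool.T (≡.sym eq) tt)) (*-congˡ (isZeroᴸ-correct n f x ρ t)) ⟩
        0# + x * 0#
          ≈⟨ trans (+-identityˡ _) (zeroʳ x) ⟩
        0# ∎

    correct : ∀ {n} (e : Expr n) ρ → ⟦ normalise e ⟧ⁿ ρ ≈ ⟦ e ⟧ ρ
    correct         (var i)  ρ = variable-correct i ρ
    correct {n = n} :1       ρ = trans (const-correct n 1 ρ) (+-identityʳ _)
    correct {n = n} (con k)  ρ = const-correct n k ρ
    correct {n = n} (e :+ f) ρ = trans (plus-correct n _ _ ρ) (+-cong (correct e ρ) (correct f ρ))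
    correct {n = n} (e :* f) ρ = trans (times-correct n _ _ ρ) (*-cong (correct e ρ) (correct f ρ))
    correct {n = n} (:- e)   ρ = trans (minus-correct n _ ρ) (-‿cong (correct e ρ))
    correct {n = n} (e :^ k) ρ = trans (power-correct n _ k ρ) (^-congˡ k (correct e ρ))

  Holds : ∀ {n} → Vec Carrier n → List (Hypothesis n) → Equation n → Set ℓ
  Holds ρ []                     (l := r) = ⟦ l ⟧ ρ ≈ ⟦ r ⟧ ρ
  Holds ρ ((_ by (l := r)) ∷ hs) e        = ⟦ l ⟧ ρ ≈ ⟦ r ⟧ ρ → Holds ρ hs e

  Entails : ∀ {n} → Entailment n → Vec Carrier n → Set ℓ
  Entails (hs ⊢ e) ρ = Holds ρ hs e

  private
    holds : ∀ {n} (ρ : Vec Carrier n) hs l r →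
            ⟦ l ⟧ ρ - ⟦ r ⟧ ρ ≈ ⟦ combination hs ⟧ ρ → Holds ρ hs (l := r)
    holds ρ []                       l r eq = x∙y⁻¹≈ε⇒x≈y _ _ eq
    holds ρ ((c by (l′ := r′)) ∷ hs) l r eq h = holds ρ hs l r (begin
      ⟦ l ⟧ ρ - ⟦ r ⟧ ρ
        ≈⟨ eq ⟩
      ⟦ c ⟧ ρ * (⟦ l′ ⟧ ρ - ⟦ r′ ⟧ ρ) + ⟦ combination hs ⟧ ρ
        ≈⟨ +-congʳ (trans (*-congˡ (x≈y⇒x∙y⁻¹≈ε h)) (zeroʳ _)) ⟩
      0# + ⟦ combination hs ⟧ ρ
        ≈⟨ +-identityˡ _ ⟩
      ⟦ combination hs ⟧ ρ ∎)

    curry-∀ : ∀ n {P : Vec Carrier n → Set ℓ} → (∀ ρ → P ρ) → ∀ⁿ n (curryⁿ P)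
    curry-∀ zero    h   = h []
    curry-∀ (suc n) h x = curry-∀ n (λ ρ → h (x ∷ ρ))

  abstract
    entails : ∀ {n} (t : Entailment n) → Bool.T (valid t) → ∀ ρ → Entails t ρ
    entails {n} (hs ⊢ l := r) t ρ = holds ρ hs l r (x∙y⁻¹≈ε⇒x≈y _ _ (begin
      ⟦ (l :- r) :- combination hs ⟧ ρ
        ≈⟨ correct ((l :- r) :- combination hs) ρ ⟨
      ⟦ normalise ((l :- r) :- combination hs) ⟧ⁿ ρ
        ≈⟨ isZero-correct n _ ρ t ⟩
      0# ∎))

  -- solve n (λ x y … → (c₁ by l₁ := r₁) ∷ … ∷ [] ⊢ l := r) proves l ≈ r from
  -- the lᵢ ≈ rᵢ, provided that l - r is the combination Σ cᵢ (lᵢ - rᵢ).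
  solve : ∀ n (f : N-ary n (Expr n) (Entailment n)) {_ : Bool.T (valid (close n f))} →
          ∀ⁿ n (curryⁿ (Entails (close n f)))
  solve n f {t} = curry-∀ n (entails (close n f) t)

-- Polynomials over an algebraically closed field

module Fields {c ℓ : Level} {p : ℕ} (K : AlgebraicClosure𝔽 c ℓ p) where
  open AlgebraicClosure𝔽 K
  open CommutativeRing commutativeRing hiding (zero) renaming (Carrier to ∣K∣)
  open CommutativeRingSolver commutativeRing
  open Polynomial commutativeRing
  open PrimeSubfield commutativeRing
  open Exp commutativeSemiring using (_^_; ^-congˡ)
  open RingProperties ring using (-0#≈0#; x∙y⁻¹≈ε⇒x≈y; x≈y⇒x∙y⁻¹≈ε)
  open SetoidReasoning setoid

  *-cancelˡ-≉0 : ∀ {x y z} → x ≉ 0# → x * y ≈ x * z → y ≈ z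
  *-cancelˡ-≉0 {x} {y} {z} x≉0 xy≈xz with x⁻¹ , xx⁻¹ ← inverse x x≉0 =
    solve 4 (λ x x⁻¹ y z → (:- (y :- z) by x :* x⁻¹ := :1) ∷ (x⁻¹ by x :* y := x :* z) ∷ [] ⊢ y := z)
      x x⁻¹ y z xx⁻¹ xy≈xz

  x*y≈0⇒y≈0 : ∀ {x y} → x ≉ 0# → x * y ≈ 0# → y ≈ 0#
  x*y≈0⇒y≈0 {x} x≉0 xy≈0 = *-cancelˡ-≉0 x≉0 (trans xy≈0 (sym (zeroʳ x)))

  *-≉0 : ∀ {x y} → x ≉ 0# → y ≉ 0# → x * y ≉ 0#
  *-≉0 x≉0 y≉0 xy≈0 = y≉0 (x*y≈0⇒y≈0 x≉0 xy≈0)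

  integral : ∀ {x y} → x * y ≈ 0# → x ≈ 0# ⊎ y ≈ 0#
  integral {x} xy≈0 with x ≟ 0#
  ... | yes x≈0 = inj₁ x≈0
  ... | no  x≉0 = inj₂ (x*y≈0⇒y≈0 x≉0 xy≈0)

  ^-≉0 : ∀ n {x} → x ≉ 0# → x ^ n ≉ 0#
  ^-≉0 zero    x≉0 = 1≉0
  ^-≉0 (suc n) x≉0 = *-≉0 x≉0 (^-≉0 n x≉0)

  ^≈0⇒≈0 : ∀ n {x} → x ^ n ≈ 0# → x ≈ 0#
  ^≈0⇒≈0 n {x} xⁿ≈0 with x ≟ 0#
  ... | yes x≈0 = x≈0
  ... | no  x≉0 = contradiction xⁿ≈0 (^-≉0 n x≉0)

  ≉0-resp : ∀ {x y} → x ≈ y → x ≉ 0# → y ≉ 0#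
  ≉0-resp x≈y x≉0 y≈0 = x≉0 (trans x≈y y≈0)

  factor-≉0ˡ : ∀ {x y} → x * y ≉ 0# → x ≉ 0#
  factor-≉0ˡ xy≉0 x≈0 = xy≉0 (trans (*-congʳ x≈0) (zeroˡ _))

  factor-≉0ʳ : ∀ {x y} → x * y ≉ 0# → y ≉ 0#
  factor-≉0ʳ xy≉0 y≈0 = xy≉0 (trans (*-congˡ y≈0) (zeroʳ _))

  -≉0 : ∀ {x y} → x ≉ y → x - y ≉ 0#
  -≉0 x≉y x-y≈0 = x≉y (x∙y⁻¹≈ε⇒x≈y _ _ x-y≈0)

  coeff-+ : ∀ f g i → coeff (f +ᴾ g) i ≈ coeff f i + coeff g i
  coeff-+ []      g       i       = sym (+-identityˡ _)
  coeff-+ (a ∷ f) []      i       = sym (+-identityʳ _)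
  coeff-+ (a ∷ f) (b ∷ g) zero    = refl
  coeff-+ (a ∷ f) (b ∷ g) (suc i) = coeff-+ f g i

  coeff-scale : ∀ a f i → coeff (scale a f) i ≈ a * coeff f i
  coeff-scale a []      i       = sym (zeroʳ a)
  coeff-scale a (b ∷ f) zero    = refl
  coeff-scale a (b ∷ f) (suc i) = coeff-scale a f i

  eval-+ : ∀ f g x → eval (f +ᴾ g) x ≈ eval f x + eval g x
  eval-+ []      g       x = sym (+-identityˡ _)
  eval-+ (a ∷ f) []      x = sym (+-identityʳ _)
  eval-+ (a ∷ f) (b ∷ g) x =
    trans (+-congˡ (*-congˡ (eval-+ f g x)))
          (solve 5 (λ a b x e f → [] ⊢ (a :+ b) :+ x :* (e :+ f) := (a :+ x :* e) :+ (b :+ x :* f)) a b x _ _)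

  eval-scale : ∀ a f x → eval (scale a f) x ≈ a * eval f x
  eval-scale a []      x = sym (zeroʳ a)
  eval-scale a (b ∷ f) x =
    trans (+-congˡ (*-congˡ (eval-scale a f x)))
          (solve 4 (λ a b x e → [] ⊢ a :* b :+ x :* (a :* e) := a :* (b :+ x :* e)) a b x _)

  eval-* : ∀ f g x → eval (f *ᴾ g) x ≈ eval f x * eval g x
  eval-* []      g x = sym (zeroˡ _)
  eval-* (a ∷ f) g x = begin
    eval (scale a g +ᴾ (0# ∷ f *ᴾ g)) x
      ≈⟨ eval-+ (scale a g) _ x ⟩
    eval (scale a g) x + (0# + x * eval (f *ᴾ g) x)
      ≈⟨ +-cong (eval-scale a g x) (+-congˡ (*-congˡ (eval-* f g x))) ⟩
    a * eval g x + (0# + x * (eval f x * eval g x))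
      ≈⟨ solve 4 (λ a g x f → [] ⊢ a :* g :+ (con 0 :+ x :* (f :* g)) := (a :+ x :* f) :* g) a _ x _ ⟩
    eval (a ∷ f) x * eval g x ∎

  eval-1 : ∀ x → eval 1ᴾ x ≈ 1#
  eval-1 x = trans (+-congˡ (zeroʳ x)) (+-identityʳ _)

  eval-^ : ∀ f n x → eval (f ^ᴾ n) x ≈ eval f x ^ n
  eval-^ f zero    x = eval-1 x
  eval-^ f (suc n) x = trans (eval-* f (f ^ᴾ n) x) (*-congˡ (eval-^ f n x))

  eval-congʳ : ∀ f {x y} → x ≈ y → eval f x ≈ eval f y
  eval-congʳ []      x≈y = refl
  eval-congʳ (a ∷ f) x≈y = +-congˡ (*-cong x≈y (eval-congʳ f x≈y))

  eval-zero : ∀ f → (∀ i → coeff f i ≈ 0#) → ∀ x → eval f x ≈ 0#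
  eval-zero []      f≈0 x = refl
  eval-zero (a ∷ f) f≈0 x = begin
    a + x * eval f x  ≈⟨ +-cong (f≈0 0) (*-congˡ (eval-zero f (λ i → f≈0 (suc i)) x)) ⟩
    0# + x * 0#       ≈⟨ trans (+-identityˡ _) (zeroʳ x) ⟩
    0#                ∎

  eval-cong : ∀ f g → f ≈ᴾ g → ∀ x → eval f x ≈ eval g x
  eval-cong []      g       f≈g x = sym (eval-zero g (λ i → sym (f≈g i)) x)
  eval-cong (a ∷ f) []      f≈g x = eval-zero (a ∷ f) f≈g x
  eval-cong (a ∷ f) (b ∷ g) f≈g x =
    +-cong (f≈g 0) (*-congˡ (eval-cong f g (λ i → f≈g (suc i)) x))

  infixl 6 _-ᴾ_
  _-ᴾ_ : Poly → Poly → Poly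
  f -ᴾ g = f +ᴾ scale (- 1#) g

  private
    -1* : ∀ x y → x + - 1# * y ≈ x - y
    -1* = solve 2 (λ x y → [] ⊢ x :+ (:- :1) :* y := x :- y)

  coeff-- : ∀ f g i → coeff (f -ᴾ g) i ≈ coeff f i - coeff g i
  coeff-- f g i = trans (coeff-+ f _ i) (trans (+-congˡ (coeff-scale _ g i)) (-1* _ _))

  eval-- : ∀ f g x → eval (f -ᴾ g) x ≈ eval f x - eval g x
  eval-- f g x = trans (eval-+ f _ x) (trans (+-congˡ (eval-scale _ g x)) (-1* _ _))

  zero⊎degree : ∀ f → (∀ i → coeff f i ≈ 0#) ⊎ ∃[ n ] HasDegree f n
  zero⊎degree []      = inj₁ (λ i → refl)
  zero⊎degree (a ∷ f) with zero⊎degree f | a ≟ 0#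
  ... | inj₂ (n , fₙ≉0 , high) | _       = inj₂ (suc n , fₙ≉0 , λ { (suc i) (s≤s n<i) → high i n<i })
  ... | inj₁ f≈0               | yes a≈0 = inj₁ (λ { zero → a≈0 ; (suc i) → f≈0 i })
  ... | inj₁ f≈0               | no  a≉0 = inj₂ (0 , a≉0 , λ { (suc i) _ → f≈0 i })

  -- A nonconstant f vanishing everywhere would leave f + 1 without a root.
  vanishing⇒zero : ∀ f → (∀ x → eval f x ≈ 0#) → ∀ i → coeff f i ≈ 0#
  vanishing⇒zero f f≗0 with zero⊎degree f
  ... | inj₁ f≈0                      = f≈0
  ... | inj₂ (zero , f₀≉0 , high)     = ⊥-elim (f₀≉0 (constant f f≗0))
    where
    constant : ∀ f → (∀ x → eval f x ≈ 0#) → coeff f 0 ≈ 0#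
    constant []      _   = refl
    constant (a ∷ f) f≗0 = trans (sym (trans (+-congˡ (zeroˡ _)) (+-identityʳ a))) (f≗0 0#)
  ... | inj₂ (suc n , fₙ≉0 , high)    = ⊥-elim (1≉0 (begin
    1#                           ≈⟨ eval-1 x ⟨
    eval 1ᴾ x                    ≈⟨ trans (+-congˡ (f≗0 x)) (+-identityʳ _) ⟨
    eval 1ᴾ x + eval f x         ≈⟨ eval-+ 1ᴾ f x ⟨
    eval (1ᴾ +ᴾ f) x             ≈⟨ proj₂ root ⟩
    0#                           ∎))
    where
    higher : ∀ i → coeff (1ᴾ +ᴾ f) (suc i) ≈ coeff f (suc i)
    higher i = trans (coeff-+ 1ᴾ f (suc i)) (+-identityˡ _)
    root = closed (1ᴾ +ᴾ f) n
      ( ≉0-resp (sym (higher n)) fₙ≉0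
      , λ { (suc i) n<i → trans (higher i) (high (suc i) n<i) })
    x = proj₁ root

  -- Reduces polynomial identities to pointwise ones, which the ring solver can handle; coefficients
  -- of products need not be expanded by hand.
  ≗⇒≈ᴾ : ∀ f g → (∀ x → eval f x ≈ eval g x) → f ≈ᴾ g
  ≗⇒≈ᴾ f g f≗g i = x∙y⁻¹≈ε⇒x≈y _ _ (trans (sym (coeff-- f g i))
    (vanishing⇒zero (f -ᴾ g) (λ x → trans (eval-- f g x) (x≈y⇒x∙y⁻¹≈ε (f≗g x))) i))

  -- Pointwise cancellation breaks down at x = r. Instead, if h = f - g had degree n, its leading
  -- coefficient would reappear as coefficient n + 1 of the vanishing polynomial (X - r) h.
  cancel-linear : ∀ r f g → (∀ x → (x - r) * eval f x ≈ (x - r) * eval g x) →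
                  ∀ x → eval f x ≈ eval g x
  cancel-linear r f g eq x with zero⊎degree (f -ᴾ g)
  ... | inj₁ f-g≈0 = x∙y⁻¹≈ε⇒x≈y _ _ (trans (sym (eval-- f g x)) (eval-zero (f -ᴾ g) f-g≈0 x))
  ... | inj₂ (n , hₙ≉0 , high) = ⊥-elim (hₙ≉0 (begin
    coeff h n
      ≈⟨ solve 2 (λ a r → [] ⊢ a := a :+ (:- r) :* con 0) _ r ⟩
    coeff h n + - r * 0#
      ≈⟨ +-congˡ (trans (coeff-scale (- r) h (suc n)) (*-congˡ (high (suc n) ℕ.≤-refl))) ⟨
    coeff h n + coeff (scale (- r) h) (suc n)
      ≈⟨ coeff-+ (0# ∷ h) (scale (- r) h) (suc n) ⟨
    coeff ((0# ∷ h) +ᴾ scale (- r) h) (suc n)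
      ≈⟨ vanishing⇒zero ((0# ∷ h) +ᴾ scale (- r) h) vanishing (suc n) ⟩
    0# ∎))
    where
    h = f -ᴾ g
    vanishing : ∀ x → eval ((0# ∷ h) +ᴾ scale (- r) h) x ≈ 0#
    vanishing x = begin
      eval ((0# ∷ h) +ᴾ scale (- r) h) x
        ≈⟨ trans (eval-+ (0# ∷ h) (scale (- r) h) x) (+-congˡ (eval-scale (- r) h x)) ⟩
      (0# + x * eval h x) + - r * eval h x
        ≈⟨ +-cong (+-congˡ (*-congˡ (eval-- f g x))) (*-congˡ (eval-- f g x)) ⟩
      (0# + x * (eval f x - eval g x)) + - r * (eval f x - eval g x)
        ≈⟨ solve 4 (λ x r f g → (:1 by (x :- r) :* f := (x :- r) :* g) ∷ []
             ⊢ (con 0 :+ x :* (f :- g)) :+ (:- r) :* (f :- g) := con 0) x r _ _ (eq x) ⟩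
      0# ∎

  -- Synthetic division by X - r: the coefficients of the quotient are the intermediate values of
  -- Horner's scheme for `eval f r`.
  quotient : Poly → ∣K∣ → Poly
  quotient []          r = []
  quotient (a ∷ [])    r = []
  quotient (a ∷ b ∷ f) r = eval (b ∷ f) r ∷ quotient (b ∷ f) r

  length-quotient : ∀ a f r → length (quotient (a ∷ f) r) ≡ length f
  length-quotient a []      r = ≡.refl
  length-quotient a (b ∷ f) r = ≡.cong suc (length-quotient b f r)

  quotient-remainder : ∀ f r x → eval f x ≈ (x - r) * eval (quotient f r) x + eval f r
  quotient-remainder []          r x = solve 2 (λ x r → [] ⊢ con 0 := (x :- r) :* con 0 :+ con 0) x r
  quotient-remainder (a ∷ [])    r x =
    solve 3 (λ x r a → [] ⊢ a :+ x :* con 0 := (x :- r) :* con 0 :+ (a :+ r :* con 0)) x r a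
  quotient-remainder (a ∷ b ∷ f) r x =
    trans (+-congˡ (*-congˡ (quotient-remainder (b ∷ f) r x)))
          (solve 5 (λ x r a q e → [] ⊢ a :+ x :* ((x :- r) :* q :+ e) := (x :- r) :* (e :+ x :* q) :+ (a :+ r :* e)) x r a _ _)

  factor : ∀ f r → eval f r ≈ 0# → ∀ x → eval f x ≈ (x - r) * eval (quotient f r) x
  factor f r fr≈0 x = trans (quotient-remainder f r x) (trans (+-congˡ fr≈0) (+-identityʳ _))

  linear : ∣K∣ → Poly
  linear r = (- r) ∷ 1# ∷ []

  eval-linear : ∀ r x → eval (linear r) x ≈ x - r
  eval-linear = solve 2 (λ r x → [] ⊢ (:- r) :+ x :* (:1 :+ x :* con 0) := x :- r)

  linear-∣ : ∀ f r → eval f r ≈ 0# → linear r ∣ᴾ f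
  linear-∣ f r fr≈0 = quotient f r , ≗⇒≈ᴾ (quotient f r *ᴾ linear r) f (λ x → begin
    eval (quotient f r *ᴾ linear r) x          ≈⟨ eval-* (quotient f r) (linear r) x ⟩
    eval (quotient f r) x * eval (linear r) x  ≈⟨ *-congˡ (eval-linear r x) ⟩
    eval (quotient f r) x * (x - r)            ≈⟨ *-comm _ _ ⟩
    (x - r) * eval (quotient f r) x            ≈⟨ factor f r fr≈0 x ⟨
    eval f x                                   ∎)

  coprime⇒no-common-root : ∀ f g r → Coprime f g → eval f r ≈ 0# → eval g r ≉ 0#
  coprime⇒no-common-root f g r coprime fr≈0 gr≈0
    with q , q*d≈1 ← coprime (linear r) (linear-∣ f r fr≈0) (linear-∣ g r gr≈0) = 1≉0 (begin
    1#                              ≈⟨ eval-1 r ⟨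
    eval 1ᴾ r                       ≈⟨ eval-cong (q *ᴾ linear r) 1ᴾ q*d≈1 r ⟨
    eval (q *ᴾ linear r) r          ≈⟨ eval-* q (linear r) r ⟩
    eval q r * eval (linear r) r    ≈⟨ *-congˡ (eval-linear r r) ⟩
    eval q r * (r - r)              ≈⟨ solve 2 (λ q r → [] ⊢ q :* (r :- r) := con 0) _ r ⟩
    0#                              ∎)

  -- Each division by X - r uses up one root and shortens the coefficient list by one. Bounding the
  -- length rather than the degree tolerates trailing zeros.
  many-roots⇒vanishing : ∀ f {xs} → AllPairs _≉_ xs → All (λ x → eval f x ≈ 0#) xs →
                         length f ℕ.≤ length xs → ∀ x → eval f x ≈ 0#
  many-roots⇒vanishing []      _                   _               _         x = refl
  many-roots⇒vanishing (a ∷ f) {r ∷ xs} (r≉ ∷ distinct) (fr≈0 ∷ roots) (s≤s f≤xs) x =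
    trans (factor (a ∷ f) r fr≈0 x) (trans (*-congˡ vanishing) (zeroʳ _))
    where
    vanishing : eval (quotient (a ∷ f) r) x ≈ 0#
    vanishing = many-roots⇒vanishing (quotient (a ∷ f) r) distinct
      (All.zipWith (λ { (r≉y , fy≈0) → x*y≈0⇒y≈0 (-≉0 (λ y≈r → r≉y (sym y≈r))) (trans (sym (factor (a ∷ f) r fr≈0 _)) fy≈0) }) (r≉ , roots))
      (≡.subst (ℕ._≤ length xs) (≡.sym (length-quotient a f r)) f≤xs) x

  degree-unique : ∀ f {m n} → HasDegree f m → HasDegree f n → m ≡ n
  degree-unique f {m} {n} (fₘ≉0 , high) (fₙ≉0 , high′) =
    ℕ.≤-antisym (ℕ.≮⇒≥ λ n<m → fₘ≉0 (high′ m n<m)) (ℕ.≮⇒≥ λ m<n → fₙ≉0 (high n m<n))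

  degree-cong : ∀ f g {n} → f ≈ᴾ g → HasDegree f n → HasDegree g n
  degree-cong f g f≈g (fₙ≉0 , high) = ≉0-resp (f≈g _) fₙ≉0 , λ i n<i → trans (sym (f≈g i)) (high i n<i)

  degree-+ : ∀ f g {n} → HasDegree f n → (∀ i → n ℕ.≤ i → coeff g i ≈ 0#) → HasDegree (f +ᴾ g) n
  degree-+ f g {n} (fₙ≉0 , high) low =
    ≉0-resp (sym (same n ℕ.≤-refl)) fₙ≉0 , λ i n<i → trans (same i (ℕ.<⇒≤ n<i)) (high i n<i)
    where
    same : ∀ i → n ℕ.≤ i → coeff (f +ᴾ g) i ≈ coeff f i
    same i n≤i = trans (coeff-+ f g i) (trans (+-congˡ (low i n≤i)) (+-identityʳ _))

  private
    zero-* : ∀ f g → (∀ i → coeff f i ≈ 0#) → ∀ i → coeff (f *ᴾ g) i ≈ 0#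
    zero-* f g f≈0 = vanishing⇒zero (f *ᴾ g) (λ x → trans (eval-* f g x) (trans (*-congʳ (eval-zero f f≈0 x)) (zeroˡ _)))

  degree-* : ∀ f g {m n} → HasDegree f m → HasDegree g n → HasDegree (f *ᴾ g) (m ℕ.+ n)
  degree-* []      g (f₀≉0 , _)                _ = contradiction refl f₀≉0
  degree-* (a ∷ f) g {zero} {n} (a≉0 , high) (gₙ≉0 , high′) =
    ≉0-resp (sym (same n)) (*-≉0 a≉0 gₙ≉0) , λ i n<i → trans (same i) (trans (*-congˡ (high′ i n<i)) (zeroʳ a))
    where
    tail : ∀ i → coeff (0# ∷ f *ᴾ g) i ≈ 0#
    tail zero    = refl
    tail (suc i) = zero-* f g (λ i → high (suc i) (s≤s z≤n)) i
    same : ∀ i → coeff ((a ∷ f) *ᴾ g) i ≈ a * coeff g i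
    same i = trans (coeff-+ (scale a g) _ i) (trans (+-cong (coeff-scale a g i) (tail i)) (+-identityʳ _))
  degree-* (a ∷ f) g {suc m} {n} (fₘ≉0 , high) dg@(gₙ≉0 , high′) =
    ≉0-resp (sym (same (m ℕ.+ n) (ℕ.m≤n+m n m))) (proj₁ ih) ,
    λ { (suc i) (s≤s m+n<i) → trans (same i (ℕ.≤-trans (ℕ.m≤n+m n m) (ℕ.<⇒≤ m+n<i))) (proj₂ ih i m+n<i) }
    where
    ih = degree-* f g {m} {n} (fₘ≉0 , λ i m<i → high (suc i) (s≤s m<i)) dg
    same : ∀ i → n ℕ.≤ i → coeff ((a ∷ f) *ᴾ g) (suc i) ≈ coeff (f *ᴾ g) i
    same i n≤i = begin
      coeff (scale a g +ᴾ (0# ∷ f *ᴾ g)) (suc i)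
        ≈⟨ coeff-+ (scale a g) _ (suc i) ⟩
      coeff (scale a g) (suc i) + coeff (f *ᴾ g) i
        ≈⟨ +-congʳ (trans (coeff-scale a g (suc i)) (trans (*-congˡ (high′ (suc i) (s≤s n≤i))) (zeroʳ a))) ⟩
      0# + coeff (f *ᴾ g) i
        ≈⟨ +-identityˡ _ ⟩
      coeff (f *ᴾ g) i ∎

  degree-1 : HasDegree 1ᴾ 0
  degree-1 = 1≉0 , λ { (suc i) _ → refl }

  X^ : ℕ → Poly
  X^ zero    = 1ᴾ
  X^ (suc n) = 0# ∷ X^ n

  eval-X^ : ∀ n x → eval (X^ n) x ≈ x ^ n
  eval-X^ zero    x = eval-1 x
  eval-X^ (suc n) x = trans (+-identityˡ _) (*-congˡ (eval-X^ n x))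

  degree-X^ : ∀ n → HasDegree (X^ n) n
  degree-X^ zero    = degree-1
  degree-X^ (suc n) = proj₁ (degree-X^ n) , λ { (suc i) (s≤s n<i) → proj₂ (degree-X^ n) i n<i }

  nth-root : ∀ n .{{_ : ℕ.NonZero n}} k → ∃[ x ] x ^ n ≈ k
  nth-root (suc n) k = proj₁ root , trans (*-congˡ (sym (eval-X^ n (proj₁ root))))
      (solve 2 (λ k y → (:1 by :- k :+ y := con 0) ∷ [] ⊢ y := k) k _ (proj₂ root))
    where
    root = closed ((- k) ∷ X^ n) n (proj₁ (degree-X^ n) , λ { (suc i) (s≤s n<i) → proj₂ (degree-X^ n) i n<i })

  degree-^ : ∀ f n {m} → HasDegree f m → HasDegree (f ^ᴾ n) (n ℕ.* m)
  degree-^ f zero    d = degree-1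
  degree-^ f (suc n) d = degree-* f (f ^ᴾ n) d (degree-^ f n d)

-- Divisibility by a prime

module PrimeDivisibility {p : ℕ} (p-prime : Prime p) where

  prime∤! : ∀ n → n ℕ.< p → ¬ p ∣ n !
  prime∤! zero    _   p∣1 = ℕ.<⇒≱ (ℕ.nonTrivial⇒n>1 p {{prime⇒nonTrivial p-prime}}) (ℕ.∣⇒≤ p∣1)
  prime∤! (suc n) n<p p∣n! with euclidsLemma (suc n) (n !) p-prime p∣n!
  ... | inj₁ p∣1+n = ℕ.<⇒≱ n<p (ℕ.∣⇒≤ p∣1+n)
  ... | inj₂ p∣n!′ = prime∤! n (ℕ.<-trans (ℕ.n<1+n n) n<p) p∣n!′

  -- The prime divides p! = (p C k) · k! · (p - k)! but neither of the two smaller factorials.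
  prime∣binomial : ∀ k → 0 ℕ.< k → k ℕ.< p → p ∣ p C k
  prime∣binomial k 0<k k<p = [ (λ h → h) , (λ h → ⊥-elim ([ prime∤! k k<p , prime∤! (p ℕ.∸ k) p∸k<p ]′
      (euclidsLemma (k !) ((p ℕ.∸ k) !) p-prime h))) ]′
    (euclidsLemma (p C k) (k ! ℕ.* (p ℕ.∸ k) !) p-prime (≡.subst (p ∣_) (≡.sym product) (p∣p! p-prime)))
    where
    instance
      k!≢0 = k ℕ.!* (p ℕ.∸ k) !≢0
    p∸k<p : p ℕ.∸ k ℕ.< p
    p∸k<p = ℕ.∸-monoʳ-< 0<k (ℕ.<⇒≤ k<p)
    p∣p! : ∀ {n} → Prime n → n ∣ n !
    p∣p! {suc n} _ = ℕ.m∣m*n (n !)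
    product : (p C k) ℕ.* (k ! ℕ.* (p ℕ.∸ k) !) ≡ p !
    product = ≡.trans (≡.cong (ℕ._* (k ! ℕ.* (p ℕ.∸ k) !)) (nCk≡n!/k![n-k]! (ℕ.<⇒≤ k<p)))
                      (m/n*n≡m (k![n∸k]!∣n! (ℕ.<⇒≤ k<p)))

  odd-prime : 2 ℕ.< p → p ≡ suc (p ℕ./ 2 ℕ.* 2)
  odd-prime 2<p = ≡.trans (m≡m%n+[m/n]*n p 2) (≡.cong (ℕ._+ p ℕ./ 2 ℕ.* 2) odd)
    where
    odd : p ℕ.% 2 ≡ 1
    odd with p ℕ.% 2 in eq | m%n<n p 2
    ... | 0             | _ = [ (λ ()) , (λ { ≡.refl → ⊥-elim (ℕ.<-irrefl ≡.refl 2<p) }) ]′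
                                (prime⇒irreducible p-prime (ℕ.m%n≡0⇒n∣m p 2 eq))
    ... | 1             | _ = ≡.refl
    ... | suc (suc _)   | s≤s (s≤s ())

-- The prime field as the fixed points of Frobenius

module PrimeField {c ℓ : Level} {p : ℕ} (p-prime : Prime p) (K : AlgebraicClosure𝔽 c ℓ p) where
  open AlgebraicClosure𝔽 K
  open CommutativeRing commutativeRing hiding (zero) renaming (Carrier to ∣K∣)
  open CommutativeRingSolver commutativeRing
  open Polynomial commutativeRing
  open PrimeSubfield commutativeRing
  open Exp commutativeSemiring using (_^_; ^-congˡ; ^-homo-*; ^-distrib-*; ^-assocʳ)
  open RingProperties ring using (x∙y⁻¹≈ε⇒x≈y; x≈y⇒x∙y⁻¹≈ε)
  open Mult semiring using () renaming (_×_ to _·_)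
  open SetoidReasoning setoid
  open Fields K
  open PrimeDivisibility p-prime
  private
    module M = Mult semiring
    module S = Sum +-monoid
    instance
      p≢0 = prime⇒nonZero p-prime

  ι-+ : ∀ m n → ι (m ℕ.+ n) ≈ ι m + ι n
  ι-+ m n = M.×-homo-+ 1# m n

  ι-* : ∀ m n → ι (m ℕ.* n) ≈ ι m * ι n
  ι-* = M.×1-homo-*

  ι-∣ : ∀ {n} → p ∣ n → ι n ≈ 0#
  ι-∣ (divides q ≡.refl) = trans (ι-* q p) (trans (*-congˡ char-p) (zeroʳ _))

  ι-% : ∀ n → ι n ≈ ι (n ℕ.% p)
  ι-% n = begin
    ι n                                   ≡⟨ ≡.cong ι (m≡m%n+[m/n]*n n p) ⟩
    ι (n ℕ.% p ℕ.+ n ℕ./ p ℕ.* p)         ≈⟨ ι-+ (n ℕ.% p) _ ⟩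
    ι (n ℕ.% p) + ι (n ℕ./ p ℕ.* p)       ≈⟨ +-congˡ (ι-∣ (ℕ.n∣m*n (n ℕ./ p))) ⟩
    ι (n ℕ.% p) + 0#                      ≈⟨ +-identityʳ _ ⟩
    ι (n ℕ.% p)                           ∎

  -- A Bézout relation between n and p maps to 1 = 0 if both have image 0. Over the naturals it
  -- comes in two forms, depending on which side carries the 1.
  ι-≉0 : ∀ n → 0 ℕ.< n → n ℕ.< p → ι n ≉ 0#
  ι-≉0 n@(suc _) _ n<p ιn≈0 with coprime-Bézout (prime⇒coprime p-prime n<p)
  ... | Bézout.+- x y eq = 1≉0 (begin
    1#                      ≈⟨ solve 1 (λ y → [] ⊢ :1 := con 1 :+ y :* con 0) (ι y) ⟩
    ι 1 + ι y * 0#          ≈⟨ +-congˡ (*-congˡ ιn≈0) ⟨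
    ι 1 + ι y * ι n         ≈⟨ trans (ι-+ 1 (y ℕ.* n)) (+-congˡ (ι-* y n)) ⟨
    ι (1 ℕ.+ y ℕ.* n)       ≡⟨ ≡.cong ι eq ⟩
    ι (x ℕ.* p)             ≈⟨ ι-∣ (ℕ.n∣m*n x) ⟩
    0#                      ∎)
  ... | Bézout.-+ x y eq = 1≉0 (begin
    1#                      ≈⟨ solve 1 (λ y → [] ⊢ :1 := con 1 :+ con 0) (ι y) ⟩
    ι 1 + 0#                ≈⟨ +-congˡ (ι-∣ (ℕ.n∣m*n x)) ⟨
    ι 1 + ι (x ℕ.* p)       ≈⟨ ι-+ 1 (x ℕ.* p) ⟨
    ι (1 ℕ.+ x ℕ.* p)       ≡⟨ ≡.cong ι eq ⟩
    ι (y ℕ.* n)             ≈⟨ trans (ι-* y n) (trans (*-congˡ ιn≈0) (zeroʳ _)) ⟩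
    0#                      ∎)

  ι-distinct : ∀ {m n} → m ℕ.< n → n ℕ.< p → ι m ≉ ι n
  ι-distinct {m} {n} m<n n<p ιm≈ιn = ι-≉0 (n ℕ.∸ m) (ℕ.m<n⇒0<n∸m m<n) (ℕ.≤-<-trans (ℕ.m∸n≤m n m) n<p) (begin
    ι (n ℕ.∸ m)
      ≈⟨ solve 2 (λ d m → [] ⊢ d := (m :+ d) :- m) (ι (n ℕ.∸ m)) (ι m) ⟩
    (ι m + ι (n ℕ.∸ m)) - ι m
      ≈⟨ +-congʳ (ι-+ m _) ⟨
    ι (m ℕ.+ (n ℕ.∸ m)) - ι m
      ≡⟨ ≡.cong (λ k → ι k - ι m) (ℕ.m+[n∸m]≡n (ℕ.<⇒≤ m<n)) ⟩
    ι n - ι m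
      ≈⟨ x≈y⇒x∙y⁻¹≈ε (sym ιm≈ιn) ⟩
    0# ∎)

  0^p : 0# ^ p ≈ 0#
  0^p = 0^ p
    where
    0^ : ∀ n .{{_ : ℕ.NonZero n}} → 0# ^ n ≈ 0#
    0^ (suc n) = zeroˡ _

  1^ : ∀ n → 1# ^ n ≈ 1#
  1^ zero    = refl
  1^ (suc n) = trans (*-identityˡ _) (1^ n)

  frobenius-+ : ∀ x y → (x + y) ^ p ≈ x ^ p + y ^ p
  frobenius-+ x y = go p ≡.refl
    where
    open Binomial commutativeSemiring using (theorem)
    -- `p` is a parameter; a copy of it is matched as `suc m`, which lets the binomial sum be split
    -- into its first, middle and last terms.
    go : ∀ n → n ≡ p → (x + y) ^ n ≈ x ^ n + y ^ n
    go zero    eq     = ⊥-elim (ℕ.≢-nonZero⁻¹ p (≡.sym eq))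
    go (suc m) ≡.refl = begin
      (x + y) ^ suc m
        ≈⟨ theorem (suc m) x y ⟩
      term zero + S.sum (λ i → term (suc i))
        ≈⟨ +-congˡ (S.sum-init-last (λ i → term (suc i))) ⟩
      term zero + (S.sum (λ i → term (suc (inject₁ i))) + term (suc (fromℕ m)))
        ≈⟨ +-cong first (+-cong (trans (S.sum-cong-≋ middle) (S.sum-replicate-zero m)) final) ⟩
      y ^ suc m + (0# + x ^ suc m)
        ≈⟨ solve 2 (λ x y → [] ⊢ y :+ (con 0 :+ x) := x :+ y) _ _ ⟩
      x ^ suc m + y ^ suc m ∎
      where
      term : Fin (suc (suc m)) → ∣K∣
      term k = (suc m C toℕ k) · (x ^ toℕ k * y ^ (suc m ℕ.∸ toℕ k))
      first : term zero ≈ y ^ suc m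
      first = trans (+-identityʳ _) (*-identityˡ _)
      middle : ∀ i → term (suc (inject₁ i)) ≈ 0#
      middle i = begin
        (suc m C k) · z        ≈⟨ M.×-congʳ (suc m C k) (*-identityˡ z) ⟨
        (suc m C k) · (1# * z) ≈⟨ M.×-assoc-* (suc m C k) 1# z ⟨
        ι (suc m C k) * z      ≈⟨ *-congʳ (ι-∣ (prime∣binomial k (s≤s z≤n) (s≤s (≡.subst (ℕ._< m) (≡.sym (toℕ-inject₁ i)) (toℕ<n i))))) ⟩
        0# * z                 ≈⟨ zeroˡ z ⟩
        0#                     ∎
        where
        k = suc (toℕ (inject₁ i))
        z = x ^ k * y ^ (suc m ℕ.∸ k)
      final : term (suc (fromℕ m)) ≈ x ^ suc m
      final rewrite toℕ-fromℕ m | nCn≡1 (suc m) | ℕ.n∸n≡0 m = trans (+-identityʳ _) (*-identityʳ _)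

  frobenius-* : ∀ x y → (x * y) ^ p ≈ x ^ p * y ^ p
  frobenius-* x y = ^-distrib-* x y p

  frobenius-- : ∀ x → (- x) ^ p ≈ - x ^ p
  frobenius-- x = solve 2 (λ a b → (:1 by b :+ a := con 0) ∷ [] ⊢ a := :- b) ((- x) ^ p) (x ^ p) (begin
    x ^ p + (- x) ^ p  ≈⟨ frobenius-+ x (- x) ⟨
    (x - x) ^ p        ≈⟨ ^-congˡ p (-‿inverseʳ x) ⟩
    0# ^ p             ≈⟨ 0^p ⟩
    0#                 ∎)

  frobenius-ι : ∀ n → ι n ^ p ≈ ι n
  frobenius-ι zero    = 0^p
  frobenius-ι (suc n) = trans (frobenius-+ 1# (ι n)) (+-cong (1^ p) (frobenius-ι n))

  ∈⇒fixed : ∀ {x} → InPrimeField x → x ^ p ≈ x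
  ∈⇒fixed (n , x≈ιn) = trans (^-congˡ p x≈ιn) (trans (frobenius-ι n) (sym x≈ιn))

  residue : ∀ {x} → InPrimeField x → Fin p
  residue (n , _) = fromℕ< (m%n<n n p)

  ι-residue : ∀ {x} (x∈ : InPrimeField x) → x ≈ ι (toℕ (residue x∈))
  ι-residue (n , x≈ιn) = trans x≈ιn (trans (ι-% n) (reflexive (≡.cong ι (≡.sym (toℕ-fromℕ< (m%n<n n p))))))

  -- The search visits only the p representatives `ι i`, whence the demand that `P` respect `≈`.
  ∃𝔽ₚ? : ∀ {q} {P : ∣K∣ → Set q} → (∀ {x y} → x ≈ y → P x → P y) → (∀ x → Dec (P x)) →
         Dec (∃[ x ] InPrimeField x × P x)
  ∃𝔽ₚ? resp P? = map′ (λ (i , Pi) → ι (toℕ i) , (toℕ i , refl) , Pi)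
                      (λ (x , x∈ , Px) → residue x∈ , resp (ι-residue x∈) Px)
                      (any? (λ i → P? (ι (toℕ i))))

  _∈𝔽ₚ? : ∀ x → Dec (InPrimeField x)
  x ∈𝔽ₚ? = map′ (λ (y , (n , y≈ιn) , x≈y) → n , trans x≈y y≈ιn) (λ x∈ → x , x∈ , refl)
                 (∃𝔽ₚ? (λ y≈z x≈y → trans x≈y y≈z) (x ≟_))

  private
    coeff-X^ : ∀ n → coeff (X^ n) n ≈ 1#
    coeff-X^ zero    = refl
    coeff-X^ (suc n) = coeff-X^ n

    length-X^- : ∀ m n → m ℕ.≤ n → length (X^ n -ᴾ X^ m) ≡ suc n
    length-X^- zero    zero    z≤n       = ≡.refl
    length-X^- zero    (suc n) z≤n       = ≡.cong suc (length-X^ n)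
      where
      length-X^ : ∀ n → length (X^ n +ᴾ []) ≡ suc n
      length-X^ zero    = ≡.refl
      length-X^ (suc n) = ≡.cong suc (≡.trans (≡.cong length (≡.sym (+[] (X^ n)))) (length-X^ n))
        where
        +[] : ∀ f → f +ᴾ [] ≡ f
        +[] []      = ≡.refl
        +[] (_ ∷ _) = ≡.refl
    length-X^- (suc m) (suc n) (s≤s m≤n) = ≡.cong suc (length-X^- m n m≤n)

    residues : ℕ → List ∣K∣
    residues = applyUpTo (λ i → ι (suc i))

    residues-distinct : ∀ {n} → n ℕ.< p → AllPairs _≉_ (residues n)
    residues-distinct {n} n<p = AllPairs.applyUpTo⁺₁ _ n (λ i<j j<n → ι-distinct (s≤s i<j) (ℕ.≤-<-trans j<n n<p))

    2≤p : 2 ℕ.≤ p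
    2≤p = ℕ.nonTrivial⇒n>1 p {{prime⇒nonTrivial p-prime}}

  -- Otherwise X^p - X would have p + 1 roots.
  fixed⇒∈ : ∀ {x} → x ^ p ≈ x → InPrimeField x
  fixed⇒∈ {x} x^p≈x = decidable-stable (x ∈𝔽ₚ?) (λ x∉ → 1≉0 (trans (sym (leading 2≤p)) (zero-coeff x∉ p)))
    where
    f = X^ p -ᴾ X^ 1
    leading : 2 ℕ.≤ p → coeff f p ≈ 1#
    leading 2≤p = trans (coeff-- (X^ p) (X^ 1) p) (trans (+-cong (coeff-X^ p) (-‿cong (high 2≤p))) (solve 0 ([] ⊢ :1 :- con 0 := :1)))
      where
      high : ∀ {n} → 2 ℕ.≤ n → coeff (X^ 1) n ≈ 0#
      high {suc zero}    (s≤s ())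
      high {suc (suc n)} _ = refl
    evaluate : ∀ y → y ^ p ≈ y → eval f y ≈ 0#
    evaluate y y^p≈y = trans (eval-- (X^ p) (X^ 1) y) (x≈y⇒x∙y⁻¹≈ε (trans (eval-X^ p y) (trans y^p≈y (sym (trans (eval-X^ 1 y) (*-identityʳ y))))))
    points : List ∣K∣
    points = x ∷ 0# ∷ residues (ℕ.pred p)
    vanishing : ¬ InPrimeField x → ∀ y → eval f y ≈ 0#
    vanishing x∉ = many-roots⇒vanishing f {points}
      (((λ x≈0 → x∉ (0 , x≈0)) ∷ All.applyUpTo⁺₂ _ _ (λ i x≈ → x∉ (suc i , x≈)))
        ∷ All.applyUpTo⁺₁ _ _ (λ i<p-1 → ι-distinct (s≤s z≤n) (ℕ.≤-trans (s≤s i<p-1) (ℕ.≤-reflexive (ℕ.suc-pred p))))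
        ∷ residues-distinct (ℕ.≤-reflexive (ℕ.suc-pred p)))
      (evaluate x x^p≈x ∷ evaluate 0# 0^p ∷ All.applyUpTo⁺₂ _ _ (λ i → evaluate _ (frobenius-ι (suc i))))
      (ℕ.≤-reflexive (≡.trans (length-X^- 1 p (ℕ.≤-trans (s≤s z≤n) 2≤p))
        (≡.cong suc (≡.trans (≡.sym (ℕ.suc-pred p)) (≡.cong suc (≡.sym (length-applyUpTo _ (ℕ.pred p))))))))
    zero-coeff : ¬ InPrimeField x → ∀ i → coeff f i ≈ 0#
    zero-coeff x∉ = vanishing⇒zero f (vanishing x∉)

  ∈-resp : ∀ {x y} → x ≈ y → InPrimeField x → InPrimeField y
  ∈-resp x≈y (n , x≈ιn) = n , trans (sym x≈y) x≈ιn

  ι-∈ : ∀ n → InPrimeField (ι n)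
  ι-∈ n = n , refl

  0-∈ : InPrimeField 0#
  0-∈ = ι-∈ 0

  1-∈ : InPrimeField 1#
  1-∈ = 1 , sym (+-identityʳ 1#)

  -- Closure under the field operations, negation and inversion included, is uniform when read off
  -- from x ^ p = x; with representatives in ℕ each operation would need its own argument.
  +-∈ : ∀ {x y} → InPrimeField x → InPrimeField y → InPrimeField (x + y)
  +-∈ x∈ y∈ = fixed⇒∈ (trans (frobenius-+ _ _) (+-cong (∈⇒fixed x∈) (∈⇒fixed y∈)))

  *-∈ : ∀ {x y} → InPrimeField x → InPrimeField y → InPrimeField (x * y)
  *-∈ x∈ y∈ = fixed⇒∈ (trans (frobenius-* _ _) (*-cong (∈⇒fixed x∈) (∈⇒fixed y∈)))

  -‿∈ : ∀ {x} → InPrimeField x → InPrimeField (- x)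
  -‿∈ x∈ = fixed⇒∈ (trans (frobenius-- _) (-‿cong (∈⇒fixed x∈)))

  ^-∈ : ∀ {x} n → InPrimeField x → InPrimeField (x ^ n)
  ^-∈ zero    x∈ = 1-∈
  ^-∈ (suc n) x∈ = *-∈ x∈ (^-∈ n x∈)

  inverse-∈ : ∀ {x y} → x * y ≈ 1# → InPrimeField x → InPrimeField y
  inverse-∈ {x} {y} xy≈1 x∈ = fixed⇒∈ (solve 3 (λ x y z →
      (:- z by x :* y := :1) ∷ (y by x :* z := :1) ∷ [] ⊢ z := y) x y (y ^ p) xy≈1 (begin
    x * y ^ p       ≈⟨ *-congʳ (∈⇒fixed x∈) ⟨
    x ^ p * y ^ p   ≈⟨ frobenius-* x y ⟨
    (x * y) ^ p     ≈⟨ trans (^-congˡ p xy≈1) (1^ p) ⟩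
    1#              ∎))

  -- If all the 2q elements of 𝔽ₚˣ were squares, they would be roots of X^q - 1.
  ∃-nonsquare : 2 ℕ.< p → ∃[ d ] InPrimeField d × (∀ r → InPrimeField r → ¬ r ^ 2 ≈ d)
  ∃-nonsquare 2<p with ∃𝔽ₚ? {P = NonSquare} nonsquare-resp nonsquare?
    where
    NonSquare : ∣K∣ → Set _
    NonSquare d = ¬ (∃[ r ] InPrimeField r × r ^ 2 ≈ d)
    nonsquare-resp : ∀ {x y} → x ≈ y → NonSquare x → NonSquare y
    nonsquare-resp x≈y ns (r , r∈ , eq) = ns (r , r∈ , trans eq (sym x≈y))
    nonsquare? : ∀ d → Dec (NonSquare d)
    nonsquare? d = ¬? (∃𝔽ₚ? (λ x≈y eq → trans (^-congˡ 2 (sym x≈y)) eq) (λ r → (r ^ 2) ≟ d))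
  ... | yes (d , d∈ , ns) = d , d∈ , λ r r∈ eq → ns (r , r∈ , eq)
  -- X^q - 1 would then vanish everywhere; its value at 0 is -1, because q > 0.
  ... | no  all-squares   = ⊥-elim (1≉0 (solve 1 (λ e → (:- :1 by e :- :1 := con 0) ∷ (:1 by e := con 0) ∷ [] ⊢ :1 := con 0) (0# ^ q)
      (trans (sym (evaluate 0#)) (vanishing 0#)) (0^q 0<q)))
    where
    q = p ℕ./ 2
    0<q : 0 ℕ.< q
    0<q = ℕ.m≥n⇒m/n>0 {p} {2} (ℕ.<⇒≤ 2<p)
    0^q : ∀ {n} → 0 ℕ.< n → 0# ^ n ≈ 0#
    0^q {suc n} _ = zeroˡ _
    p≡1+q*2 : p ≡ suc (q ℕ.* 2)
    p≡1+q*2 = odd-prime 2<p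
    f = X^ q -ᴾ X^ 0
    evaluate : ∀ x → eval f x ≈ x ^ q - 1#
    evaluate x = trans (eval-- (X^ q) (X^ 0) x) (+-cong (eval-X^ q x) (-‿cong (eval-1 x)))
    square-power : ∀ r {x} → InPrimeField r → r ^ 2 ≈ x → x ≉ 0# → x ^ q ≈ 1#
    square-power r {x} r∈ r²≈x x≉0 = *-cancelˡ-≉0 r≉0 (begin
      r * x ^ q           ≈⟨ *-congˡ (^-congˡ q r²≈x) ⟨
      r * (r ^ 2) ^ q     ≈⟨ *-congˡ (^-assocʳ r 2 q) ⟩
      r ^ suc (2 ℕ.* q)   ≡⟨ ≡.cong (λ k → r ^ suc k) (ℕ.*-comm 2 q) ⟩
      r ^ suc (q ℕ.* 2)   ≡⟨ ≡.cong (r ^_) p≡1+q*2 ⟨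
      r ^ p               ≈⟨ ∈⇒fixed r∈ ⟩
      r                   ≈⟨ *-identityʳ r ⟨
      r * 1#              ∎)
      where
      r≉0 : r ≉ 0#
      r≉0 r≈0 = x≉0 (trans (sym r²≈x) (trans (*-congʳ r≈0) (zeroˡ _)))
    root : ∀ {i} → i ℕ.< q ℕ.* 2 → eval f (ι (suc i)) ≈ 0#
    root {i} i<2q with ∃𝔽ₚ? (λ x≈y eq → trans (^-congˡ 2 (sym x≈y)) eq) (λ r → (r ^ 2) ≟ ι (suc i))
    ... | yes (r , r∈ , eq) = trans (evaluate _) (x≈y⇒x∙y⁻¹≈ε (square-power r r∈ eq
            (ι-≉0 (suc i) (s≤s z≤n) (≡.subst (suc i ℕ.<_) (≡.sym p≡1+q*2) (s≤s i<2q)))))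
    ... | no  ns            = contradiction (ι (suc i) , ι-∈ (suc i) , ns) all-squares
    vanishing : ∀ x → eval f x ≈ 0#
    vanishing = many-roots⇒vanishing f
      (residues-distinct (≡.subst (q ℕ.* 2 ℕ.<_) (≡.sym p≡1+q*2) (ℕ.n<1+n _)))
      (All.applyUpTo⁺₁ _ _ root)
      (ℕ.≤-trans (ℕ.≤-reflexive (length-X^- 0 q z≤n))
        (ℕ.≤-trans (ℕ.≤-trans (ℕ.+-monoˡ-≤ q 0<q) (ℕ.≤-reflexive (≡.trans (≡.cong (q ℕ.+_) (≡.sym (ℕ.+-identityʳ q))) (ℕ.*-comm 2 q))))
          (ℕ.≤-reflexive (≡.sym (length-applyUpTo _ (q ℕ.* 2))))))

-- Common notation

module Context {c ℓ : Level} {p : ℕ} (p-prime : Prime p) (3<p : 3 < p) (K : AlgebraicClosure𝔽 c ℓ p) where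
  open AlgebraicClosure𝔽 K public
  open CommutativeRing commutativeRing hiding (zero) renaming (Carrier to ∣K∣) public
  open CommutativeRingSolver commutativeRing hiding (⟦_⟧) public
  open Polynomial commutativeRing public
  open PrimeSubfield commutativeRing public
  open Exp commutativeSemiring using (_^_; ^-congˡ) public
  open RingProperties ring using (x∙y⁻¹≈ε⇒x≈y; x≈y⇒x∙y⁻¹≈ε; -‿involutive) public
  open SetoidReasoning setoid public
  open Fields K public
  open PrimeField p-prime K public
  open SupersingularGraphs p K hiding (_∈_) public

  :cubic : ∀ {n} → Expr n → Expr n → Expr n → Expr n
  :cubic A B x = x :^ 3 :+ A :* x :+ B

  :slope :veluA :veluB :disc : ∀ {n} → Expr n → Expr n → Expr n
  :slope A r = con 3 :* r :^ 2 :+ A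
  :veluA A r = :- (con 4 :* A :+ con 15 :* r :^ 2)
  :veluB A r = :- (con 8 :* (A :* r) :+ con 22 :* r :^ 3)
  :disc A B = con 4 :* A :^ 3 :+ con 27 :* B :^ 2

-- The addition law and isomorphisms over the closure

module Curves {c ℓ : Level} {p : ℕ} (p-prime : Prime p) (3<p : 3 < p) (K : AlgebraicClosure𝔽 c ℓ p) where
  open Context p-prime 3<p K

  2≉0 : ι 2 ≉ 0#
  2≉0 = ι-≉0 2 (s≤s z≤n) (ℕ.<-trans (ℕ.n<1+n 2) 3<p)

  3≉0 : ι 3 ≉ 0#
  3≉0 = ι-≉0 3 (s≤s z≤n) 3<p

  /-unique : ∀ {x y q} → y ≉ 0# → q * y ≈ x → x / y ≈ q
  /-unique {x} {y} {q} y≉0 qy≈x with y ≟ 0#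
  ... | yes y≈0 = contradiction y≈0 y≉0
  ... | no  y≉0′ with y⁻¹ , yy⁻¹ ← inverse y y≉0′ =
    solve 4 (λ x y y⁻¹ q → (q by y :* y⁻¹ := :1) ∷ (:- y⁻¹ by q :* y := x) ∷ [] ⊢ x :* y⁻¹ := q) x y y⁻¹ q yy⁻¹ qy≈x

  /-* : ∀ {x y} → y ≉ 0# → (x / y) * y ≈ x
  /-* {x} {y} y≉0 with y ≟ 0#
  ... | yes y≈0 = contradiction y≈0 y≉0
  ... | no  y≉0′ with y⁻¹ , yy⁻¹ ← inverse y y≉0′ =
    solve 3 (λ x y y⁻¹ → (x by y :* y⁻¹ := :1) ∷ [] ⊢ (x :* y⁻¹) :* y := x) x y y⁻¹ yy⁻¹

  ≈ₚ-refl : ∀ {P} → P ≈ₚ P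
  ≈ₚ-refl {∞}       = ∞
  ≈ₚ-refl {aff _ _} = aff refl refl

  ≈ₚ-sym : ∀ {P Q} → P ≈ₚ Q → Q ≈ₚ P
  ≈ₚ-sym ∞         = ∞
  ≈ₚ-sym (aff e f) = aff (sym e) (sym f)

  ≈ₚ-trans : ∀ {P Q R} → P ≈ₚ Q → Q ≈ₚ R → P ≈ₚ R
  ≈ₚ-trans ∞         ∞           = ∞
  ≈ₚ-trans (aff e f) (aff e′ f′) = aff (trans e e′) (trans f f′)

  ≈ₚ-reflexive : ∀ {P Q} → P ≡ Q → P ≈ₚ Q
  ≈ₚ-reflexive ≡.refl = ≈ₚ-refl

  ≈∞⇒≡∞ : ∀ {P} → P ≈ₚ ∞ → P ≡ ∞
  ≈∞⇒≡∞ ∞ = ≡.refl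

  On : Weierstrass → ∣K∣ → ∣K∣ → Set ℓ
  On E x y = y ^ 2 ≈ x ^ 3 + A E * x + B E

  ∈ₑ-resp : ∀ {E P Q} → P ≈ₚ Q → P ∈ₑ E → Q ∈ₑ E
  ∈ₑ-resp         ∞                           ∞        = ∞
  ∈ₑ-resp {E} (aff {x} {y} {x′} {y′} x≈ y≈) (aff on) = aff (begin
    y′ ^ 2                     ≈⟨ ^-congˡ 2 y≈ ⟨
    y ^ 2                      ≈⟨ on ⟩
    x ^ 3 + A E * x + B E      ≈⟨ +-congʳ (+-cong (^-congˡ 3 x≈) (*-congˡ x≈)) ⟩
    x′ ^ 3 + A E * x′ + B E    ∎)

  Root : Weierstrass → ∣K∣ → Set ℓ
  Root E r = r ^ 3 + A E * r + B E ≈ 0#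

  -- 4A³ + 27B² is the resultant of the cubic and its derivative; the cofactors write it as a
  -- combination of the two.
  double-root⇒singular : ∀ E x → Root E x → ι 3 * x ^ 2 + A E ≈ 0# → disc E ≈ 0#
  double-root⇒singular E x fx≈0 f′x≈0 =
    solve 3 (λ x A B →
        (con 27 :* (B :- x :^ 3 :- A :* x) by :cubic A B x := con 0)
      ∷ (con 4 :* A :^ 2 :+ con 15 :* (x :^ 2 :* A) :+ con 9 :* x :^ 4 by :slope A x := con 0) ∷ []
      ⊢ :disc A B := con 0) x (A E) (B E) fx≈0 f′x≈0

  -- x³ + A x + B - (m x + n)² = (x - x₁)(x - x₂)(x - x₃)
  record Line (E : Weierstrass) (x₁ y₁ x₂ y₂ x₃ : ∣K∣) : Set (c Level.⊔ ℓ) where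
    field
      m n : ∣K∣
      on₁ : y₁ ≈ m * x₁ + n
      on₂ : y₂ ≈ m * x₂ + n
      e₁  : x₁ + x₂ + x₃ ≈ m ^ 2
      e₂  : x₁ * x₂ + x₁ * x₃ + x₂ * x₃ ≈ A E - ι 2 * (m * n)
      e₃  : x₁ * x₂ * x₃ ≈ n ^ 2 - B E

    y₃ : ∣K∣
    y₃ = m * x₃ + n

    third-on : On E x₃ (- y₃)
    third-on = solve 7 (λ x₁ x₂ x₃ m n A B →
        (:- x₃ :^ 2 by x₁ :+ x₂ :+ x₃ := m :^ 2)
      ∷ (x₃ by x₁ :* x₂ :+ x₁ :* x₃ :+ x₂ :* x₃ := A :- con 2 :* (m :* n))
      ∷ (:- :1 by x₁ :* x₂ :* x₃ := n :^ 2 :- B) ∷ []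
      ⊢ (:- (m :* x₃ :+ n)) :^ 2 := :cubic A B x₃) x₁ x₂ x₃ m n (A E) (B E) e₁ e₂ e₃

  private
    -- Once two of Vieta's relations hold, the third follows from evaluating the cubic at the known
    -- root x₁.
    e₃-from : ∀ E x₁ y₁ x₂ x₃ m n → On E x₁ y₁ → y₁ ≈ m * x₁ + n → x₁ + x₂ + x₃ ≈ m ^ 2 →
              x₁ * x₂ + x₁ * x₃ + x₂ * x₃ ≈ A E - ι 2 * (m * n) → x₁ * x₂ * x₃ ≈ n ^ 2 - B E
    e₃-from E x₁ y₁ x₂ x₃ m n = solve 8 (λ x₁ y₁ x₂ x₃ m n A B →
        (:- :1 by y₁ :^ 2 := :cubic A B x₁)
      ∷ (y₁ :+ m :* x₁ :+ n by y₁ := m :* x₁ :+ n)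
      ∷ (:- x₁ :^ 2 by x₁ :+ x₂ :+ x₃ := m :^ 2)
      ∷ (x₁ by x₁ :* x₂ :+ x₁ :* x₃ :+ x₂ :* x₃ := A :- con 2 :* (m :* n)) ∷ []
      ⊢ x₁ :* x₂ :* x₃ := n :^ 2 :- B) x₁ y₁ x₂ x₃ m n (A E) (B E)

    chord-y : ∀ m x₁ x₃ y₁ → m * (x₁ - x₃) - y₁ ≈ - (m * x₃ + (y₁ - m * x₁))
    chord-y = solve 4 (λ m x₁ x₃ y₁ → [] ⊢ m :* (x₁ :- x₃) :- y₁ := :- (m :* x₃ :+ (y₁ :- m :* x₁)))

  equal-ordinates : ∀ E {x₁ y₁ x₂ y₂} → On E x₁ y₁ → On E x₂ y₂ → x₁ ≈ x₂ → y₁ ≉ - y₂ → y₁ ≈ y₂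
  equal-ordinates E {x₁} {y₁} {x₂} {y₂} on₁ on₂ x₁≈x₂ y₁≉-y₂ =
    x∙y⁻¹≈ε⇒x≈y _ _ (x*y≈0⇒y≈0 sum≉0 (begin
      (y₁ + y₂) * (y₁ - y₂)   ≈⟨ solve 2 (λ y₁ y₂ → [] ⊢ (y₁ :+ y₂) :* (y₁ :- y₂) := y₁ :^ 2 :- y₂ :^ 2) y₁ y₂ ⟩
      y₁ ^ 2 - y₂ ^ 2         ≈⟨ x≈y⇒x∙y⁻¹≈ε (trans on₁ (trans (+-congʳ (+-cong (^-congˡ 3 x₁≈x₂) (*-congˡ x₁≈x₂))) (sym on₂))) ⟩
      0#                      ∎))
    where
    sum≉0 : y₁ + y₂ ≉ 0#
    sum≉0 s≈0 = y₁≉-y₂ (solve 2 (λ y₁ y₂ → (:1 by y₁ :+ y₂ := con 0) ∷ [] ⊢ y₁ := :- y₂) y₁ y₂ s≈0)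

  double≉0 : ∀ {y z} → y ≉ - z → y ≈ z → ι 2 * y ≉ 0#
  double≉0 {y} {z} y≉-z y≈z 2y≈0 = y≉-z
    (solve 2 (λ y z → (:1 by con 2 :* y := con 0) ∷ (:- :1 by y := z) ∷ [] ⊢ y := :- z) y z 2y≈0 y≈z)

  Collinear : Weierstrass → (x₁ y₁ x₂ y₂ : ∣K∣) → Point → Set (c Level.⊔ ℓ)
  Collinear E x₁ y₁ x₂ y₂ R = ∃[ x₃ ] ∃[ L ] R ≈ₚ aff x₃ (- Line.y₃ {E} {x₁} {y₁} {x₂} {y₂} {x₃} L)

  -- Chord and tangent are merged here: unless the points are opposite, the sum is minus the third
  -- point of a `Line`. The homomorphism proofs then transport lines and need not repeat the case
  -- distinction of `add`.
  add-cases : ∀ E {x₁ y₁ x₂ y₂} → On E x₁ y₁ → On E x₂ y₂ →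
              (x₁ ≈ x₂ × y₁ ≈ - y₂ × add E (aff x₁ y₁) (aff x₂ y₂) ≡ ∞)
              ⊎ Collinear E x₁ y₁ x₂ y₂ (add E (aff x₁ y₁) (aff x₂ y₂))
  add-cases E {x₁} {y₁} {x₂} {y₂} on₁ on₂ with x₁ ≟ x₂ | y₁ ≟ (- y₂)
  ... | yes x₁≈x₂ | yes y₁≈-y₂ = inj₁ (x₁≈x₂ , y₁≈-y₂ , ≡.refl)
  ... | yes x₁≈x₂ | no  y₁≉-y₂ = inj₂ (x₃ , record
    { m = m ; n = n
    ; on₁ = on₁′
    ; on₂ = solve 5 (λ x₁ y₁ x₂ y₂ m → (m by x₁ := x₂) ∷ (:- :1 by y₁ := y₂) ∷ [] ⊢ y₂ := m :* x₂ :+ (y₁ :- m :* x₁)) x₁ y₁ x₂ y₂ m x₁≈x₂ y₁≈y₂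
    ; e₁ = e₁
    ; e₂ = e₂
    ; e₃ = e₃-from E x₁ y₁ x₂ x₃ m n on₁ on₁′ e₁ e₂
    } , aff refl (chord-y m x₁ x₃ y₁))
    where
    y₁≈y₂ = equal-ordinates E on₁ on₂ x₁≈x₂ y₁≉-y₂
    m = (ι 3 * x₁ ^ 2 + A E) / (ι 2 * y₁)
    n = y₁ - m * x₁
    x₃ = m ^ 2 - x₁ - x₂
    on₁′ : y₁ ≈ m * x₁ + n
    on₁′ = solve 3 (λ x₁ y₁ m → [] ⊢ y₁ := m :* x₁ :+ (y₁ :- m :* x₁)) x₁ y₁ m
    e₁ : x₁ + x₂ + x₃ ≈ m ^ 2
    e₁ = solve 3 (λ x₁ x₂ m → [] ⊢ x₁ :+ x₂ :+ (m :^ 2 :- x₁ :- x₂) := m :^ 2) x₁ x₂ m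
    e₂ : x₁ * x₂ + x₁ * x₃ + x₂ * x₃ ≈ A E - ι 2 * (m * n)
    e₂ = solve 5 (λ x₁ y₁ x₂ m A →
        (:1 by m :* (con 2 :* y₁) := :slope A x₁)
      ∷ (con 2 :* x₁ :+ x₂ :- m :^ 2 by x₁ := x₂) ∷ []
      ⊢ x₁ :* x₂ :+ x₁ :* (m :^ 2 :- x₁ :- x₂) :+ x₂ :* (m :^ 2 :- x₁ :- x₂) := A :- con 2 :* (m :* (y₁ :- m :* x₁)))
      x₁ y₁ x₂ m (A E) (/-* (double≉0 y₁≉-y₂ y₁≈y₂)) x₁≈x₂
  ... | no x₁≉x₂ | _ = inj₂ (x₃ , record
    { m = m ; n = n
    ; on₁ = on₁′
    ; on₂ = solve 5 (λ x₁ y₁ x₂ y₂ m → (:- :1 by m :* (x₂ :- x₁) := y₂ :- y₁) ∷ [] ⊢ y₂ := m :* x₂ :+ (y₁ :- m :* x₁)) x₁ y₁ x₂ y₂ m slope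
    ; e₁ = e₁
    ; e₂ = e₂
    ; e₃ = e₃-from E x₁ y₁ x₂ x₃ m n on₁ on₁′ e₁ e₂
    } , aff refl (chord-y m x₁ x₃ y₁))
    where
    x₂-x₁≉0 : x₂ - x₁ ≉ 0#
    x₂-x₁≉0 = -≉0 (λ x₂≈x₁ → x₁≉x₂ (sym x₂≈x₁))
    m = (y₂ - y₁) / (x₂ - x₁)
    slope : m * (x₂ - x₁) ≈ y₂ - y₁
    slope = /-* x₂-x₁≉0
    n = y₁ - m * x₁
    x₃ = m ^ 2 - x₁ - x₂
    on₁′ : y₁ ≈ m * x₁ + n
    on₁′ = solve 3 (λ x₁ y₁ m → [] ⊢ y₁ := m :* x₁ :+ (y₁ :- m :* x₁)) x₁ y₁ m
    e₁ : x₁ + x₂ + x₃ ≈ m ^ 2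
    e₁ = solve 3 (λ x₁ x₂ m → [] ⊢ x₁ :+ x₂ :+ (m :^ 2 :- x₁ :- x₂) := m :^ 2) x₁ x₂ m
    e₂ : x₁ * x₂ + x₁ * x₃ + x₂ * x₃ ≈ A E - ι 2 * (m * n)
    -- The difference of the two curve equations yields the relation only after multiplication by x₂
    -- - x₁.
    e₂ = *-cancelˡ-≉0 x₂-x₁≉0 (solve 7 (λ x₁ y₁ x₂ y₂ m A B →
        (m :* (x₂ :- x₁) :+ y₁ :+ y₂ by m :* (x₂ :- x₁) := y₂ :- y₁) ∷ (:- :1 by y₁ :^ 2 := :cubic A B x₁) ∷ (:1 by y₂ :^ 2 := :cubic A B x₂) ∷ []
      ⊢ (x₂ :- x₁) :* (x₁ :* x₂ :+ x₁ :* (m :^ 2 :- x₁ :- x₂) :+ x₂ :* (m :^ 2 :- x₁ :- x₂)) := (x₂ :- x₁) :* (A :- con 2 :* (m :* (y₁ :- m :* x₁))))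
      x₁ y₁ x₂ y₂ m (A E) (B E) slope on₁ on₂)

  private
    chord-line : ∀ {E x₁ y₁ x₂ y₂ x₃} (L : Line E x₁ y₁ x₂ y₂ x₃) {k} → k ≈ Line.m L →
                 chord k x₁ y₁ x₂ ≈ₚ aff x₃ (- Line.y₃ L)
    chord-line {E} {x₁} {y₁} {x₂} {y₂} {x₃} L {k} k≈m = aff third (begin
      k * (x₁ - (k ^ 2 - x₁ - x₂)) - y₁
        ≈⟨ +-congʳ (*-cong k≈m (+-congˡ (-‿cong third))) ⟩
      m * (x₁ - x₃) - y₁
        ≈⟨ solve 5 (λ m n x₁ y₁ x₃ → (:- :1 by y₁ := m :* x₁ :+ n) ∷ [] ⊢ m :* (x₁ :- x₃) :- y₁ := :- (m :* x₃ :+ n)) m n x₁ y₁ x₃ on₁ ⟩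
      - (m * x₃ + n) ∎)
      where
      open Line L
      third : k ^ 2 - x₁ - x₂ ≈ x₃
      third = solve 5 (λ k m x₁ x₂ x₃ → (k :+ m by k := m) ∷ (:- :1 by x₁ :+ x₂ :+ x₃ := m :^ 2) ∷ [] ⊢ k :^ 2 :- x₁ :- x₂ := x₃) k m x₁ x₂ x₃ k≈m e₁

    module TangentLine {E x₁ y₁ x₂ y₂ x₃} (L : Line E x₁ y₁ x₂ y₂ x₃) (x₁≈x₂ : x₁ ≈ x₂) where
      open Line L

      y₁≈y₂ : y₁ ≈ y₂
      y₁≈y₂ = trans on₁ (trans (+-congʳ (*-congˡ x₁≈x₂)) (sym on₂))

      tangent : m * (ι 2 * y₁) ≈ ι 3 * x₁ ^ 2 + A E
      tangent = solve 7 (λ m n x₁ y₁ x₂ x₃ A →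
          (con 2 :* m by y₁ := m :* x₁ :+ n) ∷ (x₃ :- x₁ by x₁ := x₂) ∷ (:- (con 2 :* x₁) by x₁ :+ x₂ :+ x₃ := m :^ 2)
        ∷ (:1 by x₁ :* x₂ :+ x₁ :* x₃ :+ x₂ :* x₃ := A :- con 2 :* (m :* n)) ∷ []
        ⊢ m :* (con 2 :* y₁) := :slope A x₁) m n x₁ y₁ x₂ x₃ (A E) on₁ x₁≈x₂ e₁ e₂

      on : On E x₁ y₁
      on = solve 8 (λ x₁ y₁ x₂ x₃ m n A B →
          (y₁ :+ m :* x₁ :+ n by y₁ := m :* x₁ :+ n)
        ∷ (:- x₁ :^ 2 by x₁ :+ x₂ :+ x₃ := m :^ 2)
        ∷ (x₁ by x₁ :* x₂ :+ x₁ :* x₃ :+ x₂ :* x₃ := A :- con 2 :* (m :* n))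
        ∷ (:- :1 by x₁ :* x₂ :* x₃ := n :^ 2 :- B) ∷ []
        ⊢ y₁ :^ 2 := :cubic A B x₁) x₁ y₁ x₂ x₃ m n (A E) (B E) on₁ e₁ e₂ e₃

      opposite⇒singular : y₁ ≈ - y₂ → disc E ≈ 0#
      opposite⇒singular y₁≈-y₂ = double-root⇒singular E x₁
        (trans (sym on) (trans (*-congʳ y₁≈0) (zeroˡ _)))
        (trans (sym tangent) (trans (*-congˡ (trans (*-congˡ y₁≈0) (zeroʳ _))) (zeroʳ _)))
        where
        y₁≈0 : y₁ ≈ 0#
        y₁≈0 = x*y≈0⇒y≈0 2≉0 (solve 2 (λ y₁ y₂ → (:1 by y₁ := y₂) ∷ (:1 by y₁ := :- y₂) ∷ [] ⊢ con 2 :* y₁ := con 0) y₁ y₂ y₁≈y₂ y₁≈-y₂)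

  -- A `Line` fixes the slope that `add` computes, both for a chord and for a tangent. Ellipticity
  -- excludes the remaining branch: a line of finite slope that is tangent where y = 0 would make
  -- the cubic and its derivative vanish together.
  add-line : ∀ E → IsElliptic E → ∀ {x₁ y₁ x₂ y₂ x₃} (L : Line E x₁ y₁ x₂ y₂ x₃) →
             add E (aff x₁ y₁) (aff x₂ y₂) ≈ₚ aff x₃ (- Line.y₃ L)
  add-line E elliptic {x₁} {y₁} {x₂} {y₂} {x₃} L with x₁ ≟ x₂ | y₁ ≟ (- y₂)
  ... | no x₁≉x₂ | _ = chord-line L (/-unique (-≉0 (λ x₂≈x₁ → x₁≉x₂ (sym x₂≈x₁)))
      (solve 6 (λ m n x₁ y₁ x₂ y₂ → (:1 by y₁ := m :* x₁ :+ n) ∷ (:- :1 by y₂ := m :* x₂ :+ n) ∷ []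
        ⊢ m :* (x₂ :- x₁) := y₂ :- y₁) m n x₁ y₁ x₂ y₂ on₁ on₂))
    where open Line L
  ... | yes x₁≈x₂ | no y₁≉-y₂ = chord-line L (/-unique (double≉0 y₁≉-y₂ y₁≈y₂) tangent)
    where open TangentLine L x₁≈x₂
  ... | yes x₁≈x₂ | yes y₁≈-y₂ = ⊥-elim (elliptic (opposite⇒singular y₁≈-y₂))
    where open TangentLine L x₁≈x₂

  add-opposite : ∀ E {x₁ y₁ x₂ y₂} → x₁ ≈ x₂ → y₁ ≈ - y₂ → add E (aff x₁ y₁) (aff x₂ y₂) ≡ ∞
  add-opposite E {x₁} {y₁} {x₂} {y₂} x₁≈x₂ y₁≈-y₂ with x₁ ≟ x₂ | y₁ ≟ (- y₂)
  ... | yes _    | yes _    = ≡.refl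
  ... | yes _    | no y₁≉   = contradiction y₁≈-y₂ y₁≉
  ... | no x₁≉x₂ | _        = contradiction x₁≈x₂ x₁≉x₂

  add-identityʳ : ∀ E P → add E P ∞ ≡ P
  add-identityʳ E ∞         = ≡.refl
  add-identityʳ E (aff _ _) = ≡.refl

  Line-resp : ∀ {E x₁ y₁ x₂ y₂ x₃ x₁′ y₁′ x₂′ y₂′} → x₁ ≈ x₁′ → y₁ ≈ y₁′ → x₂ ≈ x₂′ → y₂ ≈ y₂′ →
              Line E x₁ y₁ x₂ y₂ x₃ → Line E x₁′ y₁′ x₂′ y₂′ x₃
  Line-resp x₁≈ y₁≈ x₂≈ y₂≈ L = record
    { m = m ; n = n
    ; on₁ = trans (sym y₁≈) (trans on₁ (+-congʳ (*-congˡ x₁≈)))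
    ; on₂ = trans (sym y₂≈) (trans on₂ (+-congʳ (*-congˡ x₂≈)))
    ; e₁ = trans (sym (+-congʳ (+-cong x₁≈ x₂≈))) e₁
    ; e₂ = trans (sym (+-cong (+-cong (*-cong x₁≈ x₂≈) (*-congʳ x₁≈)) (*-congʳ x₂≈))) e₂
    ; e₃ = trans (sym (*-congʳ (*-cong x₁≈ x₂≈))) e₃
    }
    where open Line L

  -- `add` branches on its arguments, so instead of following the branches the same `Line` is reused
  -- for the equal points.
  add-cong : ∀ E → IsElliptic E → ∀ {P P′ Q Q′} → P ∈ₑ E → Q ∈ₑ E → P ≈ₚ P′ → Q ≈ₚ Q′ →
             add E P Q ≈ₚ add E P′ Q′
  add-cong E elliptic ∞ _ ∞ Q≈Q′ = Q≈Q′
  add-cong E elliptic (aff _) ∞ (aff e f) ∞ = aff e f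
  add-cong E elliptic (aff on₁) (aff on₂) (aff x₁≈ y₁≈) (aff x₂≈ y₂≈) with add-cases E on₁ on₂
  ... | inj₁ (x₁≈x₂ , y₁≈-y₂ , eq) =
    ≈ₚ-reflexive (≡.trans eq (≡.sym (add-opposite E
      (trans (sym x₁≈) (trans x₁≈x₂ x₂≈)) (trans (sym y₁≈) (trans y₁≈-y₂ (-‿cong y₂≈))))))
  ... | inj₂ (x₃ , L , eq) = ≈ₚ-trans eq (≈ₚ-sym (add-line E elliptic (Line-resp x₁≈ y₁≈ x₂≈ y₂≈ L)))

  add-∈ : ∀ E {P Q} → P ∈ₑ E → Q ∈ₑ E → add E P Q ∈ₑ E
  add-∈ E ∞         Q∈        = Q∈
  add-∈ E (aff on₁) ∞         = aff on₁
  add-∈ E (aff on₁) (aff on₂) with add-cases E on₁ on₂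
  ... | inj₁ (_ , _ , eq)  = ≡.subst (_∈ₑ E) (≡.sym eq) ∞
  ... | inj₂ (x₃ , L , eq) = ∈ₑ-resp (≈ₚ-sym eq) (aff (Line.third-on L))

  mult-∈ : ∀ E n {P} → P ∈ₑ E → mult E n P ∈ₑ E
  mult-∈ E zero    P∈ = ∞
  mult-∈ E (suc n) P∈ = add-∈ E P∈ (mult-∈ E n P∈)

  record IsHomomorphism (E E′ : Weierstrass) (φ : Point → Point) : Set (c Level.⊔ ℓ) where
    field
      φ-∞   : φ ∞ ≡ ∞
      φ-∈   : ∀ {P} → P ∈ₑ E → φ P ∈ₑ E′
      φ-add : ∀ {P Q} → P ∈ₑ E → Q ∈ₑ E → φ (add E P Q) ≈ₚ add E′ (φ P) (φ Q)

    φ-mult : IsElliptic E′ → ∀ n {P} → P ∈ₑ E → φ (mult E n P) ≈ₚ mult E′ n (φ P)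
    φ-mult elliptic zero    P∈ = ≈ₚ-reflexive φ-∞
    φ-mult elliptic (suc n) P∈ = ≈ₚ-trans (φ-add P∈ (mult-∈ E n P∈))
      (add-cong E′ elliptic (φ-∈ P∈) (φ-∈ (mult-∈ E n P∈)) ≈ₚ-refl (φ-mult elliptic n P∈))

    -- Supersingularity is pulled back rather than pushed forward, since pushing it forward would
    -- require preimages of points. The assumption on the kernel may use that P is killed by p,
    -- which suits kernels of order prime to p.
    supersingular-pullback : IsElliptic E′ → Supersingular E′ →
      (∀ P → P ∈ₑ E → mult E p P ≡ ∞ → φ P ≡ ∞ → P ≡ ∞) → Supersingular E
    supersingular-pullback elliptic supersingular kernel P P∈ pP≡∞ =
      kernel P P∈ pP≡∞ (supersingular (φ P) (φ-∈ P∈)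
        (≈∞⇒≡∞ (≈ₚ-trans (≈ₚ-sym (φ-mult elliptic p P∈)) (≈ₚ-reflexive (≡.trans (≡.cong φ pP≡∞) φ-∞)))))

  scalePoint : ∣K∣ → Point → Point
  scalePoint δ ∞         = ∞
  scalePoint δ (aff x y) = aff (δ ^ 2 * x) (δ ^ 3 * y)

  scalePoint-cong : ∀ {δ P Q} → P ≈ₚ Q → scalePoint δ P ≈ₚ scalePoint δ Q
  scalePoint-cong ∞         = ∞
  scalePoint-cong (aff e f) = aff (*-congˡ e) (*-congˡ f)

  -- An isomorphism over the closure. `_≅_` is the case of δ in the prime field, a quadratic twist
  -- the case where δ² lies there.
  record Scaling (δ : ∣K∣) (E E′ : Weierstrass) : Set ℓ where
    field
      δ≉0  : δ ≉ 0#
      A-eq : A E′ ≈ δ ^ 4 * A E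
      B-eq : B E′ ≈ δ ^ 6 * B E

    disc-eq : disc E′ ≈ δ ^ 12 * disc E
    disc-eq = solve 5 (λ δ A B A′ B′ →
        (con 4 :* (A′ :^ 2 :+ A′ :* (δ :^ 4 :* A) :+ (δ :^ 4 :* A) :^ 2) by A′ := δ :^ 4 :* A)
      ∷ (con 27 :* (B′ :+ δ :^ 6 :* B) by B′ := δ :^ 6 :* B) ∷ []
      ⊢ :disc A′ B′ := δ :^ 12 :* (:disc A B))
      δ (A E) (B E) (A E′) (B E′) A-eq B-eq

    scaling-elliptic : IsElliptic E → IsElliptic E′
    scaling-elliptic elliptic = ≉0-resp (sym disc-eq) (*-≉0 (^-≉0 12 δ≉0) elliptic)

    scaling-on : ∀ {x y} → On E x y → On E′ (δ ^ 2 * x) (δ ^ 3 * y)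
    scaling-on {x} {y} = solve 7 (λ δ A B A′ B′ x y →
        (:- (δ :^ 2 :* x) by A′ := δ :^ 4 :* A) ∷ (:- :1 by B′ := δ :^ 6 :* B) ∷ (δ :^ 6 by y :^ 2 := :cubic A B x) ∷ []
      ⊢ (δ :^ 3 :* y) :^ 2 := (δ :^ 2 :* x) :^ 3 :+ A′ :* (δ :^ 2 :* x) :+ B′)
      δ (A E) (B E) (A E′) (B E′) x y A-eq B-eq

    scaling-line : ∀ {x₁ y₁ x₂ y₂ x₃} → Line E x₁ y₁ x₂ y₂ x₃ →
                   Line E′ (δ ^ 2 * x₁) (δ ^ 3 * y₁) (δ ^ 2 * x₂) (δ ^ 3 * y₂) (δ ^ 2 * x₃)
    scaling-line {x₁} {y₁} {x₂} {y₂} {x₃} L = record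
      { m = δ * m ; n = δ ^ 3 * n
      ; on₁ = on-line x₁ y₁ on₁
      ; on₂ = on-line x₂ y₂ on₂
      ; e₁ = solve 5 (λ δ m x₁ x₂ x₃ → (δ :^ 2 by x₁ :+ x₂ :+ x₃ := m :^ 2) ∷ []
          ⊢ δ :^ 2 :* x₁ :+ δ :^ 2 :* x₂ :+ δ :^ 2 :* x₃ := (δ :* m) :^ 2) δ m x₁ x₂ x₃ e₁
      ; e₂ = solve 8 (λ δ m n x₁ x₂ x₃ A A′ → (δ :^ 4 by x₁ :* x₂ :+ x₁ :* x₃ :+ x₂ :* x₃ := A :- con 2 :* (m :* n)) ∷ (:- :1 by A′ := δ :^ 4 :* A) ∷ []
          ⊢ δ :^ 2 :* x₁ :* (δ :^ 2 :* x₂) :+ δ :^ 2 :* x₁ :* (δ :^ 2 :* x₃) :+ δ :^ 2 :* x₂ :* (δ :^ 2 :* x₃) := A′ :- con 2 :* (δ :* m :* (δ :^ 3 :* n)))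
          δ m n x₁ x₂ x₃ (A E) (A E′) e₂ A-eq
      ; e₃ = solve 7 (λ δ n x₁ x₂ x₃ B B′ → (δ :^ 6 by x₁ :* x₂ :* x₃ := n :^ 2 :- B) ∷ (:1 by B′ := δ :^ 6 :* B) ∷ []
          ⊢ δ :^ 2 :* x₁ :* (δ :^ 2 :* x₂) :* (δ :^ 2 :* x₃) := (δ :^ 3 :* n) :^ 2 :- B′) δ n x₁ x₂ x₃ (B E) (B E′) e₃ B-eq
      }
      where
      open Line L
      on-line : ∀ x y → y ≈ m * x + n → δ ^ 3 * y ≈ (δ * m) * (δ ^ 2 * x) + δ ^ 3 * n
      on-line = solve 5 (λ δ m n x y → (δ :^ 3 by y := m :* x :+ n) ∷ [] ⊢ δ :^ 3 :* y := (δ :* m) :* (δ :^ 2 :* x) :+ δ :^ 3 :* n) δ m n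

    scaling-homomorphism : IsElliptic E → IsHomomorphism E E′ (scalePoint δ)
    scaling-homomorphism elliptic = record { φ-∞ = ≡.refl ; φ-∈ = φ-∈ ; φ-add = φ-add }
      where
      φ-∈ : ∀ {P} → P ∈ₑ E → scalePoint δ P ∈ₑ E′
      φ-∈ ∞        = ∞
      φ-∈ (aff on) = aff (scaling-on on)
      φ-add : ∀ {P Q} → P ∈ₑ E → Q ∈ₑ E → scalePoint δ (add E P Q) ≈ₚ add E′ (scalePoint δ P) (scalePoint δ Q)
      φ-add ∞                 Q∈                = ≈ₚ-refl
      φ-add (aff on₁)         ∞                 = ≈ₚ-refl
      φ-add (aff on₁) (aff on₂) with add-cases E on₁ on₂
      ... | inj₁ (x₁≈x₂ , y₁≈-y₂ , eq) = ≈ₚ-reflexive (≡.trans (≡.cong (scalePoint δ) eq)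
              (≡.sym (add-opposite E′ (*-congˡ x₁≈x₂) (trans (*-congˡ y₁≈-y₂) (solve 2 (λ a b → [] ⊢ a :* (:- b) := :- (a :* b)) _ _)))))
      ... | inj₂ (x₃ , L , eq) = ≈ₚ-trans (scalePoint-cong eq) (≈ₚ-trans
              (aff refl (solve 4 (λ δ m x n → [] ⊢ δ :^ 3 :* (:- (m :* x :+ n)) := :- (δ :* m :* (δ :^ 2 :* x) :+ δ :^ 3 :* n)) δ (Line.m L) x₃ (Line.n L)))
              (≈ₚ-sym (add-line E′ (scaling-elliptic elliptic) (scaling-line L))))

    scaling-supersingular : IsElliptic E → Supersingular E′ → Supersingular E
    scaling-supersingular elliptic supersingular = IsHomomorphism.supersingular-pullback
      (scaling-homomorphism elliptic) (scaling-elliptic elliptic) supersingular (λ { ∞ _ _ _ → ≡.refl })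

-- Vélu's map respects addition

module VeluHomomorphism {c ℓ : Level} {p : ℕ} (p-prime : Prime p) (3<p : 3 < p) (K : AlgebraicClosure𝔽 c ℓ p) where
  open Context p-prime 3<p K
  open Curves p-prime 3<p K

  slope : Weierstrass → ∣K∣ → ∣K∣
  slope E r = ι 3 * r ^ 2 + A E

  -- Vélu's formulas for the quotient of E by (r , 0).
  velu : Weierstrass → ∣K∣ → Weierstrass
  velu E r = weierstrass (- (ι 4 * A E + ι 15 * r ^ 2)) (- (ι 8 * (A E * r) + ι 22 * r ^ 3))

  slope≉0 : ∀ E r → IsElliptic E → Root E r → slope E r ≉ 0#
  slope≉0 E r elliptic root b≈0 = elliptic (double-root⇒singular E r root b≈0)

  -- With ξ = x - r and b = `slope E r` this is (x + b/ξ , y (1 - b/ξ²)). The usual parameters A -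
  -- 5b and B - 7rb of the target become those of `velu` when B is eliminated by means of the root
  -- r.
  veluMap : Weierstrass → ∣K∣ → Point → Point
  veluMap E r ∞         = ∞
  veluMap E r (aff x y) with (x - r) ≟ 0#
  ... | yes _   = ∞
  ... | no  ξ≉0 = aff (x + slope E r * k) (y * (1# - slope E r * k ^ 2))
    where k = proj₁ (inverse (x - r) ξ≉0)

  veluMap-kernel : ∀ E {r x y} → x - r ≈ 0# → veluMap E r (aff x y) ≡ ∞
  veluMap-kernel E {r} {x} ξ≈0 with (x - r) ≟ 0#
  ... | yes _   = ≡.refl
  ... | no  ξ≉0 = contradiction ξ≈0 ξ≉0

  invertible⇒≉0 : ∀ {x y} → x * y ≈ 1# → x ≉ 0#
  invertible⇒≉0 xy≈1 x≈0 = 1≉0 (trans (sym xy≈1) (trans (*-congʳ x≈0) (zeroˡ _)))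

  inverse-unique : ∀ {x y z} → x * y ≈ 1# → x * z ≈ 1# → y ≈ z
  inverse-unique xy≈1 xz≈1 = *-cancelˡ-≉0 (invertible⇒≉0 xy≈1) (trans xy≈1 (sym xz≈1))

  veluMap-affine : ∀ E {r x y k} → (x - r) * k ≈ 1# →
                   veluMap E r (aff x y) ≈ₚ aff (x + slope E r * k) (y * (1# - slope E r * k ^ 2))
  veluMap-affine E {r} {x} {y} {k} ξk≈1 with (x - r) ≟ 0#
  ... | yes ξ≈0 = contradiction ξ≈0 (invertible⇒≉0 ξk≈1)
  ... | no  ξ≉0 = aff (+-congˡ (*-congˡ k′≈k)) (*-congˡ (+-congˡ (-‿cong (*-congˡ (^-congˡ 2 k′≈k)))))
    where
    k′≈k : proj₁ (inverse (x - r) ξ≉0) ≈ k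
    k′≈k = inverse-unique (proj₂ (inverse (x - r) ξ≉0)) ξk≈1

  veluMap-cong : ∀ E r {P Q} → P ≈ₚ Q → veluMap E r P ≈ₚ veluMap E r Q
  veluMap-cong E r ∞ = ∞
  veluMap-cong E r {aff x y} {aff x′ y′} (aff x≈x′ y≈y′) with (x - r) ≟ 0#
  ... | yes ξ≈0 = ≈ₚ-reflexive (≡.sym (veluMap-kernel E (trans (+-congʳ (sym x≈x′)) ξ≈0)))
  ... | no  ξ≉0 = ≈ₚ-trans (aff (+-congʳ x≈x′) (*-congʳ y≈y′))
                    (≈ₚ-sym (veluMap-affine E (trans (*-congʳ (+-congʳ (sym x≈x′))) (proj₂ (inverse (x - r) ξ≉0)))))

  kernel-ordinate : ∀ E r → Root E r → ∀ {x y} → On E x y → x - r ≈ 0# → y ≈ 0#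
  kernel-ordinate E r root {x} {y} on ξ≈0 = ^≈0⇒≈0 2 (solve 5 (λ x y r A B →
      (:1 by y :^ 2 := :cubic A B x) ∷ (:1 by :cubic A B r := con 0)
    ∷ (x :^ 2 :+ x :* r :+ r :^ 2 :+ A by x :- r := con 0) ∷ []
    ⊢ y :^ 2 := con 0) x y r (A E) (B E) on root ξ≈0)

  module _ (E : Weierstrass) (r : ∣K∣) (elliptic : IsElliptic E) (root : Root E r)
           (elliptic′ : IsElliptic (velu E r)) where
    private
      E′ = velu E r
      b = slope E r
      φ = veluMap E r

      b≉0 : b ≉ 0#
      b≉0 = slope≉0 E r elliptic root

      φ-on : ∀ {x y k} → On E x y → (x - r) * k ≈ 1# → On E′ (x + b * k) (y * (1# - b * k ^ 2))
      φ-on {x} {y} {k} = solve 6 (λ x y k r A B → let ξ = x :- r ; b = :slope A r in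
          ((:1 :- b :* k :^ 2) :^ 2 by :cubic A B r := con 0)
        ∷ ((:1 :- b :* k :^ 2) :^ 2 by y :^ 2 := :cubic A B x)
        ∷ (con 3 :* b :^ 2 :* k :^ 3 :* r :* ξ :+ b :^ 2 :* k :^ 3 :* ξ :^ 2 :+ b :^ 3 :* k :^ 3 :+ con 3 :* b :^ 2 :* k :^ 2 :* r :+ b :^ 2 :* k :^ 2 :* ξ
            :- con 6 :* b :* k :* r :* ξ :- con 2 :* b :* k :* ξ :^ 2 :- con 4 :* b :^ 2 :* k :- con 12 :* b :* r :- con 5 :* b :* ξ
           by (x :- r) :* k := :1) ∷ []
        ⊢ (y :* (:1 :- b :* k :^ 2)) :^ 2
            := (x :+ b :* k) :^ 3 :+ :veluA A r :* (x :+ b :* k) :+ :veluB A r)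
        x y k r (A E) (B E) root

      φ-∈ : ∀ {P} → P ∈ₑ E → φ P ∈ₑ E′
      φ-∈ ∞ = ∞
      φ-∈ {aff x y} (aff on) with (x - r) ≟ 0#
      ... | yes _   = ∞
      ... | no  ξ≉0 = aff (φ-on on (proj₂ (inverse (x - r) ξ≉0)))

      module _ {x₁ y₁ x₂ y₂ x₃ : ∣K∣} (L : Line E x₁ y₁ x₂ y₂ x₃) where
        open Line L
        private
          n′ = m * r + n
          ξ₁ = x₁ - r
          ξ₂ = x₂ - r
          ξ₃ = x₃ - r

        centred : ∀ x y → y ≈ m * x + n → y ≈ m * (x - r) + n′
        centred x y = solve 5 (λ x y m n r → (:1 by y := m :* x :+ n) ∷ [] ⊢ y := m :* (x :- r) :+ (m :* r :+ n)) x y m n r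

        s₁ : ξ₁ + ξ₂ + ξ₃ ≈ m ^ 2 - ι 3 * r
        s₁ = solve 5 (λ x₁ x₂ x₃ m r → (:1 by x₁ :+ x₂ :+ x₃ := m :^ 2) ∷ []
          ⊢ (x₁ :- r) :+ (x₂ :- r) :+ (x₃ :- r) := m :^ 2 :- con 3 :* r) x₁ x₂ x₃ m r e₁

        s₂ : ξ₁ * ξ₂ + ξ₁ * ξ₃ + ξ₂ * ξ₃ ≈ b - ι 2 * (m * n′)
        s₂ = solve 7 (λ x₁ x₂ x₃ m n r A →
            (:- (con 2 :* r) by x₁ :+ x₂ :+ x₃ := m :^ 2)
          ∷ (:1 by x₁ :* x₂ :+ x₁ :* x₃ :+ x₂ :* x₃ := A :- con 2 :* (m :* n)) ∷ []
          ⊢ (x₁ :- r) :* (x₂ :- r) :+ (x₁ :- r) :* (x₃ :- r) :+ (x₂ :- r) :* (x₃ :- r)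
              := (:slope A r) :- con 2 :* (m :* (m :* r :+ n))) x₁ x₂ x₃ m n r (A E) e₁ e₂

        s₃ : ξ₁ * ξ₂ * ξ₃ ≈ n′ ^ 2
        s₃ = solve 8 (λ x₁ x₂ x₃ m n r A B →
            (r :^ 2 by x₁ :+ x₂ :+ x₃ := m :^ 2)
          ∷ (:- r by x₁ :* x₂ :+ x₁ :* x₃ :+ x₂ :* x₃ := A :- con 2 :* (m :* n))
          ∷ (:1 by x₁ :* x₂ :* x₃ := n :^ 2 :- B)
          ∷ (:- :1 by :cubic A B r := con 0) ∷ []
          ⊢ (x₁ :- r) :* (x₂ :- r) :* (x₃ :- r) := (m :* r :+ n) :^ 2) x₁ x₂ x₃ m n r (A E) (B E) e₁ e₂ e₃ root

        -- zᵢ = yᵢ / ξᵢ satisfies zᵢ² = Xᵢ + 2r, and the zᵢ are the roots of a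
        -- cubic whose coefficients are read off from the line.
        image : ∀ {ν k₁ k₂ k₃} → n′ * ν ≈ 1# → ξ₁ * k₁ ≈ 1# → ξ₂ * k₂ ≈ 1# → ξ₃ * k₃ ≈ 1# →
                ∃[ L′ ] aff (x₃ + b * k₃) (- Line.y₃ {E′} {x₁ + b * k₁} {y₁ * (1# - b * k₁ ^ 2)}
                                              {x₂ + b * k₂} {y₂ * (1# - b * k₂ ^ 2)} {x₃ + b * k₃} L′)
                        ≈ₚ aff (x₃ + b * k₃) (- y₃ * (1# - b * k₃ ^ 2))
        image {ν} {k₁} {k₂} {k₃} n′ν≈1 ξk₁ ξk₂ ξk₃ = L′ , aff refl
            (trans (-‿cong (sym (on-image x₃ y₃ k₃ refl ξk₃ q₃ (proj₂ (proj₂ z-cubics)))))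
                   (solve 2 (λ a c → [] ⊢ :- (a :* c) := :- a :* c) y₃ _))
          where
          z : ∣K∣ → ∣K∣
          z k = m + n′ * k
          σ₃ = n′ + b * ν * m ^ 2 - ι 3 * (r * m)

          -- The elementary symmetric functions of the inverses kᵢ are those of the ξᵢ in reverse
          -- order, divided by ξ₁ξ₂ξ₃ = n′²; hence the powers of ν = 1/n′.
          kkk : k₁ * k₂ * k₃ ≈ ν ^ 2
          kkk = solve 8 (λ ξ₁ ξ₂ ξ₃ k₁ k₂ k₃ n ν →
              (:- ν :^ 2 :* k₁ :* k₂ :* k₃ by ξ₁ :* ξ₂ :* ξ₃ := n :^ 2)
            ∷ (:- k₁ :* k₂ :* k₃ :* (:1 :+ n :* ν) by n :* ν := :1)
            ∷ (ν :^ 2 :* ξ₂ :* ξ₃ :* k₂ :* k₃ by ξ₁ :* k₁ := :1)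
            ∷ (ν :^ 2 :* ξ₃ :* k₃ by ξ₂ :* k₂ := :1)
            ∷ (ν :^ 2 by ξ₃ :* k₃ := :1) ∷ []
            ⊢ k₁ :* k₂ :* k₃ := ν :^ 2) ξ₁ ξ₂ ξ₃ k₁ k₂ k₃ n′ ν s₃ n′ν≈1 ξk₁ ξk₂ ξk₃

          kk : k₁ * k₂ + k₁ * k₃ + k₂ * k₃ ≈ ν ^ 2 * (m ^ 2 - ι 3 * r)
          kk = solve 9 (λ ξ₁ ξ₂ ξ₃ k₁ k₂ k₃ ν m r →
              (ξ₁ :+ ξ₂ :+ ξ₃ by k₁ :* k₂ :* k₃ := ν :^ 2)
            ∷ (ν :^ 2 by ξ₁ :+ ξ₂ :+ ξ₃ := m :^ 2 :- con 3 :* r)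
            ∷ (:- (k₂ :* k₃) by ξ₁ :* k₁ := :1)
            ∷ (:- (k₁ :* k₃) by ξ₂ :* k₂ := :1)
            ∷ (:- (k₁ :* k₂) by ξ₃ :* k₃ := :1) ∷ []
            ⊢ k₁ :* k₂ :+ k₁ :* k₃ :+ k₂ :* k₃ := ν :^ 2 :* (m :^ 2 :- con 3 :* r)) ξ₁ ξ₂ ξ₃ k₁ k₂ k₃ ν m r kkk s₁ ξk₁ ξk₂ ξk₃

          k+ : k₁ + k₂ + k₃ ≈ ν ^ 2 * (b - ι 2 * (m * n′))
          k+ = solve 10 (λ ξ₁ ξ₂ ξ₃ k₁ k₂ k₃ ν b m n →
              (ξ₁ :* ξ₂ :+ ξ₁ :* ξ₃ :+ ξ₂ :* ξ₃ by k₁ :* k₂ :* k₃ := ν :^ 2)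
            ∷ (ν :^ 2 by ξ₁ :* ξ₂ :+ ξ₁ :* ξ₃ :+ ξ₂ :* ξ₃ := b :- con 2 :* (m :* n))
            ∷ (:- (ξ₂ :* k₂ :* k₃ :+ ξ₃ :* k₂ :* k₃) by ξ₁ :* k₁ := :1)
            ∷ (:- (ξ₃ :* k₁ :* k₃ :+ k₃) by ξ₂ :* k₂ := :1)
            ∷ (:- (k₁ :+ k₂) by ξ₃ :* k₃ := :1) ∷ []
            ⊢ k₁ :+ k₂ :+ k₃ := ν :^ 2 :* (b :- con 2 :* (m :* n))) ξ₁ ξ₂ ξ₃ k₁ k₂ k₃ ν b m n′ kkk s₂ ξk₁ ξk₂ ξk₃

          h₁ : z k₁ + z k₂ + z k₃ ≈ m + b * ν
          h₁ = solve 7 (λ k₁ k₂ k₃ ν b m n →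
              (n by k₁ :+ k₂ :+ k₃ := ν :^ 2 :* (b :- con 2 :* (m :* n)))
            ∷ (ν :* b :- con 2 :* m :- con 2 :* m :* n :* ν by n :* ν := :1) ∷ []
            ⊢ (m :+ n :* k₁) :+ (m :+ n :* k₂) :+ (m :+ n :* k₃) := m :+ b :* ν) k₁ k₂ k₃ ν b m n′ k+ n′ν≈1

          h₂ : z k₁ * z k₂ + z k₁ * z k₃ + z k₂ * z k₃ ≈ ι 2 * (m * (b * ν)) - ι 3 * r
          h₂ = solve 8 (λ k₁ k₂ k₃ ν b m n r →
              (con 2 :* m :* n by k₁ :+ k₂ :+ k₃ := ν :^ 2 :* (b :- con 2 :* (m :* n)))
            ∷ (n :^ 2 by k₁ :* k₂ :+ k₁ :* k₃ :+ k₂ :* k₃ := ν :^ 2 :* (m :^ 2 :- con 3 :* r))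
            ∷ (con 2 :* m :* (ν :* b :- con 2 :* m :- con 2 :* m :* n :* ν) :+ (m :^ 2 :- con 3 :* r) :* (n :* ν :+ :1) by n :* ν := :1) ∷ []
            ⊢ (m :+ n :* k₁) :* (m :+ n :* k₂) :+ (m :+ n :* k₁) :* (m :+ n :* k₃) :+ (m :+ n :* k₂) :* (m :+ n :* k₃) := con 2 :* (m :* (b :* ν)) :- con 3 :* r)
            k₁ k₂ k₃ ν b m n′ r k+ kk n′ν≈1

          h₃ : z k₁ * z k₂ * z k₃ ≈ σ₃
          h₃ = solve 8 (λ k₁ k₂ k₃ ν b m n r →
              (m :^ 2 :* n by k₁ :+ k₂ :+ k₃ := ν :^ 2 :* (b :- con 2 :* (m :* n)))
            ∷ (m :* n :^ 2 by k₁ :* k₂ :+ k₁ :* k₃ :+ k₂ :* k₃ := ν :^ 2 :* (m :^ 2 :- con 3 :* r))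
            ∷ (n :^ 3 by k₁ :* k₂ :* k₃ := ν :^ 2)
            ∷ (m :^ 2 :* (ν :* b :- con 2 :* m :- con 2 :* m :* n :* ν) :+ m :* (m :^ 2 :- con 3 :* r) :* (n :* ν :+ :1) :+ n :* (n :* ν :+ :1) by n :* ν := :1) ∷ []
            ⊢ (m :+ n :* k₁) :* (m :+ n :* k₂) :* (m :+ n :* k₃) := n :+ b :* ν :* m :^ 2 :- con 3 :* (r :* m))
            k₁ k₂ k₃ ν b m n′ r k+ kk kkk n′ν≈1

          Cubic : ∣K∣ → ∣K∣ → ∣K∣ → ∣K∣ → Set ℓ
          Cubic s₁ s₂ s₃ w = w ^ 3 ≈ s₁ * w ^ 2 - s₂ * w + s₃

          vieta : ∀ {w₁ w₂ w₃ t₁ t₂ t₃} → w₁ + w₂ + w₃ ≈ t₁ → w₁ * w₂ + w₁ * w₃ + w₂ * w₃ ≈ t₂ → w₁ * w₂ * w₃ ≈ t₃ →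
                  Cubic t₁ t₂ t₃ w₁ × Cubic t₁ t₂ t₃ w₂ × Cubic t₁ t₂ t₃ w₃
          vieta {w₁} {w₂} {w₃} {t₁} {t₂} {t₃} h₁ h₂ h₃ =
              root-of w₁ (solve 3 (λ a b c → [] ⊢ (a :- a) :* (a :- b) :* (a :- c) := con 0) w₁ w₂ w₃)
            , root-of w₂ (solve 3 (λ a b c → [] ⊢ (b :- a) :* (b :- b) :* (b :- c) := con 0) w₁ w₂ w₃)
            , root-of w₃ (solve 3 (λ a b c → [] ⊢ (c :- a) :* (c :- b) :* (c :- c) := con 0) w₁ w₂ w₃)
            where
            root-of : ∀ w → (w - w₁) * (w - w₂) * (w - w₃) ≈ 0# → Cubic t₁ t₂ t₃ w
            root-of w = solve 7 (λ w w₁ w₂ w₃ t₁ t₂ t₃ →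
                (w :^ 2 by w₁ :+ w₂ :+ w₃ := t₁)
              ∷ (:- w by w₁ :* w₂ :+ w₁ :* w₃ :+ w₂ :* w₃ := t₂)
              ∷ (:1 by w₁ :* w₂ :* w₃ := t₃)
              ∷ (:1 by (w :- w₁) :* (w :- w₂) :* (w :- w₃) := con 0) ∷ []
              ⊢ w :^ 3 := t₁ :* w :^ 2 :- t₂ :* w :+ t₃) w w₁ w₂ w₃ t₁ t₂ t₃ h₁ h₂ h₃

          square : ∀ x k → Cubic (m ^ 2 - ι 3 * r) (b - ι 2 * (m * n′)) (n′ ^ 2) (x - r) → (x - r) * k ≈ 1# →
                   x + b * k ≈ z k ^ 2 - ι 2 * r
          square x k = solve 6 (λ x k m n r b → let ξ = x :- r in
              (k :^ 2 by ξ :^ 3 := (m :^ 2 :- con 3 :* r) :* ξ :^ 2 :- (b :- con 2 :* (m :* n)) :* ξ :+ n :^ 2)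
            ∷ (k :* m :^ 2 :* ξ :+ con 2 :* k :* m :* n :+ m :^ 2 :- con 3 :* k :* r :* ξ :- k :* ξ :^ 2 :- b :* k :- con 3 :* r :- ξ
               by ξ :* k := :1) ∷ []
            ⊢ x :+ b :* k := (m :+ n :* k) :^ 2 :- con 2 :* r) x k m n′ r b

          -- Slope and intercept of the image line. With k = (z - m)ν, the image ordinate is z³ -
          -- 2bνz² + (2mbν - 3r)z; reduced by the cubic of z it becomes Mz² + σ₃, and z² = X + 2r.
          M = m - b * ν
          N = σ₃ + ι 2 * (r * M)

          on-image : ∀ x y k → y ≈ m * x + n → (x - r) * k ≈ 1# → x + b * k ≈ z k ^ 2 - ι 2 * r →
                     Cubic (m + b * ν) (ι 2 * (m * (b * ν)) - ι 3 * r) σ₃ (z k) →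
                     y * (1# - b * k ^ 2) ≈ M * (x + b * k) + N
          on-image x y k y≈ ξk sq cubic = solve 8 (λ x y k m n r b ν → let z = m :+ n :* k in
              (:1 :- b :* k :^ 2 by y := m :* (x :- r) :+ n)
            ∷ (:- (n :+ m :* b :* k) by (x :- r) :* k := :1)
            ∷ (n :* k :+ b :* ν by x :+ b :* k := z :^ 2 :- con 2 :* r)
            ∷ (:1 by z :^ 3 := (m :+ b :* ν) :* z :^ 2 :- (con 2 :* (m :* (b :* ν)) :- con 3 :* r) :* z :+ (n :+ b :* ν :* m :^ 2 :- con 3 :* (r :* m)))
            ∷ (con 2 :* b :* z :* k by n :* ν := :1) ∷ []
            ⊢ y :* (:1 :- b :* k :^ 2) := (m :- b :* ν) :* (x :+ b :* k) :+ ((n :+ b :* ν :* m :^ 2 :- con 3 :* (r :* m)) :+ con 2 :* (r :* (m :- b :* ν))))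
            x y k m n′ r b ν (centred x y y≈) ξk sq cubic n′ν≈1

          X₁ = x₁ + b * k₁
          X₂ = x₂ + b * k₂
          X₃ = x₃ + b * k₃

          ξ-cubics = vieta s₁ s₂ s₃
          z-cubics = vieta h₁ h₂ h₃

          q₁ : X₁ ≈ z k₁ ^ 2 - ι 2 * r
          q₁ = square x₁ k₁ (proj₁ ξ-cubics) ξk₁
          q₂ : X₂ ≈ z k₂ ^ 2 - ι 2 * r
          q₂ = square x₂ k₂ (proj₁ (proj₂ ξ-cubics)) ξk₂
          q₃ : X₃ ≈ z k₃ ^ 2 - ι 2 * r
          q₃ = square x₃ k₃ (proj₂ (proj₂ ξ-cubics)) ξk₃

          -- As Xᵢ + 2r = zᵢ², Vieta's relations for the image line come from those of the zᵢ by
          -- root squaring.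
          E₁ : X₁ + X₂ + X₃ ≈ M ^ 2
          E₁ = solve 10 (λ X₁ X₂ X₃ z₁ z₂ z₃ m b ν r →
              (:1 by X₁ := z₁ :^ 2 :- con 2 :* r) ∷ (:1 by X₂ := z₂ :^ 2 :- con 2 :* r) ∷ (:1 by X₃ := z₃ :^ 2 :- con 2 :* r)
            ∷ (z₁ :+ z₂ :+ z₃ :+ (m :+ b :* ν) by z₁ :+ z₂ :+ z₃ := m :+ b :* ν)
            ∷ (:- con 2 by z₁ :* z₂ :+ z₁ :* z₃ :+ z₂ :* z₃ := con 2 :* (m :* (b :* ν)) :- con 3 :* r) ∷ []
            ⊢ X₁ :+ X₂ :+ X₃ := (m :- b :* ν) :^ 2)
            X₁ X₂ X₃ (z k₁) (z k₂) (z k₃) m b ν r q₁ q₂ q₃ h₁ h₂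

          E₂ : X₁ * X₂ + X₁ * X₃ + X₂ * X₃ ≈ A E′ - ι 2 * (M * N)
          E₂ = solve 11 (λ X₁ X₂ X₃ z₁ z₂ z₃ m A ν r n → let
                b = :slope A r ; s₁ = m :+ b :* ν ; s₂ = con 2 :* (m :* (b :* ν)) :- con 3 :* r ; s₃ = n :+ b :* ν :* m :^ 2 :- con 3 :* (r :* m)
                Σ₁ = z₁ :+ z₂ :+ z₃ ; Σ₂ = z₁ :* z₂ :+ z₁ :* z₃ :+ z₂ :* z₃ ; Σ₃ = z₁ :* z₂ :* z₃ ; M = m :- b :* ν in
              (X₂ :+ X₃ by X₁ := z₁ :^ 2 :- con 2 :* r) ∷ (z₁ :^ 2 :- con 2 :* r :+ X₃ by X₂ := z₂ :^ 2 :- con 2 :* r)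
            ∷ (z₁ :^ 2 :+ z₂ :^ 2 :- con 4 :* r by X₃ := z₃ :^ 2 :- con 2 :* r)
            ∷ (:- con 2 :* Σ₃ :- con 4 :* r :* (Σ₁ :+ s₁) by Σ₁ := s₁)
            ∷ (Σ₂ :+ s₂ :+ con 8 :* r by Σ₂ := s₂)
            ∷ (:- con 2 :* s₁ by Σ₃ := s₃)
            ∷ (:- con 4 :* b by n :* ν := :1) ∷ []
            ⊢ X₁ :* X₂ :+ X₁ :* X₃ :+ X₂ :* X₃ := :veluA A r :- con 2 :* (M :* (s₃ :+ con 2 :* (r :* M))))
            X₁ X₂ X₃ (z k₁) (z k₂) (z k₃) m (A E) ν r n′ q₁ q₂ q₃ h₁ h₂ h₃ n′ν≈1

          E₃ : X₁ * X₂ * X₃ ≈ N ^ 2 - B E′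
          E₃ = solve 11 (λ X₁ X₂ X₃ z₁ z₂ z₃ m A ν r n → let
                b = :slope A r ; s₁ = m :+ b :* ν ; s₂ = con 2 :* (m :* (b :* ν)) :- con 3 :* r ; s₃ = n :+ b :* ν :* m :^ 2 :- con 3 :* (r :* m)
                Σ₁ = z₁ :+ z₂ :+ z₃ ; Σ₂ = z₁ :* z₂ :+ z₁ :* z₃ :+ z₂ :* z₃ ; Σ₃ = z₁ :* z₂ :* z₃ ; M = m :- b :* ν
                Z₁ = z₁ :^ 2 :- con 2 :* r ; Z₂ = z₂ :^ 2 :- con 2 :* r in
              (X₂ :* X₃ by X₁ := z₁ :^ 2 :- con 2 :* r) ∷ (Z₁ :* X₃ by X₂ := z₂ :^ 2 :- con 2 :* r)
            ∷ (Z₁ :* Z₂ by X₃ := z₃ :^ 2 :- con 2 :* r)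
            ∷ (con 4 :* r :* Σ₃ :+ con 4 :* r :^ 2 :* (Σ₁ :+ s₁) by Σ₁ := s₁)
            ∷ (:- con 2 :* r :* (Σ₂ :+ s₂) :- con 8 :* r :^ 2 by Σ₂ := s₂)
            ∷ (Σ₃ :+ s₃ :+ con 4 :* r :* s₁ by Σ₃ := s₃)
            ∷ (con 8 :* b :* r by n :* ν := :1) ∷ []
            ⊢ X₁ :* X₂ :* X₃ := (s₃ :+ con 2 :* (r :* M)) :^ 2 :- :veluB A r)
            X₁ X₂ X₃ (z k₁) (z k₂) (z k₃) m (A E) ν r n′ q₁ q₂ q₃ h₁ h₂ h₃ n′ν≈1

          L′ : Line E′ X₁ (y₁ * (1# - b * k₁ ^ 2)) X₂ (y₂ * (1# - b * k₂ ^ 2)) X₃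
          L′ = record
            { m = M ; n = N
            ; on₁ = on-image x₁ y₁ k₁ on₁ ξk₁ q₁ (proj₁ z-cubics)
            ; on₂ = on-image x₂ y₂ k₂ on₂ ξk₂ q₂ (proj₁ (proj₂ z-cubics))
            ; e₁ = E₁ ; e₂ = E₂ ; e₃ = E₃ }

        zero-intercept : ∀ {x y} → On E x y → x - r ≈ 0# → y ≈ m * x + n → n′ ≈ 0#
        zero-intercept {x} {y} on ξ≈0 y≈ = solve 4 (λ ξ y m n →
            (:- m by ξ := con 0) ∷ (:- :1 by y := m :* ξ :+ n) ∷ (:1 by y := con 0) ∷ [] ⊢ n := con 0)
          (x - r) y m n′ ξ≈0 (centred x y y≈) (kernel-ordinate E r root on ξ≈0)

        no-intercept : ∀ {x y} → n′ ≈ 0# → y ≈ m * x + n → y ≈ m * (x - r)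
        no-intercept {x} {y} n′≈0 y≈ = trans (centred x y y≈) (trans (+-congˡ n′≈0) (+-identityʳ _))

        -- When n′ = 0 the line passes through the kernel point (r , 0). Its other two points P and
        -- P′ satisfy ξξ′ = b, and P differs from minus P′ by the kernel point, so the images are
        -- opposite.
        opposite : ∀ {x y x′ y′ k k′} → (x - r) * (x′ - r) ≈ b → y ≈ m * (x - r) → y′ ≈ m * (x′ - r) →
                   (x - r) * k ≈ 1# → (x′ - r) * k′ ≈ 1# →
                   x + b * k ≈ x′ + b * k′ × y * (1# - b * k ^ 2) ≈ - (y′ * (1# - b * k′ ^ 2))
        opposite {x} {y} {x′} {y′} {k} {k′} ξξ′≈b y≈ y′≈ ξk ξ′k′ =
            solve 6 (λ x x′ r k k′ b → let ξ = x :- r ; ξ′ = x′ :- r in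
                (k′ :- k by ξ :* ξ′ := b) ∷ (ξ′ by ξ :* k := :1) ∷ (:- ξ by ξ′ :* k′ := :1) ∷ []
              ⊢ x :+ b :* k := x′ :+ b :* k′) x x′ r k k′ b ξξ′≈b ξk ξ′k′
          , solve 9 (λ x x′ y y′ r k k′ b m → let ξ = x :- r ; ξ′ = x′ :- r in
                (:1 :- b :* k :^ 2 by y := m :* ξ) ∷ (:1 :- b :* k′ :^ 2 by y′ := m :* ξ′)
              ∷ (m :* (k :+ k′) by ξ :* ξ′ := b)
              ∷ (:- m :* (b :* k :+ ξ′) by ξ :* k := :1) ∷ (:- m :* (b :* k′ :+ ξ) by ξ′ :* k′ := :1) ∷ []
              ⊢ y :* (:1 :- b :* k :^ 2) := :- (y′ :* (:1 :- b :* k′ :^ 2))) x x′ y y′ r k k′ b m y≈ y′≈ ξξ′≈b ξk ξ′k′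

        -- `image` divides by n′, so lines through the kernel point are treated apart. On such a
        -- line exactly one of the ξᵢ vanishes, because two vanishing ones would give b = 0; the
        -- cases say which one it is.
        φ-add-line : On E x₁ y₁ → On E x₂ y₂ → φ (aff x₃ (- y₃)) ≈ₚ add E′ (φ (aff x₁ y₁)) (φ (aff x₂ y₂))
        φ-add-line On₁ On₂ = go (ξ₁ ≟ 0#) (ξ₂ ≟ 0#) (n′ ≟ 0#)
          where
          P = aff x₁ y₁
          Q = aff x₂ y₂
          through : ∀ {x y} → n′ ≈ 0# → y ≈ m * x + n → x - r ≉ 0# → ξ₃ * (x - r) ≈ b → φ (aff x₃ (- y₃)) ≈ₚ φ (aff x y)
          through n′≈0 on ξ≉0 ξ₃ξ≈b = ≈ₚ-trans (veluMap-affine E ξk₃) (≈ₚ-trans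
              (aff (proj₁ same) (trans (solve 2 (λ a c → [] ⊢ :- a :* c := :- (a :* c)) y₃ _)
                                  (trans (-‿cong (proj₂ same)) (-‿involutive _))))
              (≈ₚ-sym (veluMap-affine E ξk)))
            where
            ξk = proj₂ (inverse _ ξ≉0)
            ξk₃ = proj₂ (inverse ξ₃ (factor-≉0ˡ (≉0-resp (sym ξ₃ξ≈b) b≉0)))
            same = opposite ξ₃ξ≈b (no-intercept n′≈0 refl) (no-intercept n′≈0 on) ξk₃ ξk
          go : Dec (ξ₁ ≈ 0#) → Dec (ξ₂ ≈ 0#) → Dec (n′ ≈ 0#) → φ (aff x₃ (- y₃)) ≈ₚ add E′ (φ P) (φ Q)
          go (yes ξ₁≈0) (yes ξ₂≈0) _ = contradiction
            (solve 6 (λ ξ₁ ξ₂ ξ₃ b m n → (:- :1 by ξ₁ :* ξ₂ :+ ξ₁ :* ξ₃ :+ ξ₂ :* ξ₃ := b :- con 2 :* (m :* n))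
                ∷ (ξ₂ :+ ξ₃ by ξ₁ := con 0) ∷ (ξ₃ by ξ₂ := con 0) ∷ (con 2 :* m by n := con 0) ∷ [] ⊢ b := con 0)
              ξ₁ ξ₂ ξ₃ b m n′ s₂ ξ₁≈0 ξ₂≈0 (zero-intercept On₁ ξ₁≈0 on₁))
            b≉0
          go (yes ξ₁≈0) (no ξ₂≉0) _ = ≈ₚ-trans
            (through (zero-intercept On₁ ξ₁≈0 on₁) on₂ ξ₂≉0 (solve 6 (λ ξ₁ ξ₂ ξ₃ b m n →
                (:1 by ξ₁ :* ξ₂ :+ ξ₁ :* ξ₃ :+ ξ₂ :* ξ₃ := b :- con 2 :* (m :* n))
              ∷ (:- (ξ₂ :+ ξ₃) by ξ₁ := con 0) ∷ (:- (con 2 :* m) by n := con 0) ∷ [] ⊢ ξ₃ :* ξ₂ := b)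
              ξ₁ ξ₂ ξ₃ b m n′ s₂ ξ₁≈0 (zero-intercept On₁ ξ₁≈0 on₁)))
            (≈ₚ-reflexive (≡.cong (λ S → add E′ S (φ Q)) (≡.sym (veluMap-kernel E {r} {x₁} {y₁} ξ₁≈0))))
          go (no ξ₁≉0) (yes ξ₂≈0) _ = ≈ₚ-trans
            (through (zero-intercept On₂ ξ₂≈0 on₂) on₁ ξ₁≉0 (solve 6 (λ ξ₁ ξ₂ ξ₃ b m n →
                (:1 by ξ₁ :* ξ₂ :+ ξ₁ :* ξ₃ :+ ξ₂ :* ξ₃ := b :- con 2 :* (m :* n))
              ∷ (:- (ξ₁ :+ ξ₃) by ξ₂ := con 0) ∷ (:- (con 2 :* m) by n := con 0) ∷ [] ⊢ ξ₃ :* ξ₁ := b)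
              ξ₁ ξ₂ ξ₃ b m n′ s₂ ξ₂≈0 (zero-intercept On₂ ξ₂≈0 on₂)))
            (≈ₚ-reflexive (≡.trans (≡.sym (add-identityʳ E′ (φ P)))
              (≡.cong (add E′ (φ P)) (≡.sym (veluMap-kernel E {r} {x₂} {y₂} ξ₂≈0)))))
          go (no ξ₁≉0) (no ξ₂≉0) (yes n′≈0) =
            ≈ₚ-trans (≈ₚ-reflexive (≡.trans (veluMap-kernel E ξ₃≈0) (≡.sym (add-opposite E′ (proj₁ same) (proj₂ same)))))
              (≈ₚ-sym (add-cong E′ elliptic′ (φ-∈ (aff On₁)) (φ-∈ (aff On₂)) (veluMap-affine E ξk₁) (veluMap-affine E ξk₂)))
            where
            ξ₃≈0 : ξ₃ ≈ 0#
            ξ₃≈0 = x*y≈0⇒y≈0 (*-≉0 ξ₁≉0 ξ₂≉0) (trans s₃ (trans (*-congʳ n′≈0) (zeroˡ _)))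
            ξξ≈b : ξ₁ * ξ₂ ≈ b
            ξξ≈b = solve 6 (λ ξ₁ ξ₂ ξ₃ b m n → (:1 by ξ₁ :* ξ₂ :+ ξ₁ :* ξ₃ :+ ξ₂ :* ξ₃ := b :- con 2 :* (m :* n))
                ∷ (:- (ξ₁ :+ ξ₂) by ξ₃ := con 0) ∷ (:- (con 2 :* m) by n := con 0) ∷ [] ⊢ ξ₁ :* ξ₂ := b)
              ξ₁ ξ₂ ξ₃ b m n′ s₂ ξ₃≈0 n′≈0
            ξk₁ = proj₂ (inverse ξ₁ ξ₁≉0)
            ξk₂ = proj₂ (inverse ξ₂ ξ₂≉0)
            same = opposite ξξ≈b (no-intercept n′≈0 on₁) (no-intercept n′≈0 on₂) ξk₁ ξk₂
          go (no ξ₁≉0) (no ξ₂≉0) (no n′≉0) =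
            ≈ₚ-trans (veluMap-affine E ξk₃)
              (≈ₚ-trans (≈ₚ-sym (proj₂ img))
              (≈ₚ-trans (≈ₚ-sym (add-line E′ elliptic′ (proj₁ img)))
                (≈ₚ-sym (add-cong E′ elliptic′ (φ-∈ (aff On₁)) (φ-∈ (aff On₂)) (veluMap-affine E ξk₁) (veluMap-affine E ξk₂)))))
            where
            ξk₁ = proj₂ (inverse ξ₁ ξ₁≉0)
            ξk₂ = proj₂ (inverse ξ₂ ξ₂≉0)
            ξk₃ = proj₂ (inverse ξ₃ (factor-≉0ʳ (≉0-resp (sym s₃) (^-≉0 2 n′≉0))))
            img = image (proj₂ (inverse n′ n′≉0)) ξk₁ ξk₂ ξk₃

      φ-add : ∀ {P Q} → P ∈ₑ E → Q ∈ₑ E → φ (add E P Q) ≈ₚ add E′ (φ P) (φ Q)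
      φ-add ∞ Q∈ = ≈ₚ-refl
      φ-add {P} (aff on₁) ∞ = ≈ₚ-reflexive (≡.sym (add-identityʳ E′ (φ P)))
      φ-add {aff x₁ y₁} {aff x₂ y₂} (aff on₁) (aff on₂) with add-cases E on₁ on₂
      ... | inj₂ (x₃ , L , eq) = ≈ₚ-trans (veluMap-cong E r eq) (φ-add-line L on₁ on₂)
      ... | inj₁ (x₁≈x₂ , y₁≈-y₂ , eq) = ≈ₚ-trans (≈ₚ-reflexive (≡.cong φ eq)) (go ((x₁ - r) ≟ 0#))
        where
        go : Dec (x₁ - r ≈ 0#) → ∞ ≈ₚ add E′ (φ (aff x₁ y₁)) (φ (aff x₂ y₂))
        go (yes ξ₁≈0) = ≈ₚ-reflexive (≡.sym (≡.cong₂ (add E′)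
          (veluMap-kernel E {r} {x₁} {y₁} ξ₁≈0) (veluMap-kernel E {r} {x₂} {y₂} (trans (+-congʳ (sym x₁≈x₂)) ξ₁≈0))))
        go (no ξ₁≉0) = ≈ₚ-trans
          (≈ₚ-reflexive (≡.sym (add-opposite E′ (+-congʳ x₁≈x₂) (trans (*-congʳ y₁≈-y₂) (solve 2 (λ a c → [] ⊢ :- a :* c := :- (a :* c)) y₂ _)))))
          (≈ₚ-sym (add-cong E′ elliptic′ (φ-∈ (aff on₁)) (φ-∈ (aff on₂)) (veluMap-affine E ξk) (veluMap-affine E (trans (*-congʳ (+-congʳ (sym x₁≈x₂))) ξk))))
          where ξk = proj₂ (inverse (x₁ - r) ξ₁≉0)

    veluMap-homomorphism : IsHomomorphism E (velu E r) (veluMap E r)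
    veluMap-homomorphism = record { φ-∞ = ≡.refl ; φ-∈ = φ-∈ ; φ-add = φ-add }

-- Vélu quotients: discriminant, dual, supersingularity

module VeluIsogeny {c ℓ : Level} {p : ℕ} (p-prime : Prime p) (3<p : 3 < p) (K : AlgebraicClosure𝔽 c ℓ p) where
  open Context p-prime 3<p K
  open PrimeDivisibility p-prime using (odd-prime)
  open Curves p-prime 3<p K
  open VeluHomomorphism p-prime 3<p K

  scaling-inverse : ∀ {δ δ⁻¹ E E′} → δ * δ⁻¹ ≈ 1# → Scaling δ E E′ → Scaling δ⁻¹ E′ E
  scaling-inverse {δ} {δ⁻¹} {E} {E′} δδ⁻¹≈1 S = record
    { δ≉0  = invertible⇒≉0 (trans (*-comm δ⁻¹ δ) δδ⁻¹≈1)
    ; A-eq = solve 4 (λ x y a b → let z = x :* y in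
          (:- y :^ 4 by b := x :^ 4 :* a) ∷ (:- a :* (:1 :+ z :+ z :^ 2 :+ z :^ 3) by x :* y := :1) ∷ [] ⊢ a := y :^ 4 :* b)
        δ δ⁻¹ (A E) (A E′) A-eq δδ⁻¹≈1
    ; B-eq = solve 4 (λ x y a b → let z = x :* y in
          (:- y :^ 6 by b := x :^ 6 :* a) ∷ (:- a :* (:1 :+ z :+ z :^ 2 :+ z :^ 3 :+ z :^ 4 :+ z :^ 5) by x :* y := :1) ∷ [] ⊢ a := y :^ 6 :* b)
        δ δ⁻¹ (B E) (B E′) B-eq δδ⁻¹≈1
    }
    where open Scaling S

  scaling-trans : ∀ {δ ε E E′ E″} → Scaling δ E E′ → Scaling ε E′ E″ → Scaling (ε * δ) E E″
  scaling-trans {δ} {ε} {E} {E′} {E″} S S′ = record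
    { δ≉0  = *-≉0 S′.δ≉0 S.δ≉0
    ; A-eq = solve 5 (λ x y a b d → (y :^ 4 by b := x :^ 4 :* a) ∷ (:1 by d := y :^ 4 :* b) ∷ [] ⊢ d := (y :* x) :^ 4 :* a)
        δ ε (A E) (A E′) (A E″) S.A-eq S′.A-eq
    ; B-eq = solve 5 (λ x y a b d → (y :^ 6 by b := x :^ 6 :* a) ∷ (:1 by d := y :^ 6 :* b) ∷ [] ⊢ d := (y :* x) :^ 6 :* a)
        δ ε (B E) (B E′) (B E″) S.B-eq S′.B-eq
    }
    where
    module S = Scaling S
    module S′ = Scaling S′

  scaling-supersingular′ : ∀ {δ E E′} → Scaling δ E E′ → IsElliptic E → Supersingular E → Supersingular E′
  scaling-supersingular′ {δ} S elliptic = Scaling.scaling-supersingular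
    (scaling-inverse (proj₂ (inverse δ δ≉0)) S) (scaling-elliptic elliptic)
    where open Scaling S

  -- In terms of ξ = x - r and b = `slope E r`, the cubic is ξ(ξ² + 3rξ + b); this is the
  -- discriminant 9r² - 4b of its quadratic factor.
  discriminant-factor : Weierstrass → ∣K∣ → ∣K∣
  discriminant-factor E r = ι 9 * r ^ 2 - ι 4 * slope E r

  disc-factored : ∀ E r → Root E r → disc E ≈ - slope E r ^ 2 * discriminant-factor E r
  disc-factored E r = solve 3 (λ r A B → let b = :slope A r in
      (con 27 :* (B :- r :^ 3 :- A :* r) by :cubic A B r := con 0) ∷ []
    ⊢ :disc A B := (:- b :^ 2) :* (con 9 :* r :^ 2 :- con 4 :* b)) r (A E) (B E)

  disc-velu : ∀ E r → disc (velu E r) ≈ - (ι 2 ^ 4 * slope E r) * discriminant-factor E r ^ 2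
  disc-velu E r = solve 2 (λ r A → let b = :slope A r in
      [] ⊢ con 4 :* (:veluA A r) :^ 3 :+ con 27 :* (:veluB A r) :^ 2
        := (:- (con 2 :^ 4 :* b)) :* (con 9 :* r :^ 2 :- con 4 :* b) :^ 2) r (A E)

  discriminant-factor≉0 : ∀ E r → IsElliptic E → Root E r → discriminant-factor E r ≉ 0#
  discriminant-factor≉0 E r elliptic root = factor-≉0ʳ (≉0-resp (disc-factored E r root) elliptic)

  -‿≉0 : ∀ {x} → x ≉ 0# → - x ≉ 0#
  -‿≉0 {x} x≉0 -x≈0 = x≉0 (solve 1 (λ x → (:- :1 by :- x := con 0) ∷ [] ⊢ x := con 0) x -x≈0)

  velu-elliptic : ∀ E r → IsElliptic E → Root E r → IsElliptic (velu E r)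
  velu-elliptic E r elliptic root = ≉0-resp (sym (disc-velu E r))
    (*-≉0 (-‿≉0 (*-≉0 (^-≉0 4 2≉0) (slope≉0 E r elliptic root))) (^-≉0 2 (discriminant-factor≉0 E r elliptic root)))

  -- The dual is the quotient by the image of the remaining 2-torsion. There ξ² + 3rξ + b = 0, so x
  -- + b/ξ = r + (ξ + b/ξ) = r - 3r.
  dualRoot : ∣K∣ → ∣K∣
  dualRoot r = - (ι 2 * r)

  dual-root : ∀ E r → Root (velu E r) (dualRoot r)
  dual-root E r = solve 2 (λ r A → let r′ = :- (con 2 :* r) in
    [] ⊢ r′ :^ 3 :+ (:veluA A r) :* r′ :+ (:veluB A r) := con 0) r (A E)

  -- The two quotients together have kernel E[2], so they amount to multiplication by 2 followed by
  -- an isomorphism; in Vélu's normalisation the isomorphism scales by 2.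
  dual-scaling : ∀ E r → Root E r → Scaling (ι 2) E (velu (velu E r) (dualRoot r))
  dual-scaling E r root = record
    { δ≉0  = 2≉0
    ; A-eq = solve 2 (λ r A → let r′ = :- (con 2 :* r) in
        [] ⊢ :- (con 4 :* :veluA A r :+ con 15 :* r′ :^ 2) := con 2 :^ 4 :* A) r (A E)
    ; B-eq = solve 3 (λ r A B → let r′ = :- (con 2 :* r) in
        (:- con 64 by :cubic A B r := con 0) ∷ []
        ⊢ :- (con 8 :* (:veluA A r :* r′) :+ con 22 :* r′ :^ 3) := con 2 :^ 6 :* B) r (A E) (B E) root
    }

  private
    two-torsion : ∀ E k {x y} → y ≈ 0# → mult E (k ℕ.* 2) (aff x y) ≡ ∞
    two-torsion E zero    y≈0 = ≡.refl
    two-torsion E (suc k) {x} {y} y≈0 = ≡.trans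
      (≡.cong (λ Q → add E (aff x y) (add E (aff x y) Q)) (two-torsion E k y≈0))
      (add-opposite E refl (solve 1 (λ y → (con 2 by y := con 0) ∷ [] ⊢ y := :- y) y y≈0))

  -- The dual map leads from `velu E r` to a rescaled copy of E, so supersingularity can be pulled
  -- back along it. The nontrivial point of its kernel has order 2 and is not killed by the odd
  -- number p.
  velu-supersingular : ∀ E r → IsElliptic E → Root E r → Supersingular E → Supersingular (velu E r)
  velu-supersingular E r elliptic root supersingular = IsHomomorphism.supersingular-pullback
    (veluMap-homomorphism E′ r′ elliptic′ (dual-root E r) elliptic″) elliptic″
    (scaling-supersingular′ (dual-scaling E r root) elliptic supersingular) kernel
    where
    E′ = velu E r
    r′ = dualRoot r
    elliptic′ = velu-elliptic E r elliptic root
    elliptic″ = velu-elliptic E′ r′ elliptic′ (dual-root E r)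
    odd-multiple : ∀ {n} → n ≡ suc (n ℕ./ 2 ℕ.* 2) → ∀ {x y} → y ≈ 0# → ¬ mult E′ n (aff x y) ≡ ∞
    odd-multiple {n} odd {x} {y} y≈0 eq with () ← ≡.trans (≡.sym eq) (≡.trans (≡.cong (λ k → mult E′ k (aff x y)) odd)
      (≡.cong (add E′ (aff x y)) (two-torsion E′ (n ℕ./ 2) y≈0)))
    kernel : ∀ P → P ∈ₑ E′ → mult E′ p P ≡ ∞ → veluMap E′ r′ P ≡ ∞ → P ≡ ∞
    kernel ∞         _        _     _     = ≡.refl
    kernel (aff x y) (aff on) pP≡∞ φP≡∞ with (x - r′) ≟ 0#
    kernel (aff x y) (aff on) pP≡∞ ()   | no _
    ... | yes ξ≈0 = ⊥-elim (odd-multiple (odd-prime (ℕ.<-trans (ℕ.n<1+n 2) 3<p))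
                      (kernel-ordinate E′ r′ (dual-root E r) on ξ≈0) pP≡∞)

  record IsVelu (r δ : ∣K∣) (E E′ : Weierstrass) : Set ℓ where
    field
      root    : Root E r
      scaling : Scaling δ (velu E r) E′

    isVelu-elliptic : IsElliptic E → IsElliptic E′
    isVelu-elliptic elliptic = Scaling.scaling-elliptic scaling (velu-elliptic E r elliptic root)

    isVelu-supersingular : IsElliptic E → Supersingular E → Supersingular E′
    isVelu-supersingular elliptic supersingular = scaling-supersingular′ scaling
      (velu-elliptic E r elliptic root) (velu-supersingular E r elliptic root supersingular)

  scaling-root : ∀ {δ E E′ r} → Scaling δ E E′ → Root E r → Root E′ (δ ^ 2 * r)
  scaling-root {δ} {E} {E′} {r} S = solve 6 (λ δ r A B A′ B′ →
      (δ :^ 2 :* r by A′ := δ :^ 4 :* A) ∷ (:1 by B′ := δ :^ 6 :* B) ∷ (δ :^ 6 by :cubic A B r := con 0) ∷ []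
    ⊢ (δ :^ 2 :* r) :^ 3 :+ A′ :* (δ :^ 2 :* r) :+ B′ := con 0) δ r (A E) (B E) (A E′) (B E′) A-eq B-eq
    where open Scaling S

  scaling-velu : ∀ {δ E E′} r → Scaling δ E E′ → Scaling δ (velu E r) (velu E′ (δ ^ 2 * r))
  scaling-velu {δ} {E} {E′} r S = record
    { δ≉0  = δ≉0
    ; A-eq = solve 4 (λ δ r A A′ → (:- con 4 by A′ := δ :^ 4 :* A) ∷ []
        ⊢ :- (con 4 :* A′ :+ con 15 :* (δ :^ 2 :* r) :^ 2) := δ :^ 4 :* :veluA A r) δ r (A E) (A E′) A-eq
    ; B-eq = solve 4 (λ δ r A A′ → (:- con 8 :* δ :^ 2 :* r by A′ := δ :^ 4 :* A) ∷ []
        ⊢ :- (con 8 :* (A′ :* (δ :^ 2 :* r)) :+ con 22 :* (δ :^ 2 :* r) :^ 3) := δ :^ 6 :* :veluB A r) δ r (A E) (A E′) A-eq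
    }
    where open Scaling S

  isVelu-scaleˡ : ∀ {δ δ⁻¹ ε r E E₁ E′} → δ * δ⁻¹ ≈ 1# → Scaling δ E E₁ → IsVelu r ε E E′ → IsVelu (δ ^ 2 * r) (ε * δ⁻¹) E₁ E′
  isVelu-scaleˡ {r = r} δδ⁻¹≈1 S V = record
    { root    = scaling-root S (IsVelu.root V)
    ; scaling = scaling-trans (scaling-inverse δδ⁻¹≈1 (scaling-velu r S)) (IsVelu.scaling V)
    }

  isVelu-scaleʳ : ∀ {δ ε r E E′ E₁} → Scaling δ E′ E₁ → IsVelu r ε E E′ → IsVelu r (δ * ε) E E₁
  isVelu-scaleʳ S V = record { root = IsVelu.root V ; scaling = scaling-trans (IsVelu.scaling V) S }

  -- The double quotient, formed at E′, is E scaled by 2 from `dual-scaling` and by δ from the model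
  -- E′; ε undoes both.
  isVelu-dual : ∀ {δ r E E′ ε} → ι 2 * δ * ε ≈ 1# → IsVelu r δ E E′ → IsVelu (δ ^ 2 * dualRoot r) ε E′ E
  isVelu-dual {δ} {r} {E} {E′} {ε} 2δε≈1 V = record
    { root    = scaling-root scaling (dual-root E r)
    ; scaling = scaling-inverse
        (trans (solve 3 (λ t δ ε → [] ⊢ δ :* t :* ε := t :* δ :* ε) (ι 2) δ ε) 2δε≈1)
        (scaling-trans (dual-scaling E r root) (scaling-velu (dualRoot r) scaling))
    }
    where open IsVelu V

-- Vélu's map in standard form

module VeluForms {c ℓ : Level} {p : ℕ} (p-prime : Prime p) (3<p : 3 < p) (K : AlgebraicClosure𝔽 c ℓ p) where
  open Context p-prime 3<p K
  open Curves p-prime 3<p K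
  open VeluHomomorphism p-prime 3<p K
  open VeluIsogeny p-prime 3<p K

  -- The fractions are x + b/(x - r) and 1 - b/(x - r)² over common denominators, multiplied by δ²
  -- and δ³.
  record HasVeluForm {E E′} (φ : Isogeny E E′) (r δ : ∣K∣) : Set (c Level.⊔ ℓ) where
    open Isogeny φ
    field
      eval-u : ∀ x → eval u x ≈ δ ^ 2 * (x ^ 2 - r * x + slope E r)
      eval-v : ∀ x → eval v x ≈ x - r
      eval-s : ∀ x → eval s x ≈ δ ^ 3 * ((x - r) ^ 2 - slope E r)
      eval-t : ∀ x → eval t x ≈ (x - r) ^ 2

    apply-form : ∀ P → apply P ≈ₚ scalePoint δ (veluMap E r P)
    apply-form ∞ = ∞
    apply-form (aff x y) with eval v x ≟ 0#
    ... | yes v≈0 = ≈ₚ-reflexive (≡.sym (≡.cong (scalePoint δ) (veluMap-kernel E (trans (sym (eval-v x)) v≈0))))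
    ... | no  v≉0 = ≈ₚ-trans
        (aff (/-unique v≉0 (trans (*-congˡ (eval-v x)) (trans (solve 5 (λ x r δ b k →
                 (δ :^ 2 :* b by (x :- r) :* k := :1) ∷ [] ⊢ δ :^ 2 :* (x :+ b :* k) :* (x :- r) := δ :^ 2 :* (x :^ 2 :- r :* x :+ b))
                 x r δ (slope E r) k ξk≈1) (sym (eval-u x)))))
             (trans (*-congˡ (/-unique (≉0-resp (sym (eval-t x)) (^-≉0 2 ξ≉0)) (trans (*-congˡ (eval-t x)) (trans (solve 5 (λ x r δ b k →
                 (:- δ :^ 3 :* b :* (k :* (x :- r) :+ :1) by (x :- r) :* k := :1) ∷ [] ⊢ δ :^ 3 :* (:1 :- b :* k :^ 2) :* (x :- r) :^ 2 := δ :^ 3 :* ((x :- r) :^ 2 :- b))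
                 x r δ (slope E r) k ξk≈1) (sym (eval-s x))))))
               (solve 3 (λ a b d → [] ⊢ a :* (b :* d) := b :* (a :* d)) y (δ ^ 3) _)))
        (≈ₚ-sym (scalePoint-cong (veluMap-affine E ξk≈1)))
      where
      ξ≉0 : x - r ≉ 0#
      ξ≉0 = ≉0-resp (eval-v x) v≉0
      k = proj₁ (inverse (x - r) ξ≉0)
      ξk≈1 : (x - r) * k ≈ 1#
      ξk≈1 = proj₂ (inverse (x - r) ξ≉0)

    module _ (δ≉0 : δ ≉ 0#) (over : DefinedOver𝔽ₚ) where
      root∈ : InPrimeField r
      root∈ = ∈-resp (trans (-‿cong (≗⇒≈ᴾ v (linear r) (λ x → trans (eval-v x) (sym (eval-linear r x))) 0)) (-‿involutive r))
                (-‿∈ (proj₁ (proj₂ (over 0))))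

      -- δ is the quotient of the leading coefficients δ³ of s and δ² of u. The x-coordinate alone
      -- would only show that δ² is rational.
      scale∈ : InPrimeField δ
      scale∈ = ∈-resp δ≈ (*-∈ (proj₁ (proj₂ (proj₂ (over 2)))) (inverse-∈ u₂k≈1 (proj₁ (over 2))))
        where
        u₂≈ : coeff u 2 ≈ δ ^ 2
        u₂≈ = ≗⇒≈ᴾ u ((δ ^ 2 * slope E r) ∷ (- (δ ^ 2 * r)) ∷ δ ^ 2 ∷ []) (λ x → trans (eval-u x)
          (solve 4 (λ x r δ b → [] ⊢ δ :^ 2 :* (x :^ 2 :- r :* x :+ b) := δ :^ 2 :* b :+ x :* (:- (δ :^ 2 :* r) :+ x :* (δ :^ 2 :+ x :* con 0))) x r δ (slope E r))) 2
        s₂≈ : coeff s 2 ≈ δ ^ 3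
        s₂≈ = ≗⇒≈ᴾ s ((δ ^ 3 * (r ^ 2 - slope E r)) ∷ (- (δ ^ 3 * (ι 2 * r))) ∷ δ ^ 3 ∷ []) (λ x → trans (eval-s x)
          (solve 4 (λ x r δ b → [] ⊢ δ :^ 3 :* ((x :- r) :^ 2 :- b) := δ :^ 3 :* (r :^ 2 :- b) :+ x :* (:- (δ :^ 3 :* (con 2 :* r)) :+ x :* (δ :^ 3 :+ x :* con 0))) x r δ (slope E r))) 2
        u₂≉0 = ≉0-resp (sym u₂≈) (^-≉0 2 δ≉0)
        k = proj₁ (inverse (coeff u 2) u₂≉0)
        u₂k≈1 = proj₂ (inverse (coeff u 2) u₂≉0)
        δ≈ : coeff s 2 * k ≈ δ
        δ≈ = solve 4 (λ u s k δ → (k by s := δ :^ 3) ∷ (:- δ :* k by u := δ :^ 2) ∷ (δ by u :* k := :1) ∷ [] ⊢ s :* k := δ)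
               (coeff u 2) (coeff s 2) k δ s₂≈ u₂≈ u₂k≈1

  eval-equationˡ : ∀ s f v x → eval (s ^ᴾ 2 *ᴾ f *ᴾ v ^ᴾ 3) x ≈ eval s x ^ 2 * eval f x * eval v x ^ 3
  eval-equationˡ s f v x = trans (eval-* (s ^ᴾ 2 *ᴾ f) (v ^ᴾ 3) x)
    (*-cong (trans (eval-* (s ^ᴾ 2) f x) (*-congʳ (eval-^ s 2 x))) (eval-^ v 3 x))

  target-cubic : Weierstrass → Poly → Poly → Poly
  target-cubic E′ u v = u ^ᴾ 3 +ᴾ scale (A E′) (u *ᴾ v ^ᴾ 2) +ᴾ scale (B E′) (v ^ᴾ 3)

  eval-target-cubic : ∀ E′ u v x → eval (target-cubic E′ u v) x ≈
                      eval u x ^ 3 + A E′ * (eval u x * eval v x ^ 2) + B E′ * eval v x ^ 3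
  eval-target-cubic E′ u v x = trans (eval-+ (u ^ᴾ 3 +ᴾ scale (A E′) (u *ᴾ v ^ᴾ 2)) (scale (B E′) (v ^ᴾ 3)) x)
    (+-cong (trans (eval-+ (u ^ᴾ 3) (scale (A E′) (u *ᴾ v ^ᴾ 2)) x)
        (+-cong (eval-^ u 3 x) (trans (eval-scale (A E′) (u *ᴾ v ^ᴾ 2) x) (*-congˡ (trans (eval-* u (v ^ᴾ 2) x) (*-congˡ (eval-^ v 2 x)))))))
      (trans (eval-scale (B E′) (v ^ᴾ 3) x) (*-congˡ (eval-^ v 3 x))))

  eval-equationʳ : ∀ E′ u v t x → eval (t ^ᴾ 2 *ᴾ target-cubic E′ u v) x ≈
                   eval t x ^ 2 * (eval u x ^ 3 + A E′ * (eval u x * eval v x ^ 2) + B E′ * eval v x ^ 3)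
  eval-equationʳ E′ u v t x = trans (eval-* (t ^ᴾ 2) (target-cubic E′ u v) x) (*-cong (eval-^ t 2 x) (eval-target-cubic E′ u v x))

  eval-cubic : ∀ E x → eval (cubic E) x ≈ x ^ 3 + A E * x + B E
  eval-cubic E x = solve 3 (λ x A B → [] ⊢ B :+ x :* (A :+ x :* (con 0 :+ x :* (:1 :+ x :* con 0))) := :cubic A B x) x (A E) (B E)

  bezout⇒coprime : ∀ f g a b {k} → k ≉ 0# → (∀ x → eval a x * eval f x + eval b x * eval g x ≈ k) → Coprime f g
  bezout⇒coprime f g a b {k} k≉0 bezout d (q , qd≈f) (q′ , q′d≈g) = scale k⁻¹ (a *ᴾ q +ᴾ b *ᴾ q′) ,
    ≗⇒≈ᴾ (scale k⁻¹ (a *ᴾ q +ᴾ b *ᴾ q′) *ᴾ d) 1ᴾ (λ x → begin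
      eval (scale k⁻¹ (a *ᴾ q +ᴾ b *ᴾ q′) *ᴾ d) x
        ≈⟨ trans (eval-* (scale k⁻¹ (a *ᴾ q +ᴾ b *ᴾ q′)) d x) (*-congʳ (trans (eval-scale k⁻¹ (a *ᴾ q +ᴾ b *ᴾ q′) x)
             (*-congˡ (trans (eval-+ (a *ᴾ q) (b *ᴾ q′) x) (+-cong (eval-* a q x) (eval-* b q′ x)))))) ⟩
      k⁻¹ * (eval a x * eval q x + eval b x * eval q′ x) * eval d x
        ≈⟨ solve 8 (λ k⁻¹ k a b q q′ d z → (:1 by k :* k⁻¹ := :1) ∷ (k⁻¹ by a :* (q :* d) :+ b :* (q′ :* d) := k) ∷ []
             ⊢ k⁻¹ :* (a :* q :+ b :* q′) :* d := :1) k⁻¹ k _ _ _ _ _ x (proj₂ (inverse k k≉0))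
             (trans (+-cong (*-congˡ (trans (sym (eval-* q d x)) (eval-cong (q *ᴾ d) f qd≈f x)))
                            (*-congˡ (trans (sym (eval-* q′ d x)) (eval-cong (q′ *ᴾ d) g q′d≈g x)))) (bezout x)) ⟩
      1#
        ≈⟨ eval-1 x ⟨
      eval 1ᴾ x ∎)
    where k⁻¹ = proj₁ (inverse k k≉0)

  module _ {E E′ r δ} (elliptic : IsElliptic E) (V : IsVelu r δ E E′) where
    open IsVelu V
    open Scaling scaling
    private
      b = slope E r
      u′ v′ s′ t′ : Poly
      u′ = (δ ^ 2 * b) ∷ (- (δ ^ 2 * r)) ∷ δ ^ 2 ∷ []
      v′ = linear r
      s′ = (δ ^ 3 * (r ^ 2 - b)) ∷ (- (δ ^ 3 * (ι 2 * r))) ∷ δ ^ 3 ∷ []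
      t′ = r ^ 2 ∷ (- (ι 2 * r)) ∷ 1# ∷ []

      eval-u′ : ∀ x → eval u′ x ≈ δ ^ 2 * (x ^ 2 - r * x + b)
      eval-u′ x = solve 4 (λ x r δ b → [] ⊢ δ :^ 2 :* b :+ x :* (:- (δ :^ 2 :* r) :+ x :* (δ :^ 2 :+ x :* con 0)) := δ :^ 2 :* (x :^ 2 :- r :* x :+ b)) x r δ b

      eval-s′ : ∀ x → eval s′ x ≈ δ ^ 3 * ((x - r) ^ 2 - b)
      eval-s′ x = solve 4 (λ x r δ b → [] ⊢ δ :^ 3 :* (r :^ 2 :- b) :+ x :* (:- (δ :^ 3 :* (con 2 :* r)) :+ x :* (δ :^ 3 :+ x :* con 0)) := δ :^ 3 :* ((x :- r) :^ 2 :- b)) x r δ b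

      eval-t′ : ∀ x → eval t′ x ≈ (x - r) ^ 2
      eval-t′ x = solve 2 (λ x r → [] ⊢ r :^ 2 :+ x :* (:- (con 2 :* r) :+ x :* (:1 :+ x :* con 0)) := (x :- r) :^ 2) x r

      high : ∀ {a b c} i → 2 ℕ.< i → coeff (a ∷ b ∷ c ∷ []) i ≈ 0#
      high (suc zero) (s≤s ())
      high (suc (suc zero)) (s≤s (s≤s ()))
      high (suc (suc (suc i))) _ = refl

      high′ : ∀ {a b} i → 1 ℕ.< i → coeff (a ∷ b ∷ []) i ≈ 0#
      high′ (suc zero) (s≤s ())
      high′ (suc (suc i)) _ = refl

      equation′ : ∀ x → eval (s′ ^ᴾ 2 *ᴾ cubic E *ᴾ v′ ^ᴾ 3) x ≈ eval (t′ ^ᴾ 2 *ᴾ target-cubic E′ u′ v′) x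
      equation′ x = begin
        eval (s′ ^ᴾ 2 *ᴾ cubic E *ᴾ v′ ^ᴾ 3) x
          ≈⟨ eval-equationˡ s′ (cubic E) v′ x ⟩
        eval s′ x ^ 2 * eval (cubic E) x * eval v′ x ^ 3
          ≈⟨ *-cong (*-cong (^-congˡ 2 (eval-s′ x)) (eval-cubic E x)) (^-congˡ 3 (eval-linear r x)) ⟩
        (δ ^ 3 * ((x - r) ^ 2 - b)) ^ 2 * (x ^ 3 + A E * x + B E) * (x - r) ^ 3
          ≈⟨ solve 7 (λ x r δ A B A′ B′ → let ξ = x :- r ; b = :slope A r ; u = δ :^ 2 :* (x :^ 2 :- r :* x :+ b) in
                 (δ :^ 6 :* (ξ :^ 2 :- b) :^ 2 :* ξ :^ 3 by :cubic A B r := con 0)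
               ∷ (:- ξ :^ 4 :* u :* ξ :^ 2 by A′ := δ :^ 4 :* (:veluA A r))
               ∷ (:- ξ :^ 7 by B′ := δ :^ 6 :* (:veluB A r)) ∷ []
               ⊢ (δ :^ 3 :* (ξ :^ 2 :- b)) :^ 2 :* (:cubic A B x) :* ξ :^ 3
                   := (ξ :^ 2) :^ 2 :* (u :^ 3 :+ A′ :* (u :* ξ :^ 2) :+ B′ :* ξ :^ 3))
               x r δ (A E) (B E) (A E′) (B E′) root A-eq B-eq ⟩
        ((x - r) ^ 2) ^ 2 * ((δ ^ 2 * (x ^ 2 - r * x + b)) ^ 3 + A E′ * (δ ^ 2 * (x ^ 2 - r * x + b) * (x - r) ^ 2) + B E′ * (x - r) ^ 3)
          ≈⟨ *-cong (^-congˡ 2 (eval-t′ x)) (+-cong (+-cong (^-congˡ 3 (eval-u′ x)) (*-congˡ (*-cong (eval-u′ x) (^-congˡ 2 (eval-linear r x))))) (*-congˡ (^-congˡ 3 (eval-linear r x)))) ⟨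
        eval t′ x ^ 2 * (eval u′ x ^ 3 + A E′ * (eval u′ x * eval v′ x ^ 2) + B E′ * eval v′ x ^ 3)
          ≈⟨ eval-equationʳ E′ u′ v′ t′ x ⟨
        eval (t′ ^ᴾ 2 *ᴾ target-cubic E′ u′ v′) x ∎

      b≉0 = slope≉0 E r elliptic root

    abstract
      veluIsogeny : Isogeny E E′
      veluIsogeny = record
        { u = u′ ; v = v′ ; s = s′ ; t = t′ ; degᵤ = 2 ; degᵥ = 1
        ; degree-u = ^-≉0 2 δ≉0 , high
        ; degree-v = 1≉0 , high′
        ; degᵥ<degᵤ = s≤s (s≤s z≤n)
        ; v-monic = 1 , (1≉0 , high′) , refl
        ; t-monic = 2 , (1≉0 , high) , refl
        -- u′ - δ²X v′ is the constant δ²b, and below δ³ t′ - s′ is the constant δ³b.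
        ; u-v-coprime = bezout⇒coprime u′ v′ 1ᴾ (0# ∷ (- (δ ^ 2)) ∷ []) (*-≉0 (^-≉0 2 δ≉0) b≉0) (λ x →
            trans (+-congˡ (*-congˡ (eval-linear r x)))
              (solve 4 (λ x r δ b → [] ⊢ (:1 :+ x :* con 0) :* (δ :^ 2 :* b :+ x :* (:- (δ :^ 2 :* r) :+ x :* (δ :^ 2 :+ x :* con 0)))
                  :+ (con 0 :+ x :* (:- δ :^ 2 :+ x :* con 0)) :* (x :- r) := δ :^ 2 :* b) x r δ b))
        ; s-t-coprime = bezout⇒coprime s′ t′ ((- 1#) ∷ []) (δ ^ 3 ∷ []) (*-≉0 (^-≉0 3 δ≉0) b≉0) (λ x →
            solve 4 (λ x r δ b → [] ⊢ (:- :1 :+ x :* con 0) :* (δ :^ 3 :* (r :^ 2 :- b) :+ x :* (:- (δ :^ 3 :* (con 2 :* r)) :+ x :* (δ :^ 3 :+ x :* con 0)))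
                  :+ (δ :^ 3 :+ x :* con 0) :* (r :^ 2 :+ x :* (:- (con 2 :* r) :+ x :* (:1 :+ x :* con 0))) := δ :^ 3 :* b) x r δ b)
        ; equation = ≗⇒≈ᴾ (s′ ^ᴾ 2 *ᴾ cubic E *ᴾ v′ ^ᴾ 3) (t′ ^ᴾ 2 *ᴾ target-cubic E′ u′ v′) equation′
        }

      veluIsogeny-degree : Isogeny.degree veluIsogeny ≡ 2
      veluIsogeny-degree = ≡.refl

      veluIsogeny-form : HasVeluForm veluIsogeny r δ
      veluIsogeny-form = record { eval-u = eval-u′ ; eval-v = eval-linear r ; eval-s = eval-s′ ; eval-t = eval-t′ }

      veluIsogeny-over : InPrimeField (A E) → InPrimeField r → InPrimeField δ → Isogeny.DefinedOver𝔽ₚ veluIsogeny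
      veluIsogeny-over A∈ r∈ δ∈ = λ where
          0 → *-∈ δ²∈ b∈ , -‿∈ r∈ , *-∈ δ³∈ (+-∈ (^-∈ 2 r∈) (-‿∈ b∈)) , ^-∈ 2 r∈
          1 → -‿∈ (*-∈ δ²∈ r∈) , 1-∈ , -‿∈ (*-∈ δ³∈ 2r∈) , -‿∈ 2r∈
          2 → δ²∈ , 0-∈ , δ³∈ , 1-∈
          (suc (suc (suc i))) → 0-∈ , 0-∈ , 0-∈ , 0-∈
        where
        δ²∈ : InPrimeField (δ ^ 2)
        δ²∈ = ^-∈ 2 δ∈
        δ³∈ : InPrimeField (δ ^ 3)
        δ³∈ = ^-∈ 3 δ∈
        2r∈ : InPrimeField (ι 2 * r)
        2r∈ = *-∈ (ι-∈ 2) r∈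
        b∈ : InPrimeField b
        b∈ = +-∈ (*-∈ (ι-∈ 3) (^-∈ 2 r∈)) A∈

-- Solving the degree-2 identity

module MonicIdentities {c ℓ : Level} {p : ℕ} (p-prime : Prime p) (3<p : 3 < p) (K : AlgebraicClosure𝔽 c ℓ p) where
  open Context p-prime 3<p K
  open Curves p-prime 3<p K
  open VeluHomomorphism p-prime 3<p K
  open VeluIsogeny p-prime 3<p K
  open VeluForms p-prime 3<p K

  -- A factor x - r may be cancelled between functions only if both sides are polynomial; the
  -- combinators below certify this alongside the pointwise calculation.
  PolynomialFunction : (∣K∣ → ∣K∣) → Set (c Level.⊔ ℓ)
  PolynomialFunction F = ∃[ f ] ∀ x → eval f x ≈ F x

  infixl 6 _⊕_
  infixl 7 _⊗_
  _⊕_ : ∀ {F G} → PolynomialFunction F → PolynomialFunction G → PolynomialFunction (λ x → F x + G x)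
  (f , f≈) ⊕ (g , g≈) = f +ᴾ g , λ x → trans (eval-+ f g x) (+-cong (f≈ x) (g≈ x))

  _⊗_ : ∀ {F G} → PolynomialFunction F → PolynomialFunction G → PolynomialFunction (λ x → F x * G x)
  (f , f≈) ⊗ (g , g≈) = f *ᴾ g , λ x → trans (eval-* f g x) (*-cong (f≈ x) (g≈ x))

  power : ∀ {F} n → PolynomialFunction F → PolynomialFunction (λ x → F x ^ n)
  power n (f , f≈) = f ^ᴾ n , λ x → trans (eval-^ f n x) (^-congˡ n (f≈ x))

  constant : ∀ a → PolynomialFunction (λ _ → a)
  constant a = a ∷ [] , λ x → trans (+-congˡ (zeroʳ x)) (+-identityʳ a)

  evaluation : ∀ f → PolynomialFunction (eval f)
  evaluation f = f , λ x → refl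

  identity : PolynomialFunction (λ x → x)
  identity = 0# ∷ 1# ∷ [] , solve 1 (λ x → [] ⊢ con 0 :+ x :* (:1 :+ x :* con 0) := x)

  cancel-root : ∀ r {F G} → PolynomialFunction F → PolynomialFunction G →
                (∀ x → (x - r) * F x ≈ (x - r) * G x) → ∀ x → F x ≈ G x
  cancel-root r (f , f≈) (g , g≈) eq x = trans (sym (f≈ x)) (trans
    (cancel-linear r f g (λ x → trans (*-congˡ (f≈ x)) (trans (eq x) (sym (*-congˡ (g≈ x))))) x) (g≈ x))

  eval-degree0 : ∀ f → HasDegree f 0 → ∀ x → eval f x ≈ coeff f 0
  eval-degree0 f (_ , high) x = trans (eval-cong f (coeff f 0 ∷ []) (λ { zero → refl ; (suc i) → high (suc i) (s≤s z≤n) }) x)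
    (trans (+-congˡ (zeroʳ x)) (+-identityʳ _))

  eval-degree1 : ∀ f → HasDegree f 1 → ∀ x → eval f x ≈ coeff f 0 + coeff f 1 * x
  eval-degree1 f (_ , high) x = trans
    (eval-cong f (coeff f 0 ∷ coeff f 1 ∷ []) (λ { zero → refl ; (suc zero) → refl ; (suc (suc i)) → high (suc (suc i)) (s≤s (s≤s z≤n)) }) x)
    (solve 3 (λ x a b → [] ⊢ a :+ x :* (b :+ x :* con 0) := a :+ b :* x) x _ _)

  eval-degree2 : ∀ f → HasDegree f 2 → ∀ x → eval f x ≈ coeff f 0 + coeff f 1 * x + coeff f 2 * x ^ 2
  eval-degree2 f (_ , high) x = trans
    (eval-cong f (coeff f 0 ∷ coeff f 1 ∷ coeff f 2 ∷ [])
      (λ { zero → refl ; (suc zero) → refl ; (suc (suc zero)) → refl ; (suc (suc (suc i))) → high (suc (suc (suc i))) (s≤s (s≤s (s≤s z≤n))) }) x)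
    (solve 4 (λ x a b c → [] ⊢ a :+ x :* (b :+ x :* (c :+ x :* con 0)) := a :+ b :* x :+ c :* x :^ 2) x _ _ _)

  -- The isogeny equation in ξ = x - r with v = ξ and t = ξ², after division by ξ⁴: one ξ of the
  -- divisor comes from the cubic of E, which leaves ξ² + aξ + b, and three come from v³.
  Identity : (s₂ s₁ s₀ u₂ u₁ u₀ a b α β : ∣K∣) → Set (c Level.⊔ ℓ)
  Identity s₂ s₁ s₀ u₂ u₁ u₀ a b α β = ∀ ξ →
    (s₂ * ξ ^ 2 + s₁ * ξ + s₀) ^ 2 * (ξ ^ 2 + a * ξ + b)
      ≈ (u₂ * ξ ^ 2 + u₁ * ξ + u₀) ^ 3 + α * ((u₂ * ξ ^ 2 + u₁ * ξ + u₀) * ξ ^ 2) + β * ξ ^ 3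

  module Coefficients {s₂ s₁ s₀ u₂ u₁ u₀ a b α β} (identity : Identity s₂ s₁ s₀ u₂ u₁ u₀ a b α β) where
    private
      difference : Poly
      difference = (b * s₀ ^ 2 - u₀ ^ 3)
        ∷ (ι 2 * (b * s₁ * s₀) + a * s₀ ^ 2 - ι 3 * (u₁ * u₀ ^ 2))
        ∷ (b * (s₁ ^ 2 + ι 2 * (s₂ * s₀)) + ι 2 * (a * s₁ * s₀) + s₀ ^ 2 - (ι 3 * (u₂ * u₀ ^ 2) + ι 3 * (u₁ ^ 2 * u₀) + α * u₀))
        ∷ (ι 2 * (b * s₂ * s₁) + a * (s₁ ^ 2 + ι 2 * (s₂ * s₀)) + ι 2 * (s₁ * s₀) - (u₁ ^ 3 + ι 6 * (u₂ * u₁ * u₀) + α * u₁ + β))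
        ∷ (b * s₂ ^ 2 + ι 2 * (a * s₂ * s₁) + s₁ ^ 2 + ι 2 * (s₂ * s₀) - (ι 3 * (u₂ ^ 2 * u₀) + ι 3 * (u₂ * u₁ ^ 2) + α * u₂))
        ∷ (a * s₂ ^ 2 + ι 2 * (s₂ * s₁) - ι 3 * (u₂ ^ 2 * u₁))
        ∷ (s₂ ^ 2 - u₂ ^ 3)
        ∷ []

      zeros : ∀ i → coeff difference i ≈ 0#
      zeros = vanishing⇒zero difference (λ ξ → solve 11 (λ s₂ s₁ s₀ u₂ u₁ u₀ a b α β ξ →
          let s = s₂ :* ξ :^ 2 :+ s₁ :* ξ :+ s₀ ; u = u₂ :* ξ :^ 2 :+ u₁ :* ξ :+ u₀ in
          (:1 by s :^ 2 :* (ξ :^ 2 :+ a :* ξ :+ b) := u :^ 3 :+ α :* (u :* ξ :^ 2) :+ β :* ξ :^ 3) ∷ []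
        ⊢ (b :* s₀ :^ 2 :- u₀ :^ 3)
            :+ ξ :* ((con 2 :* (b :* s₁ :* s₀) :+ a :* s₀ :^ 2 :- con 3 :* (u₁ :* u₀ :^ 2))
            :+ ξ :* ((b :* (s₁ :^ 2 :+ con 2 :* (s₂ :* s₀)) :+ con 2 :* (a :* s₁ :* s₀) :+ s₀ :^ 2 :- (con 3 :* (u₂ :* u₀ :^ 2) :+ con 3 :* (u₁ :^ 2 :* u₀) :+ α :* u₀))
            :+ ξ :* ((con 2 :* (b :* s₂ :* s₁) :+ a :* (s₁ :^ 2 :+ con 2 :* (s₂ :* s₀)) :+ con 2 :* (s₁ :* s₀) :- (u₁ :^ 3 :+ con 6 :* (u₂ :* u₁ :* u₀) :+ α :* u₁ :+ β))
            :+ ξ :* ((b :* s₂ :^ 2 :+ con 2 :* (a :* s₂ :* s₁) :+ s₁ :^ 2 :+ con 2 :* (s₂ :* s₀) :- (con 3 :* (u₂ :^ 2 :* u₀) :+ con 3 :* (u₂ :* u₁ :^ 2) :+ α :* u₂))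
            :+ ξ :* ((a :* s₂ :^ 2 :+ con 2 :* (s₂ :* s₁) :- con 3 :* (u₂ :^ 2 :* u₁))
            :+ ξ :* ((s₂ :^ 2 :- u₂ :^ 3) :+ ξ :* con 0)))))) := con 0)
        s₂ s₁ s₀ u₂ u₁ u₀ a b α β ξ (identity ξ))

    c₀ = zeros 0
    c₁ = zeros 1
    c₂ = zeros 2
    c₃ = zeros 3
    c₄ = zeros 4
    c₅ = zeros 5
    c₆ = zeros 6

  -- The constant terms satisfy b t₀² = e³, a cuspidal cubic, parametrised by w = t₀/e as e = bw²
  -- and t₀ = bw³. The other coefficients then force w = 1 or w = -1; the first makes the target
  -- singular and the second is Vélu's solution.
  module MonicIdentity (E : Weierstrass) (r : ∣K∣) (elliptic : IsElliptic E) (root : Root E r)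
                    {t₁ t₀ d e α β : ∣K∣} (elliptic′ : IsElliptic (weierstrass α β)) (e≉0 : e ≉ 0#)
                    (identity : Identity 1# t₁ t₀ 1# d e (ι 3 * r) (slope E r) α β) where
    private
      b = slope E r
      open Coefficients identity

      F₅ : ι 3 * r + ι 2 * t₁ ≈ ι 3 * d
      F₅ = solve 3 (λ r t₁ d → (:1 by (con 3 :* r) :* :1 :^ 2 :+ con 2 :* (:1 :* t₁) :- con 3 :* (:1 :^ 2 :* d) := con 0) ∷ []
        ⊢ con 3 :* r :+ con 2 :* t₁ := con 3 :* d) r t₁ d c₅

      F₄ : b + ι 6 * (r * t₁) + t₁ ^ 2 + ι 2 * t₀ ≈ ι 3 * e + ι 3 * d ^ 2 + α
      F₄ = solve 7 (λ r b t₁ t₀ d e α → (:1 by b :* :1 :^ 2 :+ con 2 :* (con 3 :* r :* :1 :* t₁) :+ t₁ :^ 2 :+ con 2 :* (:1 :* t₀) :- (con 3 :* (:1 :^ 2 :* e) :+ con 3 :* (:1 :* d :^ 2) :+ α :* :1) := con 0) ∷ []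
        ⊢ b :+ con 6 :* (r :* t₁) :+ t₁ :^ 2 :+ con 2 :* t₀ := con 3 :* e :+ con 3 :* d :^ 2 :+ α) r b t₁ t₀ d e α c₄

      F₃ : ι 2 * (b * t₁) + ι 3 * r * (t₁ ^ 2 + ι 2 * t₀) + ι 2 * (t₁ * t₀) ≈ d ^ 3 + ι 6 * (d * e) + α * d + β
      F₃ = solve 8 (λ r b t₁ t₀ d e α β → (:1 by con 2 :* (b :* :1 :* t₁) :+ con 3 :* r :* (t₁ :^ 2 :+ con 2 :* (:1 :* t₀)) :+ con 2 :* (t₁ :* t₀) :- (d :^ 3 :+ con 6 :* (:1 :* d :* e) :+ α :* d :+ β) := con 0) ∷ []
        ⊢ con 2 :* (b :* t₁) :+ con 3 :* r :* (t₁ :^ 2 :+ con 2 :* t₀) :+ con 2 :* (t₁ :* t₀) := d :^ 3 :+ con 6 :* (d :* e) :+ α :* d :+ β) r b t₁ t₀ d e α β c₃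

      F₂ : b * (t₁ ^ 2 + ι 2 * t₀) + ι 6 * (r * t₁ * t₀) + t₀ ^ 2 ≈ ι 3 * e ^ 2 + ι 3 * (d ^ 2 * e) + α * e
      F₂ = solve 7 (λ r b t₁ t₀ d e α → (:1 by b :* (t₁ :^ 2 :+ con 2 :* (:1 :* t₀)) :+ con 2 :* (con 3 :* r :* t₁ :* t₀) :+ t₀ :^ 2 :- (con 3 :* (:1 :* e :^ 2) :+ con 3 :* (d :^ 2 :* e) :+ α :* e) := con 0) ∷ []
        ⊢ b :* (t₁ :^ 2 :+ con 2 :* t₀) :+ con 6 :* (r :* t₁ :* t₀) :+ t₀ :^ 2 := con 3 :* e :^ 2 :+ con 3 :* (d :^ 2 :* e) :+ α :* e) r b t₁ t₀ d e α c₂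

      F₁ : ι 2 * (b * t₁ * t₀) + ι 3 * r * t₀ ^ 2 ≈ ι 3 * (d * e ^ 2)
      F₁ = x∙y⁻¹≈ε⇒x≈y _ _ c₁

      F₀ : b * t₀ ^ 2 ≈ e ^ 3
      F₀ = x∙y⁻¹≈ε⇒x≈y _ _ c₀

      b≉0 = slope≉0 E r elliptic root

      w = t₀ * proj₁ (inverse e e≉0)

      t₀≈we : t₀ ≈ w * e
      t₀≈we = solve 3 (λ t e k → (:- t by e :* k := :1) ∷ [] ⊢ t := t :* k :* e) t₀ e _ (proj₂ (inverse e e≉0))

      e≈ : e ≈ b * w ^ 2
      e≈ = *-cancelˡ-≉0 (^-≉0 2 e≉0) (solve 4 (λ e b t w → (:- :1 by b :* t :^ 2 := e :^ 3) ∷ (b :* (t :+ w :* e) by t := w :* e) ∷ []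
        ⊢ e :^ 2 :* e := e :^ 2 :* (b :* w :^ 2)) e b t₀ w F₀ t₀≈we)

      t₀≈ : t₀ ≈ b * w ^ 3
      t₀≈ = trans t₀≈we (trans (*-congˡ e≈) (solve 2 (λ b w → [] ⊢ w :* (b :* w :^ 2) := b :* w :^ 3) b w))

      w≉0 : w ≉ 0#
      w≉0 w≈0 = e≉0 (trans e≈ (trans (*-congˡ (trans (*-congʳ w≈0) (zeroˡ _))) (zeroʳ b)))

      I₁ : ι 2 * t₁ + ι 3 * (r * w ^ 3) ≈ ι 3 * (d * w)
      I₁ = *-cancelˡ-≉0 (*-≉0 (^-≉0 2 b≉0) (^-≉0 3 w≉0)) (solve 7 (λ r b t₁ t₀ d e w →
            (:1 by con 2 :* (b :* t₁ :* t₀) :+ con 3 :* r :* t₀ :^ 2 := con 3 :* (d :* e :^ 2))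
          ∷ (con 3 :* b :* d :* w :^ 2 :+ con 3 :* d :* e by e := b :* w :^ 2)
          ∷ (:- (con 3 :* b :* r :* w :^ 3) :- con 2 :* b :* t₁ :- con 3 :* r :* t₀ by t₀ := b :* w :^ 3) ∷ []
        ⊢ b :^ 2 :* w :^ 3 :* (con 2 :* t₁ :+ con 3 :* (r :* w :^ 3)) := b :^ 2 :* w :^ 3 :* (con 3 :* (d :* w)))
        r b t₁ t₀ d e w F₁ e≈ t₀≈)

      -- What is left of e · `F₄` - `F₂`, a combination that eliminates α, after the factor b(1 - w)
      -- is split off.
      bracket = b * w ^ 2 * (1# + w) * (1# - w) ^ 2 + ι 6 * (r * t₁ * w ^ 2) - t₁ ^ 2 * (1# + w)

      brackets : b * (1# - w) * bracket ≈ 0#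
      brackets = solve 8 (λ r b t₁ t₀ d e α w →
            (:- :1 by b :* (t₁ :^ 2 :+ con 2 :* t₀) :+ con 6 :* (r :* t₁ :* t₀) :+ t₀ :^ 2 := con 3 :* e :^ 2 :+ con 3 :* (d :^ 2 :* e) :+ α :* e)
          ∷ (e by b :+ con 6 :* (r :* t₁) :+ t₁ :^ 2 :+ con 2 :* t₀ := con 3 :* e :+ con 3 :* d :^ 2 :+ α)
          ∷ (:- (con 6 :* r :* t₁) :- t₁ :^ 2 :- b :- con 2 :* t₀ by e := b :* w :^ 2)
          ∷ (b :* w :^ 3 :+ con 6 :* r :* t₁ :+ con 2 :* b :+ t₀ :- con 2 :* b :* w :^ 2 by t₀ := b :* w :^ 3) ∷ []
        ⊢ b :* (:1 :- w) :* (b :* w :^ 2 :* (:1 :+ w) :* (:1 :- w) :^ 2 :+ con 6 :* (r :* t₁ :* w :^ 2) :- t₁ :^ 2 :* (:1 :+ w)) := con 0)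
        r b t₁ t₀ d e α w F₂ F₄ e≈ t₀≈

      -- For w = 1 the target cubic has the double root d - t₁.
      w≉1 : w ≉ 1#
      w≉1 w≈1 = elliptic′ (begin
        ι 4 * α ^ 3 + ι 27 * β ^ 2
          ≈⟨ +-cong (*-congˡ (^-congˡ 3 α≈)) (*-congˡ (^-congˡ 2 β≈)) ⟩
        ι 4 * (- (ι 3 * (t₁ - d) ^ 2)) ^ 3 + ι 27 * (- (ι 2 * (t₁ - d) ^ 3)) ^ 2
          ≈⟨ solve 1 (λ z → [] ⊢ con 4 :* (:- (con 3 :* z :^ 2)) :^ 3 :+ con 27 :* (:- (con 2 :* z :^ 3)) :^ 2 := con 0) (t₁ - d) ⟩
        0# ∎)
        where
        e≈b : e ≈ b
        e≈b = trans e≈ (trans (*-congˡ (trans (^-congˡ 2 w≈1) (1^ 2))) (*-identityʳ b))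
        t₀≈b : t₀ ≈ b
        t₀≈b = trans t₀≈ (trans (*-congˡ (trans (^-congˡ 3 w≈1) (1^ 3))) (*-identityʳ b))
        α≈ : α ≈ - (ι 3 * (t₁ - d) ^ 2)
        α≈ = solve 7 (λ r b t₁ t₀ d e α →
            (:- :1 by b :+ con 6 :* (r :* t₁) :+ t₁ :^ 2 :+ con 2 :* t₀ := con 3 :* e :+ con 3 :* d :^ 2 :+ α)
          ∷ (:- con 3 by e := b) ∷ (con 2 by t₀ := b) ∷ (con 2 :* t₁ by con 3 :* r :+ con 2 :* t₁ := con 3 :* d) ∷ []
          ⊢ α := :- (con 3 :* (t₁ :- d) :^ 2)) r b t₁ t₀ d e α F₄ e≈b t₀≈b F₅
        β≈ : β ≈ - (ι 2 * (t₁ - d) ^ 3)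
        β≈ = solve 8 (λ r b t₁ t₀ d e α β →
            (:- :1 by con 2 :* (b :* t₁) :+ con 3 :* r :* (t₁ :^ 2 :+ con 2 :* t₀) :+ con 2 :* (t₁ :* t₀) := d :^ 3 :+ con 6 :* (d :* e) :+ α :* d :+ β)
          ∷ (:- con 6 :* d by e := b) ∷ (con 6 :* r :+ con 2 :* t₁ by t₀ := b)
          ∷ (:- d by α := :- (con 3 :* (t₁ :- d) :^ 2))
          ∷ (t₁ :^ 2 :+ con 2 :* b by con 3 :* r :+ con 2 :* t₁ := con 3 :* d) ∷ []
          ⊢ β := :- (con 2 :* (t₁ :- d) :^ 3)) r b t₁ t₀ d e α β F₃ e≈b t₀≈b α≈ F₅

      1-w≉0 : 1# - w ≉ 0#
      1-w≉0 = -≉0 (λ 1≈w → w≉1 (sym 1≈w))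

      -- Subtracting `I₁` from `F₅` eliminates t₁ and leaves 3(1 - w)d = 3r(1 - w³).
      d≈ : d ≈ r * (w ^ 2 + w + 1#)
      d≈ = *-cancelˡ-≉0 (*-≉0 3≉0 1-w≉0) (solve 4 (λ r t₁ d w →
            (:1 by con 2 :* t₁ :+ con 3 :* (r :* w :^ 3) := con 3 :* (d :* w)) ∷ (:- :1 by con 3 :* r :+ con 2 :* t₁ := con 3 :* d) ∷ []
          ⊢ con 3 :* (:1 :- w) :* d := con 3 :* (:1 :- w) :* (r :* (w :^ 2 :+ w :+ :1))) r t₁ d w I₁ F₅)

      2t₁≈ : ι 2 * t₁ ≈ ι 3 * (r * (w ^ 2 + w))
      2t₁≈ = solve 4 (λ r t₁ d w →
            (con 3 by d := r :* (w :^ 2 :+ w :+ :1)) ∷ (:1 by con 3 :* r :+ con 2 :* t₁ := con 3 :* d) ∷ []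
          ⊢ con 2 :* t₁ := con 3 :* (r :* (w :^ 2 :+ w))) r t₁ d w d≈ F₅

      w≈-1 : 1# + w ≈ 0#
      w≈-1 = x*y≈0⇒y≈0 (*-≉0 (*-≉0 (^-≉0 2 w≉0) (^-≉0 2 1-w≉0)) (discriminant-factor≉0 E r elliptic root))
        (solve 4 (λ r b t₁ w →
            (:- con 4 by b :* w :^ 2 :* (:1 :+ w) :* (:1 :- w) :^ 2 :+ con 6 :* (r :* t₁ :* w :^ 2) :- t₁ :^ 2 :* (:1 :+ w) := con 0)
          ∷ (con 6 :* r :* w :^ 2 :- con 3 :* r :* w :^ 3 :- con 3 :* r :* w :- con 2 :* t₁ :* w :- con 2 :* t₁ by con 2 :* t₁ := con 3 :* (r :* (w :^ 2 :+ w))) ∷ []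
          ⊢ w :^ 2 :* (:1 :- w) :^ 2 :* (con 9 :* r :^ 2 :- con 4 :* b) :* (:1 :+ w) := con 0)
        r b t₁ w (x*y≈0⇒y≈0 (*-≉0 b≉0 1-w≉0) brackets) 2t₁≈)

    e≈b : e ≈ b
    e≈b = trans e≈ (solve 2 (λ b w → (b :* (w :- :1) by :1 :+ w := con 0) ∷ [] ⊢ b :* w :^ 2 := b) b w w≈-1)

    t₀≈-b : t₀ ≈ - b
    t₀≈-b = trans t₀≈ (solve 2 (λ b w → (b :* (w :^ 2 :- w :+ :1) by :1 :+ w := con 0) ∷ [] ⊢ b :* w :^ 3 := :- b) b w w≈-1)

    d≈r : d ≈ r
    d≈r = trans d≈ (solve 2 (λ r w → (r :* w by :1 :+ w := con 0) ∷ [] ⊢ r :* (w :^ 2 :+ w :+ :1) := r) r w w≈-1)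

    t₁≈0 : t₁ ≈ 0#
    t₁≈0 = x*y≈0⇒y≈0 2≉0 (trans 2t₁≈ (solve 2 (λ r w → (con 3 :* r :* w by :1 :+ w := con 0) ∷ [] ⊢ con 3 :* (r :* (w :^ 2 :+ w)) := con 0) r w w≈-1))

    α≈velu : α ≈ A (velu E r)
    α≈velu = solve 7 (λ r A t₁ t₀ d e α → let b = :slope A r in
        (:- :1 by b :+ con 6 :* (r :* t₁) :+ t₁ :^ 2 :+ con 2 :* t₀ := con 3 :* e :+ con 3 :* d :^ 2 :+ α)
      ∷ (:- con 3 by e := b) ∷ (con 2 by t₀ := :- b) ∷ (con 6 :* r :+ t₁ by t₁ := con 0) ∷ (:- (con 3 :* d) :- con 3 :* r by d := r) ∷ []
      ⊢ α := :veluA A r) r (A E) t₁ t₀ d e α F₄ e≈b t₀≈-b t₁≈0 d≈r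

    β≈velu : β ≈ B (velu E r)
    β≈velu = solve 8 (λ r A t₁ t₀ d e α β → let b = :slope A r in
        (:- :1 by con 2 :* (b :* t₁) :+ con 3 :* r :* (t₁ :^ 2 :+ con 2 :* t₀) :+ con 2 :* (t₁ :* t₀) := d :^ 3 :+ con 6 :* (d :* e) :+ α :* d :+ β)
      ∷ (:- (con 6 :* d) by e := b) ∷ (con 6 :* r :+ con 2 :* t₁ by t₀ := :- b) ∷ (con 3 :* r :* t₁ by t₁ := con 0)
      ∷ (:- (d :* r) :- d :^ 2 :- r :^ 2 :- con 6 :* b :- α by d := r)
      ∷ (:- r by α := :veluA A r) ∷ []
      ⊢ β := :veluB A r) r (A E) t₁ t₀ d e α β F₃ e≈b t₀≈-b t₁≈0 d≈r α≈velu

-- Classification of degree-2 isogenies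

module Classification {c ℓ : Level} {p : ℕ} (p-prime : Prime p) (3<p : 3 < p) (K : AlgebraicClosure𝔽 c ℓ p) where
  open Context p-prime 3<p K
  open Curves p-prime 3<p K
  open VeluHomomorphism p-prime 3<p K
  open VeluIsogeny p-prime 3<p K
  open VeluForms p-prime 3<p K
  open MonicIdentities p-prime 3<p K

  module _ {E E′ : Weierstrass} (elliptic : IsElliptic E) (elliptic′ : IsElliptic E′)
           (φ : Isogeny E E′) (degree≡2 : Isogeny.degree φ ≡ 2) where
    open Isogeny φ
    private
      U V S T F N : ∣K∣ → ∣K∣
      U = eval u
      V = eval v
      S = eval s
      T = eval t
      F x = x ^ 3 + A E * x + B E
      N x = U x ^ 3 + A E′ * (U x * V x ^ 2) + B E′ * V x ^ 3

      S-fun = evaluation s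
      N-fun : PolynomialFunction N
      N-fun = (power 3 (evaluation u) ⊕ constant (A E′) ⊗ (evaluation u ⊗ power 2 (evaluation v))) ⊕ constant (B E′) ⊗ power 3 (evaluation v)

      eqn : ∀ x → S x ^ 2 * F x * V x ^ 3 ≈ T x ^ 2 * N x
      eqn x = begin
        S x ^ 2 * F x * V x ^ 3
          ≈⟨ *-congʳ (*-congˡ (eval-cubic E x)) ⟨
        S x ^ 2 * eval (cubic E) x * V x ^ 3
          ≈⟨ eval-equationˡ s (cubic E) v x ⟨
        eval (s ^ᴾ 2 *ᴾ cubic E *ᴾ v ^ᴾ 3) x
          ≈⟨ eval-cong (s ^ᴾ 2 *ᴾ cubic E *ᴾ v ^ᴾ 3) (t ^ᴾ 2 *ᴾ target-cubic E′ u v) equation x ⟩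
        eval (t ^ᴾ 2 *ᴾ target-cubic E′ u v) x
          ≈⟨ eval-equationʳ E′ u v t x ⟩
        T x ^ 2 * N x ∎

      degᵤ≡2 : degᵤ ≡ 2
      degᵤ≡2 = ≡.trans (≡.sym (ℕ.m≥n⇒m⊔n≡m (ℕ.<⇒≤ degᵥ<degᵤ))) degree≡2

      degree-u₂ : HasDegree u 2
      degree-u₂ = ≡.subst (HasDegree u) degᵤ≡2 degree-u

      degᵥ<2 : degᵥ ℕ.< 2
      degᵥ<2 = ≡.subst (degᵥ ℕ.<_) degᵤ≡2 degᵥ<degᵤ

      degree-N : HasDegree (target-cubic E′ u v) 6
      degree-N = degree-+ (u ^ᴾ 3 +ᴾ scale (A E′) (u *ᴾ v ^ᴾ 2)) (scale (B E′) (v ^ᴾ 3))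
        (degree-+ (u ^ᴾ 3) (scale (A E′) (u *ᴾ v ^ᴾ 2)) (degree-^ u 3 degree-u₂)
          (λ i 6≤i → trans (coeff-scale (A E′) (u *ᴾ v ^ᴾ 2) i) (trans (*-congˡ (proj₂ (degree-* u (v ^ᴾ 2) degree-u₂ (degree-^ v 2 degree-v)) i
            (ℕ.≤-trans (s≤s (ℕ.+-monoʳ-≤ 2 (ℕ.*-monoʳ-≤ 2 (ℕ.≤-pred degᵥ<2)))) (ℕ.<⇒≤ 6≤i)))) (zeroʳ _))))
        (λ i 6≤i → trans (coeff-scale (B E′) (v ^ᴾ 3) i) (trans (*-congˡ (proj₂ (degree-^ v 3 degree-v) i
            (ℕ.≤-trans (s≤s (ℕ.*-monoʳ-≤ 3 (ℕ.≤-pred degᵥ<2))) (ℕ.<⇒≤ (ℕ.<⇒≤ 6≤i))))) (zeroʳ _)))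

      degₜ = proj₁ t-monic
      degree-t : HasDegree t degₜ
      degree-t = proj₁ (proj₂ t-monic)

      degree-right : HasDegree (t ^ᴾ 2 *ᴾ target-cubic E′ u v) (2 ℕ.* degₜ ℕ.+ 6)
      degree-right = degree-* (t ^ᴾ 2) (target-cubic E′ u v) (degree-^ t 2 degree-t) degree-N

      degree-cubic : HasDegree (cubic E) 3
      degree-cubic = 1≉0 , λ { (suc zero) (s≤s ()) ; (suc (suc zero)) (s≤s (s≤s ())) ; (suc (suc (suc zero))) (s≤s (s≤s (s≤s ())))
                             ; (suc (suc (suc (suc i)))) _ → refl }

      -- Degrees of the two sides of the isogeny equation. Parity excludes `degᵥ` = 0, and with
      -- `degᵥ` = 1 the polynomials s and t have equal degree.
      degrees : ∀ {n} → HasDegree s n → 2 ℕ.* n ℕ.+ 3 ℕ.+ 3 ℕ.* degᵥ ≡ 2 ℕ.* degₜ ℕ.+ 6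
      degrees degree-s = degree-unique (t ^ᴾ 2 *ᴾ target-cubic E′ u v)
        (degree-cong (s ^ᴾ 2 *ᴾ cubic E *ᴾ v ^ᴾ 3) (t ^ᴾ 2 *ᴾ target-cubic E′ u v) equation
          (degree-* (s ^ᴾ 2 *ᴾ cubic E) (v ^ᴾ 3) (degree-* (s ^ᴾ 2) (cubic E) (degree-^ s 2 degree-s) degree-cubic) (degree-^ v 3 degree-v)))
        degree-right

      s-degree : ∃[ n ] HasDegree s n
      s-degree with zero⊎degree s
      ... | inj₂ d   = d
      ... | inj₁ s≈0 = contradiction (vanishing⇒zero (t ^ᴾ 2 *ᴾ target-cubic E′ u v) (λ x → begin
        eval (t ^ᴾ 2 *ᴾ target-cubic E′ u v) x  ≈⟨ eval-equationʳ E′ u v t x ⟩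
        T x ^ 2 * N x                           ≈⟨ eqn x ⟨
        S x ^ 2 * F x * V x ^ 3                 ≈⟨ *-congʳ (trans (*-congʳ (trans (*-congʳ (eval-zero s s≈0 x)) (zeroˡ _))) (zeroˡ _)) ⟩
        0# * V x ^ 3                            ≈⟨ zeroˡ _ ⟩
        0#                                      ∎) _) (proj₁ degree-right)

      degᵥ≡1 : degᵥ ≡ 1
      degᵥ≡1 = go degᵥ degᵥ<2 (degrees (proj₂ s-degree))
        where
        go : ∀ d → d ℕ.< 2 → 2 ℕ.* proj₁ s-degree ℕ.+ 3 ℕ.+ 3 ℕ.* d ≡ 2 ℕ.* degₜ ℕ.+ 6 → d ≡ 1
        go 0 _ eq = contradiction
          (≡.trans (ℕ.*-distribˡ-+ 2 degₜ 3) (≡.trans (≡.sym eq) (≡.trans (ℕ.+-identityʳ _)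
            (≡.trans (ℕ.+-suc (2 ℕ.* proj₁ s-degree) 2) (≡.cong suc (≡.sym (ℕ.*-distribˡ-+ 2 (proj₁ s-degree) 1)))))))
          (ℕ.even≢odd (degₜ ℕ.+ 3) (proj₁ s-degree ℕ.+ 1))
        go 1 _ _  = ≡.refl
        go (suc (suc _)) (s≤s (s≤s ())) _

      degree-v₁ : HasDegree v 1
      degree-v₁ = ≡.subst (HasDegree v) degᵥ≡1 degree-v

      degree-s : HasDegree s degₜ
      degree-s = ≡.subst (HasDegree s) (ℕ.*-cancelˡ-≡ (proj₁ s-degree) degₜ 2 (ℕ.+-cancelʳ-≡ 6 _ _
        (≡.trans (≡.sym (ℕ.+-assoc (2 ℕ.* proj₁ s-degree) 3 3)) (≡.subst (λ d → 2 ℕ.* proj₁ s-degree ℕ.+ 3 ℕ.+ 3 ℕ.* d ≡ 2 ℕ.* degₜ ℕ.+ 6) degᵥ≡1 (degrees (proj₂ s-degree))))))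
        (proj₂ s-degree)

    kernelRoot : ∣K∣
    kernelRoot = - coeff v 0

    private
      r = kernelRoot
      b = slope E r

      v₁≈1 : coeff v 1 ≈ 1#
      v₁≈1 = trans (reflexive (≡.cong (coeff v) (≡.sym (degree-unique v (proj₁ (proj₂ v-monic)) degree-v₁)))) (proj₂ (proj₂ v-monic))

      V≈ : ∀ x → V x ≈ x - r
      V≈ x = trans (eval-degree1 v degree-v₁ x)
        (solve 3 (λ x a b → (x by b := :1) ∷ [] ⊢ a :+ b :* x := x :- (:- a)) x (coeff v 0) (coeff v 1) v₁≈1)

      Vr≈0 : V r ≈ 0#
      Vr≈0 = trans (V≈ r) (-‿inverseʳ r)

      Ur≉0 : U r ≉ 0#
      Ur≉0 Ur≈0 = coprime⇒no-common-root u v r u-v-coprime Ur≈0 Vr≈0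

      Nr≉0 : N r ≉ 0#
      Nr≉0 = ≉0-resp (solve 4 (λ u v A B → (:- A :* u :* v :- B :* v :^ 2 by v := con 0) ∷ []
        ⊢ u :^ 3 := u :^ 3 :+ A :* (u :* v :^ 2) :+ B :* v :^ 3) (U r) (V r) (A E′) (B E′) Vr≈0) (^-≉0 3 Ur≉0)

      S≉0 : ∀ {x} → T x ≈ 0# → S x ≉ 0#
      S≉0 {x} Tx≈0 Sx≈0 = coprime⇒no-common-root s t x s-t-coprime Sx≈0 Tx≈0

      g : ∣K∣ → ∣K∣ → ∣K∣
      g ρ x = x ^ 2 + ρ * x + ρ ^ 2 + A E

      g-fun : ∀ ρ → PolynomialFunction (g ρ)
      g-fun ρ = ((power 2 identity ⊕ constant ρ ⊗ identity) ⊕ power 2 (constant ρ)) ⊕ constant (A E)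

      F-factor : ∀ ρ → Root E ρ → ∀ x → F x ≈ (x - ρ) * g ρ x
      F-factor ρ root x = solve 4 (λ x ρ A B → (:1 by :cubic A B ρ := con 0) ∷ []
        ⊢ :cubic A B x := (x :- ρ) :* (x :^ 2 :+ ρ :* x :+ ρ :^ 2 :+ A)) x ρ (A E) (B E) root

      g-slope : ∀ ρ → Root E ρ → g ρ ρ ≉ 0#
      g-slope ρ root = ≉0-resp (solve 2 (λ ρ A → [] ⊢ :slope A ρ := ρ :^ 2 :+ ρ :* ρ :+ ρ :^ 2 :+ A) ρ (A E)) (slope≉0 E ρ elliptic root)

      V-fun = evaluation v

      -- If V ρ ≉ 0, coprimality of s and t makes ρ a root of the cubic of E, and even a double one,
      -- since t² vanishes twice at ρ and s² v³ not at all. Ellipticity forbids this.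
      T-root⇒r : ∀ ρ → T ρ ≈ 0# → V ρ ≈ 0#
      T-root⇒r ρ Tρ≈0 with V ρ ≟ 0#
      ... | yes Vρ≈0 = Vρ≈0
      ... | no  Vρ≉0 = contradiction gρ≈0 (g-slope ρ root)
        where
        Q = quotient t ρ
        T≈ = factor t ρ Tρ≈0
        root : Root E ρ
        root = x*y≈0⇒y≈0 (*-≉0 (^-≉0 2 (S≉0 Tρ≈0)) (^-≉0 3 Vρ≉0))
          (solve 5 (λ s f v t n → (:1 by s :^ 2 :* f :* v :^ 3 := t :^ 2 :* n) ∷ (t :* n by t := con 0) ∷ [] ⊢ s :^ 2 :* v :^ 3 :* f := con 0)
            (S ρ) (F ρ) (V ρ) (T ρ) (N ρ) (eqn ρ) Tρ≈0)
        cancelled : ∀ x → S x ^ 2 * g ρ x * V x ^ 3 ≈ (x - ρ) * (eval Q x ^ 2 * N x)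
        cancelled = cancel-root ρ (power 2 S-fun ⊗ g-fun ρ ⊗ power 3 V-fun) ((identity ⊕ constant (- ρ)) ⊗ (power 2 (evaluation Q) ⊗ N-fun))
          (λ x → solve 8 (λ z s f g v t q n →
              (:- s :^ 2 :* v :^ 3 by f := z :* g) ∷ (:1 by s :^ 2 :* f :* v :^ 3 := t :^ 2 :* n) ∷ (n :* (t :+ z :* q) by t := z :* q) ∷ []
            ⊢ z :* (s :^ 2 :* g :* v :^ 3) := z :* (z :* (q :^ 2 :* n)))
            (x - ρ) (S x) (F x) (g ρ x) (V x) (T x) (eval Q x) (N x) (F-factor ρ root x) (eqn x) (T≈ x))
        gρ≈0 : g ρ ρ ≈ 0#
        gρ≈0 = x*y≈0⇒y≈0 (*-≉0 (^-≉0 2 (S≉0 Tρ≈0)) (^-≉0 3 Vρ≉0))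
          (solve 6 (λ s g v q n ρ → (:1 by s :^ 2 :* g :* v :^ 3 := (ρ :- ρ) :* (q :^ 2 :* n)) ∷ [] ⊢ s :^ 2 :* v :^ 3 :* g := con 0)
            (S ρ) (g ρ ρ) (V ρ) (eval Q ρ) (N ρ) ρ (cancelled ρ))

      Tr≈0 : T r ≈ 0#
      Tr≈0 = ^≈0⇒≈0 2 (x*y≈0⇒y≈0 Nr≉0 (solve 5 (λ s f v t n →
          (:- :1 by s :^ 2 :* f :* v :^ 3 := t :^ 2 :* n) ∷ (s :^ 2 :* f :* v :^ 2 by v := con 0) ∷ [] ⊢ n :* t :^ 2 := con 0)
        (S r) (F r) (V r) (T r) (N r) (eqn r) Vr≈0))

      t₁ t₂ : Poly
      t₁ = quotient t r
      t₂ = quotient t₁ r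
      T₁ = eval t₁
      T₂ = eval t₂
      x-r = identity ⊕ constant (- r)
      F-fun : PolynomialFunction F
      F-fun = (power 3 identity ⊕ constant (A E) ⊗ identity) ⊕ constant (B E)

      -- Factors X - r are cancelled one at a time. v³ supplies three of them, and as t² vanishes to
      -- even order while s and N do not vanish at r, the cubic of E must supply a fourth. So r is a
      -- root of E and t = (X - r)² t₂.
      step₁ : ∀ x → S x ^ 2 * F x * (x - r) ^ 2 ≈ (x - r) * (T₁ x ^ 2 * N x)
      step₁ = cancel-root r (power 2 S-fun ⊗ F-fun ⊗ power 2 x-r) (x-r ⊗ (power 2 (evaluation t₁) ⊗ N-fun))
        (λ x → solve 7 (λ z s f v t q n →
            (:- s :^ 2 :* f :* (v :^ 2 :+ v :* z :+ z :^ 2) by v := z)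
          ∷ (:1 by s :^ 2 :* f :* v :^ 3 := t :^ 2 :* n) ∷ (n :* (t :+ z :* q) by t := z :* q) ∷ []
          ⊢ z :* (s :^ 2 :* f :* z :^ 2) := z :* (z :* (q :^ 2 :* n)))
          (x - r) (S x) (F x) (V x) (T x) (T₁ x) (N x) (V≈ x) (eqn x) (factor t r Tr≈0 x))

      step₂ : ∀ x → S x ^ 2 * F x * (x - r) ≈ T₁ x ^ 2 * N x
      step₂ = cancel-root r (power 2 S-fun ⊗ F-fun ⊗ x-r) (power 2 (evaluation t₁) ⊗ N-fun)
        (λ x → trans (solve 3 (λ z s f → [] ⊢ z :* (s :^ 2 :* f :* z) := s :^ 2 :* f :* z :^ 2) (x - r) (S x) (F x)) (step₁ x))

      T₁r≈0 : T₁ r ≈ 0#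
      T₁r≈0 = ^≈0⇒≈0 2 (x*y≈0⇒y≈0 Nr≉0 (solve 5 (λ s f r t n →
          (:- :1 by s :^ 2 :* f :* (r :- r) := t :^ 2 :* n) ∷ [] ⊢ n :* t :^ 2 := con 0) (S r) (F r) r (T₁ r) (N r) (step₂ r)))

      step₃ : ∀ x → S x ^ 2 * F x ≈ (x - r) * (T₂ x ^ 2 * N x)
      step₃ = cancel-root r (power 2 S-fun ⊗ F-fun) (x-r ⊗ (power 2 (evaluation t₂) ⊗ N-fun))
        (λ x → solve 6 (λ z s f t q n →
            (:1 by s :^ 2 :* f :* z := t :^ 2 :* n) ∷ (n :* (t :+ z :* q) by t := z :* q) ∷ []
          ⊢ z :* (s :^ 2 :* f) := z :* (z :* (q :^ 2 :* n)))
          (x - r) (S x) (F x) (T₁ x) (T₂ x) (N x) (step₂ x) (factor t₁ r T₁r≈0 x))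

      root : Root E r
      root = x*y≈0⇒y≈0 (^-≉0 2 (S≉0 Tr≈0)) (trans (step₃ r) (trans (*-congʳ (-‿inverseʳ r)) (zeroˡ _)))

      step₄ : ∀ x → S x ^ 2 * g r x ≈ T₂ x ^ 2 * N x
      step₄ = cancel-root r (power 2 S-fun ⊗ g-fun r) (power 2 (evaluation t₂) ⊗ N-fun)
        (λ x → trans (solve 4 (λ z s f g → (:- s :^ 2 by f := z :* g) ∷ [] ⊢ z :* (s :^ 2 :* g) := s :^ 2 :* f)
          (x - r) (S x) (F x) (g r x) (F-factor r root x)) (step₃ x))

      T₂r≉0 : T₂ r ≉ 0#
      T₂r≉0 T₂r≈0 = *-≉0 (^-≉0 2 (S≉0 Tr≈0)) (g-slope r root) (trans (step₄ r) (trans (*-congʳ (trans (*-congʳ T₂r≈0) (zeroˡ _))) (zeroˡ _)))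

      T≈T₂ : ∀ x → T x ≈ (x - r) ^ 2 * T₂ x
      T≈T₂ x = trans (factor t r Tr≈0 x) (trans (*-congˡ (factor t₁ r T₁r≈0 x)) (solve 2 (λ z t → [] ⊢ z :* (z :* t) := z :^ 2 :* t) (x - r) (T₂ x)))

      T₂-rootless : ∀ ρ → T₂ ρ ≉ 0#
      T₂-rootless ρ T₂ρ≈0 = T₂r≉0 (trans (eval-congʳ t₂ (sym ρ≈r)) T₂ρ≈0)
        where
        ρ≈r : ρ ≈ r
        ρ≈r = x∙y⁻¹≈ε⇒x≈y _ _ (trans (sym (V≈ ρ)) (T-root⇒r ρ (trans (T≈T₂ ρ) (trans (*-congˡ T₂ρ≈0) (zeroʳ _)))))

      -- Any root of t₂ would be r by `T-root⇒r`, and t₂ does not vanish there; a rootless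
      -- polynomial over the closure is constant.
      degree-t₂ : HasDegree t₂ 0
      degree-t₂ with zero⊎degree t₂
      ... | inj₁ t₂≈0          = contradiction (eval-zero t₂ t₂≈0 r) T₂r≉0
      ... | inj₂ (zero , d)    = d
      ... | inj₂ (suc n , d)   = contradiction (proj₂ (closed t₂ n d)) (T₂-rootless _)

      κ = coeff t₂ 0

      square : Poly
      square = (r ^ 2 * κ) ∷ (- (ι 2 * r * κ)) ∷ κ ∷ []

      t≈ : t ≈ᴾ square
      t≈ = ≗⇒≈ᴾ t square (λ x → trans (T≈T₂ x) (trans (*-congˡ (eval-degree0 t₂ degree-t₂ x))
        (solve 3 (λ x r κ → [] ⊢ (x :- r) :^ 2 :* κ := r :^ 2 :* κ :+ x :* (:- (con 2 :* r :* κ) :+ x :* (κ :+ x :* con 0))) x r κ)))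

      degₜ≡2 : degₜ ≡ 2
      degₜ≡2 = degree-unique t degree-t (degree-cong square t (λ i → sym (t≈ i)) (proj₁ degree-t₂ , high))
        where
        high : ∀ i → 2 ℕ.< i → coeff square i ≈ 0#
        high (suc zero) (s≤s ())
        high (suc (suc zero)) (s≤s (s≤s ()))
        high (suc (suc (suc i))) _ = refl

      κ≈1 : κ ≈ 1#
      κ≈1 = trans (sym (t≈ 2)) (trans (reflexive (≡.cong (coeff t) (≡.sym degₜ≡2))) (proj₂ (proj₂ t-monic)))

      T₂≈1 : ∀ x → T₂ x ≈ 1#
      T₂≈1 x = trans (eval-degree0 t₂ degree-t₂ x) κ≈1

      S≈ = eval-degree2 s (≡.subst (HasDegree s) degₜ≡2 degree-s)
      U≈ = eval-degree2 u degree-u₂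

      S₀ S₁ S₂ U₀ U₁ U₂ : ∣K∣
      S₂ = coeff s 2
      S₁ = coeff s 1 + ι 2 * (coeff s 2 * r)
      S₀ = coeff s 0 + coeff s 1 * r + coeff s 2 * r ^ 2
      U₂ = coeff u 2
      U₁ = coeff u 1 + ι 2 * (coeff u 2 * r)
      U₀ = coeff u 0 + coeff u 1 * r + coeff u 2 * r ^ 2

      centred : ∀ a₀ a₁ a₂ ξ → a₀ + a₁ * (ξ + r) + a₂ * (ξ + r) ^ 2 ≈ a₂ * ξ ^ 2 + (a₁ + ι 2 * (a₂ * r)) * ξ + (a₀ + a₁ * r + a₂ * r ^ 2)
      centred a₀ a₁ a₂ ξ = solve 5 (λ a₀ a₁ a₂ ξ r → [] ⊢
        a₀ :+ a₁ :* (ξ :+ r) :+ a₂ :* (ξ :+ r) :^ 2 := a₂ :* ξ :^ 2 :+ (a₁ :+ con 2 :* (a₂ :* r)) :* ξ :+ (a₀ :+ a₁ :* r :+ a₂ :* r :^ 2)) a₀ a₁ a₂ ξ r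

      S-centred : ∀ ξ → S (ξ + r) ≈ S₂ * ξ ^ 2 + S₁ * ξ + S₀
      S-centred ξ = trans (S≈ (ξ + r)) (centred (coeff s 0) (coeff s 1) (coeff s 2) ξ)

      U-centred : ∀ ξ → U (ξ + r) ≈ U₂ * ξ ^ 2 + U₁ * ξ + U₀
      U-centred ξ = trans (U≈ (ξ + r)) (centred (coeff u 0) (coeff u 1) (coeff u 2) ξ)

      identity₀ : Identity S₂ S₁ S₀ U₂ U₁ U₀ (ι 3 * r) b (A E′) (B E′)
      identity₀ ξ = begin
        (S₂ * ξ ^ 2 + S₁ * ξ + S₀) ^ 2 * (ξ ^ 2 + ι 3 * r * ξ + b)
          ≈⟨ *-cong (^-congˡ 2 (S-centred ξ)) (solve 3 (λ ξ r A → [] ⊢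
               (ξ :+ r) :^ 2 :+ r :* (ξ :+ r) :+ r :^ 2 :+ A := ξ :^ 2 :+ con 3 :* r :* ξ :+ (:slope A r)) ξ r (A E)) ⟨
        S (ξ + r) ^ 2 * g r (ξ + r)
          ≈⟨ step₄ (ξ + r) ⟩
        T₂ (ξ + r) ^ 2 * N (ξ + r)
          ≈⟨ solve 2 (λ t n → ((t :+ :1) :* n by t := :1) ∷ [] ⊢ t :^ 2 :* n := n) (T₂ (ξ + r)) (N (ξ + r)) (T₂≈1 (ξ + r)) ⟩
        N (ξ + r)
          ≈⟨ +-cong (+-cong (^-congˡ 3 (U-centred ξ)) (*-congˡ (*-cong (U-centred ξ) (^-congˡ 2 V-centred)))) (*-congˡ (^-congˡ 3 V-centred)) ⟩
        (U₂ * ξ ^ 2 + U₁ * ξ + U₀) ^ 3 + A E′ * ((U₂ * ξ ^ 2 + U₁ * ξ + U₀) * ξ ^ 2) + B E′ * ξ ^ 3 ∎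
        where
        V-centred : V (ξ + r) ≈ ξ
        V-centred = trans (V≈ (ξ + r)) (solve 2 (λ ξ r → [] ⊢ ξ :+ r :- r := ξ) ξ r)

      U₂≉0 : U₂ ≉ 0#
      U₂≉0 = proj₁ degree-u₂

      S₂²≈U₂³ : S₂ ^ 2 ≈ U₂ ^ 3
      S₂²≈U₂³ = x∙y⁻¹≈ε⇒x≈y _ _ (Coefficients.c₆ identity₀)

    -- The leading coefficients satisfy S₂² = U₂³, so their quotient λ gives U₂ = λ² and S₂ = λ³. It
    -- is the δ of the Vélu form.
    multiplier : ∣K∣
    multiplier = S₂ * proj₁ (inverse U₂ U₂≉0)

    private
      λ′ = multiplier
      U₂⁻¹ = proj₁ (inverse U₂ U₂≉0)

      U₂≈ : U₂ ≈ λ′ ^ 2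
      U₂≈ = solve 3 (λ s u k → (:- k :^ 2 by s :^ 2 := u :^ 3) ∷ (:- u :* (u :* k :+ :1) by u :* k := :1) ∷ [] ⊢ u := (s :* k) :^ 2)
        S₂ U₂ U₂⁻¹ S₂²≈U₂³ (proj₂ (inverse U₂ U₂≉0))

      S₂≈ : S₂ ≈ λ′ ^ 3
      S₂≈ = solve 4 (λ s u k l → (:- s by u :* k := :1) ∷ (l by u := l :^ 2) ∷ (:- u by l := s :* k) ∷ [] ⊢ s := l :^ 3)
        S₂ U₂ U₂⁻¹ λ′ (proj₂ (inverse U₂ U₂≉0)) U₂≈ refl

      λ≉0 : λ′ ≉ 0#
      λ≉0 λ≈0 = U₂≉0 (trans U₂≈ (trans (*-congʳ λ≈0) (zeroˡ _)))

      μ = proj₁ (inverse λ′ λ≉0)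
      λμ≈1 : λ′ * μ ≈ 1#
      λμ≈1 = proj₂ (inverse λ′ λ≉0)

      -- Rescaling the target by μ = 1/λ turns the identity into the monic one.
      E″ : Weierstrass
      E″ = weierstrass (μ ^ 4 * A E′) (μ ^ 6 * B E′)

      scaling-μ : Scaling μ E′ E″
      scaling-μ = record { δ≉0 = invertible⇒≉0 (trans (*-comm μ λ′) λμ≈1) ; A-eq = refl ; B-eq = refl }

      open Scaling scaling-μ using (δ≉0; scaling-elliptic)

      μ²U₂≈1 : μ ^ 2 * U₂ ≈ 1#
      μ²U₂≈1 = solve 3 (λ u l m → (m :^ 2 by u := l :^ 2) ∷ (l :* m :+ :1 by l :* m := :1) ∷ [] ⊢ m :^ 2 :* u := :1) U₂ λ′ μ U₂≈ λμ≈1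

      μ³S₂≈1 : μ ^ 3 * S₂ ≈ 1#
      μ³S₂≈1 = solve 3 (λ s l m → (m :^ 3 by s := l :^ 3) ∷ ((l :* m) :^ 2 :+ l :* m :+ :1 by l :* m := :1) ∷ [] ⊢ m :^ 3 :* s := :1) S₂ λ′ μ S₂≈ λμ≈1

      identity₁ : Identity 1# (μ ^ 3 * S₁) (μ ^ 3 * S₀) 1# (μ ^ 2 * U₁) (μ ^ 2 * U₀) (ι 3 * r) b (μ ^ 4 * A E′) (μ ^ 6 * B E′)
      identity₁ ξ = solve 12 (λ S₂ S₁ S₀ U₂ U₁ U₀ a b α β ξ m →
          let s = S₂ :* ξ :^ 2 :+ S₁ :* ξ :+ S₀ ; u = U₂ :* ξ :^ 2 :+ U₁ :* ξ :+ U₀ ; G = ξ :^ 2 :+ a :* ξ :+ b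
              P = :1 :* ξ :^ 2 :+ m :^ 3 :* S₁ :* ξ :+ m :^ 3 :* S₀ ; p = m :^ 3 :* s
              Q = :1 :* ξ :^ 2 :+ m :^ 2 :* U₁ :* ξ :+ m :^ 2 :* U₀ ; q = m :^ 2 :* u in
          (m :^ 6 by s :^ 2 :* G := u :^ 3 :+ α :* (u :* ξ :^ 2) :+ β :* ξ :^ 3)
        ∷ (:- ξ :^ 2 :* (P :+ p) :* G by m :^ 3 :* S₂ := :1)
        ∷ (ξ :^ 2 :* (Q :^ 2 :+ Q :* q :+ q :^ 2 :+ m :^ 4 :* α :* ξ :^ 2) by m :^ 2 :* U₂ := :1) ∷ []
        ⊢ P :^ 2 :* G := Q :^ 3 :+ m :^ 4 :* α :* (Q :* ξ :^ 2) :+ m :^ 6 :* β :* ξ :^ 3)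
        S₂ S₁ S₀ U₂ U₁ U₀ (ι 3 * r) b (A E′) (B E′) ξ μ (identity₀ ξ) μ³S₂≈1 μ²U₂≈1

      U₀≉0 : U₀ ≉ 0#
      U₀≉0 = ≉0-resp (U≈ r) Ur≉0

      open MonicIdentity E r elliptic root (scaling-elliptic elliptic′) (*-≉0 (^-≉0 2 δ≉0) U₀≉0) identity₁

    degree2-isVelu : IsVelu kernelRoot multiplier E E′
    degree2-isVelu = record { root = root ; scaling = scaling-inverse (trans (*-comm μ λ′) λμ≈1)
      (record { δ≉0 = δ≉0 ; A-eq = sym α≈velu ; B-eq = sym β≈velu }) }

    degree2-form : HasVeluForm φ kernelRoot multiplier
    degree2-form = record
      { eval-u = λ x → trans (U≈ x) (solve 8 (λ x a₀ a₁ a₂ r b l m →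
            (l :^ 2 by m :^ 2 :* (a₀ :+ a₁ :* r :+ a₂ :* r :^ 2) := b)
          ∷ (l :^ 2 :* (x :- r) by m :^ 2 :* (a₁ :+ con 2 :* (a₂ :* r)) := r)
          ∷ ((x :- r) :^ 2 by a₂ := l :^ 2)
          ∷ (:- (l :* m :+ :1) :* ((a₀ :+ a₁ :* r :+ a₂ :* r :^ 2) :+ (a₁ :+ con 2 :* (a₂ :* r)) :* (x :- r)) by l :* m := :1) ∷ []
          ⊢ a₀ :+ a₁ :* x :+ a₂ :* x :^ 2 := l :^ 2 :* (x :^ 2 :- r :* x :+ b))
          x (coeff u 0) (coeff u 1) (coeff u 2) r b λ′ μ e≈b d≈r U₂≈ λμ≈1)
      ; eval-v = V≈
      ; eval-s = λ x → trans (S≈ x) (solve 8 (λ x a₀ a₁ a₂ r b l m →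
            (l :^ 3 by m :^ 3 :* (a₀ :+ a₁ :* r :+ a₂ :* r :^ 2) := :- b)
          ∷ (l :^ 3 :* (x :- r) by m :^ 3 :* (a₁ :+ con 2 :* (a₂ :* r)) := con 0)
          ∷ ((x :- r) :^ 2 by a₂ := l :^ 3)
          ∷ (:- ((l :* m) :^ 2 :+ l :* m :+ :1) :* ((a₀ :+ a₁ :* r :+ a₂ :* r :^ 2) :+ (a₁ :+ con 2 :* (a₂ :* r)) :* (x :- r)) by l :* m := :1) ∷ []
          ⊢ a₀ :+ a₁ :* x :+ a₂ :* x :^ 2 := l :^ 3 :* ((x :- r) :^ 2 :- b))
          x (coeff s 0) (coeff s 1) (coeff s 2) r b λ′ μ t₀≈-b t₁≈0 S₂≈ λμ≈1)
      ; eval-t = λ x → trans (T≈T₂ x) (trans (*-congˡ (T₂≈1 x)) (*-identityʳ _))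
      }

-- Edges over the prime field and their twists

module Twisting {c ℓ : Level} {p : ℕ} (p-prime : Prime p) (3<p : 3 < p) (K : AlgebraicClosure𝔽 c ℓ p) where
  open Context p-prime 3<p K
  open Curves p-prime 3<p K
  open VeluHomomorphism p-prime 3<p K
  open VeluIsogeny p-prime 3<p K
  open VeluForms p-prime 3<p K
  open Classification p-prime 3<p K

  ≅⇒scaling : ∀ {E E′} (α : E ≅ E′) → Scaling (_≅_.u α) E E′
  ≅⇒scaling α = record { δ≉0 = invertible⇒≉0 (_≅_.inv α) ; A-eq = _≅_.A-eq α ; B-eq = _≅_.B-eq α }

  scaling⇒≅ : ∀ {δ E E′} → InPrimeField δ → Scaling δ E E′ → E ≅ E′
  scaling⇒≅ {δ} δ∈ S = record
    { u = δ ; u⁻¹ = proj₁ δ⁻¹ ; u∈𝔽ₚ = δ∈ ; u⁻¹∈𝔽ₚ = inverse-∈ (proj₂ δ⁻¹) δ∈ ; inv = proj₂ δ⁻¹ ; A-eq = A-eq ; B-eq = B-eq }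
    where
    open Scaling S
    δ⁻¹ = inverse δ δ≉0

  isoMap≡scalePoint : ∀ {E E′} (α : E ≅ E′) P → isoMap α P ≡ scalePoint (_≅_.u α) P
  isoMap≡scalePoint α ∞         = ≡.refl
  isoMap≡scalePoint α (aff x y) = ≡.refl

  -- Adjacency without polynomials: two elements of a finite field subject to equations. In this
  -- form it can be dualised, twisted and searched for.
  record VeluOver𝔽ₚ (E E′ : Weierstrass) : Set (c Level.⊔ ℓ) where
    field
      r δ    : ∣K∣
      r∈     : InPrimeField r
      δ∈     : InPrimeField δ
      isVelu : IsVelu r δ E E′

  velu-dual : ∀ {E E′} → VeluOver𝔽ₚ E E′ → VeluOver𝔽ₚ E′ E
  velu-dual V = record
    { r∈ = *-∈ (^-∈ 2 δ∈) (-‿∈ (*-∈ (ι-∈ 2) r∈))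
    ; δ∈ = inverse-∈ (proj₂ k) (*-∈ (ι-∈ 2) δ∈)
    ; isVelu = isVelu-dual (proj₂ k) isVelu }
    where
    open VeluOver𝔽ₚ V
    k = inverse (ι 2 * δ) (*-≉0 2≉0 (Scaling.δ≉0 (IsVelu.scaling isVelu)))

  velu-respˡ : ∀ {E E₁ E′} → E ≅ E₁ → VeluOver𝔽ₚ E E′ → VeluOver𝔽ₚ E₁ E′
  velu-respˡ α V = record
    { r∈ = *-∈ (^-∈ 2 u∈𝔽ₚ) r∈ ; δ∈ = *-∈ δ∈ u⁻¹∈𝔽ₚ ; isVelu = isVelu-scaleˡ inv (≅⇒scaling α) isVelu }
    where
    open _≅_ α
    open VeluOver𝔽ₚ V

  velu-respʳ : ∀ {E E′ E₁} → E′ ≅ E₁ → VeluOver𝔽ₚ E E′ → VeluOver𝔽ₚ E E₁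
  velu-respʳ α V = record { r∈ = r∈ ; δ∈ = *-∈ (_≅_.u∈𝔽ₚ α) δ∈ ; isVelu = isVelu-scaleʳ (≅⇒scaling α) isVelu }
    where open VeluOver𝔽ₚ V

  module _ (e : Edge) where
    private
      E = curve (source e)
      E′ = curve (target e)
      elliptic = Vertex.elliptic (source e)
      elliptic′ = Vertex.elliptic (target e)

    abstract
      edgeRoot edgeScale : ∣K∣
      edgeRoot = kernelRoot elliptic elliptic′ (Edge.isogeny e) (degree-2 e)
      edgeScale = multiplier elliptic elliptic′ (Edge.isogeny e) (degree-2 e)

      edge-isVelu : IsVelu edgeRoot edgeScale E E′
      edge-isVelu = degree2-isVelu elliptic elliptic′ (Edge.isogeny e) (degree-2 e)

      edge-form : HasVeluForm (Edge.isogeny e) edgeRoot edgeScale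
      edge-form = degree2-form elliptic elliptic′ (Edge.isogeny e) (degree-2 e)

      edgeRoot∈ : InPrimeField edgeRoot
      edgeRoot∈ = HasVeluForm.root∈ edge-form (Scaling.δ≉0 (IsVelu.scaling edge-isVelu)) (over-𝔽ₚ e)

      edgeScale∈ : InPrimeField edgeScale
      edgeScale∈ = HasVeluForm.scale∈ edge-form (Scaling.δ≉0 (IsVelu.scaling edge-isVelu)) (over-𝔽ₚ e)

    edge-velu : VeluOver𝔽ₚ E E′
    edge-velu = record { r∈ = edgeRoot∈ ; δ∈ = edgeScale∈ ; isVelu = edge-isVelu }

  veluEdge : ∀ v w → VeluOver𝔽ₚ (curve v) (curve w) → Edge
  veluEdge v w V = record
    { source = v ; target = w ; isogeny = veluIsogeny elliptic isVelu ; degree-2 = veluIsogeny-degree elliptic isVelu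
    ; over-𝔽ₚ = veluIsogeny-over elliptic isVelu A∈𝔽ₚ r∈ δ∈ }
    where
    open Vertex v
    open VeluOver𝔽ₚ V

  adjacent⇒velu : ∀ {v w} → Adjacent v w → VeluOver𝔽ₚ (curve v) (curve w)
  adjacent⇒velu (e , inj₁ (s≅v , t≅w)) = velu-respʳ t≅w (velu-respˡ s≅v (edge-velu e))
  adjacent⇒velu (e , inj₂ (s≅w , t≅v)) = velu-dual (velu-respʳ t≅v (velu-respˡ s≅w (edge-velu e)))

  velu⇒adjacent : ∀ {v w} → VeluOver𝔽ₚ (curve v) (curve w) → Adjacent v w
  velu⇒adjacent {v} {w} V = veluEdge v w V , inj₁ (≅-refl , ≅-refl)

  veluVertex : ∀ v {E} → InPrimeField (A E) → InPrimeField (B E) → VeluOver𝔽ₚ (curve v) E → Vertex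
  veluVertex v {E} A∈ B∈ V = record
    { curve = E ; A∈𝔽ₚ = A∈ ; B∈𝔽ₚ = B∈
    ; elliptic = isVelu-elliptic elliptic ; supersingular = isVelu-supersingular elliptic supersingular }
    where
    open Vertex v
    open IsVelu (VeluOver𝔽ₚ.isVelu V)

  velu-∈ : ∀ {E r} → InPrimeField (A E) → InPrimeField r → InPrimeField (A (velu E r)) × InPrimeField (B (velu E r))
  velu-∈ A∈ r∈ = -‿∈ (+-∈ (*-∈ (ι-∈ 4) A∈) (*-∈ (ι-∈ 15) (^-∈ 2 r∈)))
               , -‿∈ (+-∈ (*-∈ (ι-∈ 8) (*-∈ A∈ r∈)) (*-∈ (ι-∈ 22) (^-∈ 3 r∈)))

  scalePoint-∘ : ∀ a b P → scalePoint a (scalePoint b P) ≈ₚ scalePoint (a * b) P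
  scalePoint-∘ a b ∞         = ∞
  scalePoint-∘ a b (aff x y) = aff (solve 3 (λ a b x → [] ⊢ a :^ 2 :* (b :^ 2 :* x) := (a :* b) :^ 2 :* x) a b x)
                                   (solve 3 (λ a b y → [] ⊢ a :^ 3 :* (b :^ 3 :* y) := (a :* b) :^ 3 :* y) a b y)

  scalePoint-congˡ : ∀ {a b} → a ≈ b → ∀ P → scalePoint a P ≈ₚ scalePoint b P
  scalePoint-congˡ a≈b ∞         = ∞
  scalePoint-congˡ a≈b (aff x y) = aff (*-congʳ (^-congˡ 2 a≈b)) (*-congʳ (^-congˡ 3 a≈b))

  scalePoint-1 : ∀ {a} → a ≈ 1# → ∀ P → scalePoint a P ≈ₚ P
  scalePoint-1 a≈1 ∞         = ∞
  scalePoint-1 a≈1 (aff x y) = aff (trans (*-congʳ (trans (^-congˡ 2 a≈1) (1^ 2))) (*-identityˡ x))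
                                   (trans (*-congʳ (trans (^-congˡ 3 a≈1) (1^ 3))) (*-identityˡ y))

  veluMap-scaling : ∀ {δ E E′} r → Scaling δ E E′ → ∀ P → veluMap E′ (δ ^ 2 * r) (scalePoint δ P) ≈ₚ scalePoint δ (veluMap E r P)
  veluMap-scaling r S ∞ = ∞
  veluMap-scaling {δ} {E} {E′} r S (aff x y) = go ((x - r) ≟ 0#)
    where
    open Scaling S
    go : Dec (x - r ≈ 0#) → veluMap E′ (δ ^ 2 * r) (aff (δ ^ 2 * x) (δ ^ 3 * y)) ≈ₚ scalePoint δ (veluMap E r (aff x y))
    go (yes ξ≈0) = ≈ₚ-reflexive (≡.trans
      (veluMap-kernel E′ (solve 3 (λ δ x r → (δ :^ 2 by x :- r := con 0) ∷ [] ⊢ δ :^ 2 :* x :- δ :^ 2 :* r := con 0) δ x r ξ≈0))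
      (≡.cong (scalePoint δ) (≡.sym (veluMap-kernel E {y = y} ξ≈0))))
    go (no ξ≉0) = ≈ₚ-trans
      (veluMap-affine E′ (solve 5 (λ δ δ⁻¹ x r k → ((x :- r) :* k :* (δ :* δ⁻¹ :+ :1) by δ :* δ⁻¹ := :1) ∷ (:1 by (x :- r) :* k := :1) ∷ []
        ⊢ (δ :^ 2 :* x :- δ :^ 2 :* r) :* (δ⁻¹ :^ 2 :* k) := :1) δ δ⁻¹ x r k δδ⁻¹≈1 ξk≈1))
      (≈ₚ-trans (aff
        (solve 7 (λ δ δ⁻¹ x r k A A′ → let b = :slope A r ; z = δ :* δ⁻¹ in
            (δ⁻¹ :^ 2 :* k by A′ := δ :^ 4 :* A) ∷ (δ :^ 2 :* b :* k :* (z :+ :1) by δ :* δ⁻¹ := :1) ∷ []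
          ⊢ δ :^ 2 :* x :+ (con 3 :* (δ :^ 2 :* r) :^ 2 :+ A′) :* (δ⁻¹ :^ 2 :* k) := δ :^ 2 :* (x :+ b :* k))
          δ δ⁻¹ x r k (A E) (A E′) A-eq δδ⁻¹≈1)
        (solve 7 (λ δ δ⁻¹ y r k A A′ → let b = :slope A r ; z = δ :* δ⁻¹ in
            (:- δ :^ 3 :* y :* δ⁻¹ :^ 4 :* k :^ 2 by A′ := δ :^ 4 :* A) ∷ (:- δ :^ 3 :* y :* b :* k :^ 2 :* (z :^ 3 :+ z :^ 2 :+ z :+ :1) by δ :* δ⁻¹ := :1) ∷ []
          ⊢ δ :^ 3 :* y :* (:1 :- (con 3 :* (δ :^ 2 :* r) :^ 2 :+ A′) :* (δ⁻¹ :^ 2 :* k) :^ 2) := δ :^ 3 :* (y :* (:1 :- b :* k :^ 2)))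
          δ δ⁻¹ y r k (A E) (A E′) A-eq δδ⁻¹≈1))
        (scalePoint-cong (≈ₚ-sym (veluMap-affine E ξk≈1))))
      where
      k = proj₁ (inverse (x - r) ξ≉0)
      ξk≈1 = proj₂ (inverse (x - r) ξ≉0)
      δ⁻¹ = proj₁ (inverse δ δ≉0)
      δδ⁻¹≈1 = proj₂ (inverse δ δ≉0)

  -- `apply` branches on its argument; its Vélu form reduces the claim to `veluMap-cong`.
  apply-cong : ∀ e {P Q} → P ≈ₚ Q → ⟦ e ⟧ P ≈ₚ ⟦ e ⟧ Q
  apply-cong e {P} {Q} P≈Q = ≈ₚ-trans (apply-form P) (≈ₚ-trans
    (scalePoint-cong (veluMap-cong (curve (source e)) (edgeRoot e) P≈Q)) (≈ₚ-sym (apply-form Q)))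
    where open HasVeluForm (edge-form e)

  j-* : ∀ E → IsElliptic E → jInv E * disc E ≈ ι 1728 * (ι 4 * A E ^ 3)
  j-* E elliptic = /-* elliptic

  scaling-j : ∀ {δ E E′} → IsElliptic E → Scaling δ E E′ → jInv E′ ≈ jInv E
  scaling-j {δ} {E} {E′} elliptic S = /-unique (scaling-elliptic elliptic) (trans (*-congˡ disc-eq)
    (solve 6 (λ j D δ A A′ k → (δ :^ 12 by j :* D := k :* (con 4 :* A :^ 3))
        ∷ (:- k :* con 4 :* (A′ :^ 2 :+ A′ :* (δ :^ 4 :* A) :+ (δ :^ 4 :* A) :^ 2) by A′ := δ :^ 4 :* A) ∷ []
      ⊢ j :* (δ :^ 12 :* D) := k :* (con 4 :* A′ :^ 3)) (jInv E) (disc E) δ (A E) (A E′) (ι 1728) (j-* E elliptic) A-eq))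
    where open Scaling S

  -- Any nonzero d is allowed: nonsquares serve for stacking and folding, but two curves with the
  -- same j-invariant are related by a d whose quadratic character is unknown. δ is a square root of
  -- d in the closure.
  module Twist (d : ∣K∣) (d∈ : InPrimeField d) (d≉0 : d ≉ 0#) where
    private
      δ = proj₁ (nth-root 2 d)
      δ²≈d : δ ^ 2 ≈ d
      δ²≈d = proj₂ (nth-root 2 d)
      d⁻¹ = proj₁ (inverse d d≉0)
      dd⁻¹≈1 : d * d⁻¹ ≈ 1#
      dd⁻¹≈1 = proj₂ (inverse d d≉0)
      δ≉0 : δ ≉ 0#
      δ≉0 δ≈0 = d≉0 (trans (sym δ²≈d) (trans (*-congʳ δ≈0) (zeroˡ _)))
      δ⁻¹ = proj₁ (inverse δ δ≉0)
      δδ⁻¹≈1 : δ * δ⁻¹ ≈ 1#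
      δδ⁻¹≈1 = proj₂ (inverse δ δ≉0)

    twistCurve : Weierstrass → Weierstrass
    twistCurve E = weierstrass (d ^ 2 * A E) (d ^ 3 * B E)

    twist-scaling : ∀ E → Scaling δ E (twistCurve E)
    twist-scaling E = record
      { δ≉0 = δ≉0
      ; A-eq = solve 3 (λ δ d a → (:- (δ :^ 2 :+ d) :* a by δ :^ 2 := d) ∷ [] ⊢ d :^ 2 :* a := δ :^ 4 :* a) δ d (A E) δ²≈d
      ; B-eq = solve 3 (λ δ d a → (:- (δ :^ 4 :+ δ :^ 2 :* d :+ d :^ 2) :* a by δ :^ 2 := d) ∷ [] ⊢ d :^ 3 :* a := δ :^ 6 :* a) δ d (B E) δ²≈d
      }

    twistVertex : Vertex → Vertex
    twistVertex v = record
      { curve = twistCurve E ; A∈𝔽ₚ = *-∈ (^-∈ 2 d∈) A∈𝔽ₚ ; B∈𝔽ₚ = *-∈ (^-∈ 3 d∈) B∈𝔽ₚ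
      ; elliptic = Scaling.scaling-elliptic (twist-scaling E) elliptic
      ; supersingular = scaling-supersingular′ (twist-scaling E) elliptic supersingular }
      where
      E = curve v
      open Vertex v using (A∈𝔽ₚ; B∈𝔽ₚ; elliptic; supersingular)

    twist-≅ : ∀ {E E′} → E ≅ E′ → twistCurve E ≅ twistCurve E′
    twist-≅ {E} {E′} α = record
      { u = u ; u⁻¹ = u⁻¹ ; u∈𝔽ₚ = u∈𝔽ₚ ; u⁻¹∈𝔽ₚ = u⁻¹∈𝔽ₚ ; inv = inv
      ; A-eq = solve 4 (λ d u a a′ → (d :^ 2 by a′ := u :^ 4 :* a) ∷ [] ⊢ d :^ 2 :* a′ := u :^ 4 :* (d :^ 2 :* a)) d u (A E) (A E′) A-eq
      ; B-eq = solve 4 (λ d u a a′ → (d :^ 3 by a′ := u :^ 6 :* a) ∷ [] ⊢ d :^ 3 :* a′ := u :^ 6 :* (d :^ 3 :* a)) d u (B E) (B E′) B-eq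
      }
      where open _≅_ α

    twist-twist : ∀ E → twistCurve (twistCurve E) ≅ E
    twist-twist E = ≅-sym (scaling⇒≅ d∈ (record
      { δ≉0 = d≉0
      ; A-eq = solve 2 (λ d a → [] ⊢ d :^ 2 :* (d :^ 2 :* a) := d :^ 4 :* a) d (A E)
      ; B-eq = solve 2 (λ d a → [] ⊢ d :^ 3 :* (d :^ 3 :* a) := d :^ 6 :* a) d (B E) }))

    -- Conjugation by the possibly irrational δ keeps the data rational: the root is multiplied by
    -- δ² = d, and in the scale factor δ and its inverse cancel.
    twist-velu : ∀ {E E′} → VeluOver𝔽ₚ E E′ → VeluOver𝔽ₚ (twistCurve E) (twistCurve E′)
    twist-velu {E} {E′} V = record
      { r∈ = *-∈ (∈-resp (sym δ²≈d) d∈) r∈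
      ; δ∈ = ∈-resp (solve 3 (λ x y a → (:- a by x :* y := :1) ∷ [] ⊢ a := x :* (a :* y)) δ δ⁻¹ V.δ δδ⁻¹≈1) V.δ∈
      ; isVelu = isVelu-scaleʳ (twist-scaling E′) (isVelu-scaleˡ δδ⁻¹≈1 (twist-scaling E) V.isVelu) }
      where
      module V = VeluOver𝔽ₚ V
      open V using (r∈)

    -- Built afresh as a Vélu edge instead of by conjugating the fractions of e; `apply-twist` shows
    -- that on points it is the conjugate by δ.
    twistEdge : Edge → Edge
    twistEdge e = veluEdge (twistVertex (source e)) (twistVertex (target e)) (twist-velu (edge-velu e))

    twistEdge-form : ∀ e → HasVeluForm (Edge.isogeny (twistEdge e)) (δ ^ 2 * edgeRoot e) (δ * (edgeScale e * δ⁻¹))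
    twistEdge-form e = veluIsogeny-form (Vertex.elliptic (twistVertex (source e))) (VeluOver𝔽ₚ.isVelu (twist-velu (edge-velu e)))

    apply-twist : ∀ e P → ⟦ twistEdge e ⟧ (scalePoint δ P) ≈ₚ scalePoint δ (⟦ e ⟧ P)
    apply-twist e P =
      ≈ₚ-trans (HasVeluForm.apply-form (twistEdge-form e) (scalePoint δ P))
      (≈ₚ-trans (scalePoint-cong (veluMap-scaling (edgeRoot e) (twist-scaling (curve (source e))) P))
      (≈ₚ-trans (scalePoint-∘ (δ * (edgeScale e * δ⁻¹)) δ Q)
      (≈ₚ-trans (scalePoint-congˡ (solve 3 (λ x y a → (a :* x by x :* y := :1) ∷ [] ⊢ x :* (a :* y) :* x := x :* a) δ δ⁻¹ (edgeScale e) δδ⁻¹≈1) Q)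
      (≈ₚ-trans (≈ₚ-sym (scalePoint-∘ δ (edgeScale e) Q))
      (scalePoint-cong (≈ₚ-sym (HasVeluForm.apply-form (edge-form e) P)))))))
      where Q = veluMap (curve (source e)) (edgeRoot e) P

    scale-∈ : ∀ E {P} → IsElliptic E → P ∈ₑ E → scalePoint δ P ∈ₑ twistCurve E
    scale-∈ E elliptic = IsHomomorphism.φ-∈ (Scaling.scaling-homomorphism (twist-scaling E) elliptic)

    private
      untwist : ∀ E {P} → IsElliptic (twistCurve E) → P ∈ₑ twistCurve E → ∃[ Q ] Q ∈ₑ E × P ≈ₚ scalePoint δ Q
      untwist E {P} elliptic P∈ = scalePoint δ⁻¹ P
        , IsHomomorphism.φ-∈ (Scaling.scaling-homomorphism (scaling-inverse δδ⁻¹≈1 (twist-scaling E)) elliptic) P∈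
        , ≈ₚ-sym (≈ₚ-trans (scalePoint-∘ δ δ⁻¹ P) (scalePoint-1 δδ⁻¹≈1 P))

      isoMap-twist : ∀ {E E′} (α : E ≅ E′) P → isoMap (twist-≅ α) (scalePoint δ P) ≈ₚ scalePoint δ (isoMap α P)
      isoMap-twist α ∞         = ∞
      isoMap-twist α (aff x y) = aff (solve 3 (λ a b c → [] ⊢ a :* (b :* c) := b :* (a :* c)) _ (δ ^ 2) x)
                                     (solve 3 (λ a b c → [] ⊢ a :* (b :* c) := b :* (a :* c)) _ (δ ^ 3) y)

      isoMap-cong : ∀ {E E′} (α : E ≅ E′) {P Q} → P ≈ₚ Q → isoMap α P ≈ₚ isoMap α Q
      isoMap-cong α ∞           = ∞
      isoMap-cong α (aff e₁ e₂) = aff (*-congˡ e₁) (*-congˡ e₂)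

    twist-isomorphic : ∀ {e f} → IsomorphicEdges e f → IsomorphicEdges (twistEdge e) (twistEdge f)
    twist-isomorphic {e} {f} I = record { α = twist-≅ α ; β = twist-≅ β ; commute = commute′ }
      where
      open IsomorphicEdges I
      commute′ : ∀ P → P ∈ₑ twistCurve (curve (source e)) →
                 isoMap (twist-≅ β) (⟦ twistEdge e ⟧ P) ≈ₚ ⟦ twistEdge f ⟧ (isoMap (twist-≅ α) P)
      commute′ P P∈ =
        ≈ₚ-trans (isoMap-cong (twist-≅ β) (≈ₚ-trans (apply-cong (twistEdge e) P≈) (apply-twist e Q)))
        (≈ₚ-trans (isoMap-twist β (⟦ e ⟧ Q))
        (≈ₚ-trans (scalePoint-cong (commute Q Q∈))
        (≈ₚ-trans (≈ₚ-sym (apply-twist f (isoMap α Q)))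
        (apply-cong (twistEdge f) (≈ₚ-sym (≈ₚ-trans (isoMap-cong (twist-≅ α) P≈) (isoMap-twist α Q)))))))
        where
        untwisted = untwist (curve (source e)) (Vertex.elliptic (twistVertex (source e))) P∈
        Q = proj₁ untwisted
        Q∈ = proj₁ (proj₂ untwisted)
        P≈ = proj₂ (proj₂ untwisted)

    twist-dual : ∀ {e f} → DualEdges e f → DualEdges (twistEdge e) (twistEdge f)
    twist-dual {e} {f} D = record { α = twist-≅ α ; β = twist-≅ β ; dual = dual′ }
      where
      open DualEdges D
      E = curve (source e)
      elliptic = Vertex.elliptic (source e)
      elliptic′ = Vertex.elliptic (twistVertex (source e))
      dual′ : ∀ P → P ∈ₑ twistCurve E →
              isoMap (twist-≅ β) (⟦ twistEdge f ⟧ (isoMap (twist-≅ α) (⟦ twistEdge e ⟧ P))) ≈ₚ mult (twistCurve E) 2 P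
      dual′ P P∈ =
        ≈ₚ-trans (isoMap-cong (twist-≅ β) (≈ₚ-trans (apply-cong (twistEdge f)
          (≈ₚ-trans (isoMap-cong (twist-≅ α) (≈ₚ-trans (apply-cong (twistEdge e) P≈) (apply-twist e Q))) (isoMap-twist α (⟦ e ⟧ Q))))
          (apply-twist f (isoMap α (⟦ e ⟧ Q)))))
        (≈ₚ-trans (isoMap-twist β (⟦ f ⟧ (isoMap α (⟦ e ⟧ Q))))
        (≈ₚ-trans (scalePoint-cong (dual Q Q∈))
        (≈ₚ-trans (IsHomomorphism.φ-mult (Scaling.scaling-homomorphism (twist-scaling E) elliptic) elliptic′ 2 Q∈)
        (mult2-cong (≈ₚ-sym P≈)))))
        where
        untwisted = untwist E elliptic′ P∈
        Q = proj₁ untwisted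
        Q∈ = proj₁ (proj₂ untwisted)
        P≈ = proj₂ (proj₂ untwisted)
        mult2-cong : scalePoint δ Q ≈ₚ P → mult (twistCurve E) 2 (scalePoint δ Q) ≈ₚ mult (twistCurve E) 2 P
        mult2-cong δQ≈P = add-cong (twistCurve E) elliptic′ (scale-∈ E elliptic Q∈) (add-∈ (twistCurve E) (scale-∈ E elliptic Q∈) ∞) δQ≈P
          (add-cong (twistCurve E) elliptic′ (scale-∈ E elliptic Q∈) ∞ δQ≈P ∞)

    twist-twist-edge : ∀ e → IsomorphicEdges (twistEdge (twistEdge e)) e
    twist-twist-edge e = record { α = twist-twist (curve (source e)) ; β = twist-twist (curve (target e)) ; commute = commute }
      where
      E = curve (source e)
      T = twistVertex (source e)
      shrink : ∀ {E₁} Q → isoMap (twist-twist E₁) (scalePoint δ (scalePoint δ Q)) ≈ₚ Q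
      shrink {E₁} Q = ≈ₚ-trans (≈ₚ-reflexive (isoMap≡scalePoint (twist-twist E₁) _))
        (≈ₚ-trans (scalePoint-∘ d⁻¹ δ _) (≈ₚ-trans (scalePoint-∘ (d⁻¹ * δ) δ Q)
          (scalePoint-1 (solve 3 (λ d d⁻¹ δ → (d⁻¹ by δ :^ 2 := d) ∷ (:1 by d :* d⁻¹ := :1) ∷ [] ⊢ d⁻¹ :* δ :* δ := :1) d d⁻¹ δ δ²≈d dd⁻¹≈1) Q)))
      commute : ∀ P → P ∈ₑ twistCurve (twistCurve E) →
                isoMap (twist-twist (curve (target e))) (⟦ twistEdge (twistEdge e) ⟧ P) ≈ₚ ⟦ e ⟧ (isoMap (twist-twist E) P)
      commute P P∈ =
        ≈ₚ-trans (isoMap-cong (twist-twist (curve (target e))) (≈ₚ-trans (apply-cong (twistEdge (twistEdge e)) P≈δδR)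
          (≈ₚ-trans (apply-twist (twistEdge e) (scalePoint δ R)) (scalePoint-cong (apply-twist e R)))))
        (≈ₚ-trans (shrink {curve (target e)} (⟦ e ⟧ R))
        (apply-cong e (≈ₚ-sym (≈ₚ-trans (isoMap-cong (twist-twist E) P≈δδR) (shrink {E} R)))))
        where
        untwisted = untwist (twistCurve E) (Vertex.elliptic (twistVertex T)) P∈
        untwisted² = untwist E (Vertex.elliptic T) (proj₁ (proj₂ untwisted))
        R = proj₁ untwisted²
        P≈ = proj₂ (proj₂ untwisted)
        Q≈ = proj₂ (proj₂ untwisted²)
        P≈δδR : P ≈ₚ scalePoint δ (scalePoint δ R)
        P≈δδR = ≈ₚ-trans P≈ (scalePoint-cong Q≈)

    j-twist : ∀ v → j (twistVertex v) ≈ j v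
    j-twist v = scaling-j (Vertex.elliptic v) (twist-scaling (curve v))

-- Paths whose intermediate nodes are taken from a list, by Warshall's recursion.
module Paths {a r} {A : Set a} {R : A → A → Set r} (R? : Decidable R) where

  Path : List A → A → A → Set r
  Path []       x y = R x y
  Path (m ∷ ms) x y = Path ms x y ⊎ (Path ms x m × Path ms m y)

  path? : ∀ ms x y → Dec (Path ms x y)
  path? []       x y = R? x y
  path? (m ∷ ms) x y = path? ms x y ⊎-dec (path? ms x m ×-dec path? ms m y)

  step : ∀ ms {x y} → R x y → Path ms x y
  step []       xRy = xRy
  step (m ∷ ms) xRy = inj₁ (step ms xRy)

  -- A path in this sense passes through each listed node at most once at its level, so loops have
  -- to be cut: at m itself when m heads the list, and the detour from n through m back to n in the
  -- last case.
  Path-trans : ∀ {ms x m y} → m ∈ ms → Path ms x m → Path ms m y → Path ms x y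
  Path-trans {m ∷ ms} (here ≡.refl) xm my = inj₂ ([ (λ h → h) , proj₁ ]′ xm , [ (λ h → h) , proj₂ ]′ my)
  Path-trans (there m∈) (inj₁ xm)        (inj₁ my)        = inj₁ (Path-trans m∈ xm my)
  Path-trans (there m∈) (inj₁ xm)        (inj₂ (mn , ny)) = inj₂ (Path-trans m∈ xm mn , ny)
  Path-trans (there m∈) (inj₂ (xn , nm)) (inj₁ my)        = inj₂ (xn , Path-trans m∈ nm my)
  Path-trans (there m∈) (inj₂ (xn , nm)) (inj₂ (mn , ny)) = inj₂ (xn , ny)

-- Decidable connectedness; stacking and folding

module Components {c ℓ : Level} {p : ℕ} (p-prime : Prime p) (3<p : 3 < p) (K : AlgebraicClosure𝔽 c ℓ p) where
  open Context p-prime 3<p K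
  open SupersingularGraphs p K using () renaming (_∈_ to _∈ᶜ_)
  open Curves p-prime 3<p K
  open VeluHomomorphism p-prime 3<p K
  open VeluIsogeny p-prime 3<p K
  open Twisting p-prime 3<p K

  ≅⇒connected : ∀ {v w} → v ≈ᵛ w → Connected v w
  ≅⇒connected α = EqC.return (inj₁ α)

  adjacent⇒connected : ∀ {v w} → Adjacent v w → Connected v w
  adjacent⇒connected adj = EqC.return (inj₂ adj)

  connected-trans : ∀ {u v w} → Connected u v → Connected v w → Connected u w
  connected-trans = EqC.transitive _

  connected-sym : ∀ {v w} → Connected v w → Connected w v
  connected-sym = EqC.symmetric _

  private
    root? : ∀ E r → Dec (Root E r)
    root? E r = (r ^ 3 + A E * r + B E) ≟ 0#

    scaling? : ∀ δ E E′ → Dec (Scaling δ E E′)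
    scaling? δ E E′ = map′ (λ (δ≉0 , A-eq , B-eq) → record { δ≉0 = δ≉0 ; A-eq = A-eq ; B-eq = B-eq })
                           (λ S → Scaling.δ≉0 S , Scaling.A-eq S , Scaling.B-eq S)
                           (¬? (δ ≟ 0#) ×-dec ((A E′ ≟ (δ ^ 4 * A E)) ×-dec (B E′ ≟ (δ ^ 6 * B E))))

    scaling-resp : ∀ {δ δ′ E E′} → δ ≈ δ′ → Scaling δ E E′ → Scaling δ′ E E′
    scaling-resp δ≈δ′ S = record
      { δ≉0 = ≉0-resp δ≈δ′ δ≉0 ; A-eq = trans A-eq (*-congʳ (^-congˡ 4 δ≈δ′)) ; B-eq = trans B-eq (*-congʳ (^-congˡ 6 δ≈δ′)) }
      where open Scaling S

    isVelu-resp : ∀ {r r′ δ E E′} → r ≈ r′ → IsVelu r δ E E′ → IsVelu r′ δ E E′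
    isVelu-resp {r} {r′} {δ} {E} r≈r′ V = record
      { root = trans (+-congʳ (+-cong (^-congˡ 3 (sym r≈r′)) (*-congˡ (sym r≈r′)))) root
      ; scaling = record
        { δ≉0 = δ≉0
        ; A-eq = trans A-eq (*-congˡ (-‿cong (+-congˡ (*-congˡ (^-congˡ 2 r≈r′)))))
        ; B-eq = trans B-eq (*-congˡ (-‿cong (+-cong (*-congˡ (*-congˡ r≈r′)) (*-congˡ (^-congˡ 3 r≈r′))))) } }
      where
      open IsVelu V
      open Scaling scaling

    isVelu? : ∀ r δ E E′ → Dec (IsVelu r δ E E′)
    isVelu? r δ E E′ = map′ (λ (root , scaling) → record { root = root ; scaling = scaling })
                            (λ V → IsVelu.root V , IsVelu.scaling V)
                            (root? E r ×-dec scaling? δ (velu E r) E′)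

  -- Relates bare curves, so the search through `models` never tests supersingularity; `lift-path`
  -- restores it from the starting vertex.
  Step : Weierstrass → Weierstrass → Set (c Level.⊔ ℓ)
  Step E E′ = E ≅ E′ ⊎ VeluOver𝔽ₚ E E′

  step? : Decidable Step
  step? E E′ =
    map′ (λ (δ , δ∈ , S) → scaling⇒≅ δ∈ S) (λ α → _≅_.u α , _≅_.u∈𝔽ₚ α , ≅⇒scaling α)
         (∃𝔽ₚ? scaling-resp (λ δ → scaling? δ E E′))
    ⊎-dec
    map′ (λ (r , r∈ , δ , δ∈ , V) → record { r∈ = r∈ ; δ∈ = δ∈ ; isVelu = V })
         (λ V → let open VeluOver𝔽ₚ V in r , r∈ , δ , δ∈ , isVelu)
         (∃𝔽ₚ? (λ r≈r′ (δ , δ∈ , V) → δ , δ∈ , isVelu-resp r≈r′ V)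
           (λ r → ∃𝔽ₚ? (λ δ≈δ′ V → record { root = IsVelu.root V ; scaling = scaling-resp δ≈δ′ (IsVelu.scaling V) })
             (λ δ → isVelu? r δ E E′)))

  open Paths step?

  models : List Weierstrass
  models = cartesianProductWith weierstrass (applyUpTo ι p) (applyUpTo ι p)

  Defined : Weierstrass → Set ℓ
  Defined E = InPrimeField (A E) × InPrimeField (B E)

  models-defined : All Defined models
  models-defined = All.tabulate (λ E∈ → defined (∈-cartesianProductWith⁻ weierstrass (applyUpTo ι p) (applyUpTo ι p) E∈))
    where
    in-field : ∀ {x} → x ∈ applyUpTo ι p → InPrimeField x
    in-field x∈ with n , _ , ≡.refl ← ∈-applyUpTo⁻ ι x∈ = ι-∈ n
    defined : ∀ {E} → (∃[ a ] ∃[ b ] a ∈ applyUpTo ι p × b ∈ applyUpTo ι p × E ≡ weierstrass a b) → Defined E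
    defined (a , b , a∈ , b∈ , ≡.refl) = in-field a∈ , in-field b∈

  model : Vertex → Weierstrass
  model v = weierstrass (ι (toℕ (residue (Vertex.A∈𝔽ₚ v)))) (ι (toℕ (residue (Vertex.B∈𝔽ₚ v))))

  model∈ : ∀ v → model v ∈ models
  model∈ v = ∈-cartesianProductWith⁺ weierstrass (∈-applyUpTo⁺ ι (toℕ<n (residue (Vertex.A∈𝔽ₚ v)))) (∈-applyUpTo⁺ ι (toℕ<n (residue (Vertex.B∈𝔽ₚ v))))

  model-≅ : ∀ v → curve v ≅ model v
  model-≅ v = scaling⇒≅ 1-∈ (record
    { δ≉0 = 1≉0
    ; A-eq = trans (sym (ι-residue (Vertex.A∈𝔽ₚ v))) (sym (trans (*-congʳ (1^ 4)) (*-identityˡ _)))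
    ; B-eq = trans (sym (ι-residue (Vertex.B∈𝔽ₚ v))) (sym (trans (*-congʳ (1^ 6)) (*-identityˡ _))) })

  isomorphicVertex : ∀ v {E} → Defined E → curve v ≅ E → Vertex
  isomorphicVertex v {E} (A∈ , B∈) α = record
    { curve = E ; A∈𝔽ₚ = A∈ ; B∈𝔽ₚ = B∈
    ; elliptic = Scaling.scaling-elliptic (≅⇒scaling α) elliptic
    ; supersingular = scaling-supersingular′ (≅⇒scaling α) elliptic supersingular }
    where open Vertex v using (elliptic; supersingular)

  -- Supersingularity propagates along paths.
  lift-path : ∀ {ms E E′} → All Defined ms → Defined E′ → Path ms E E′ →
              ∀ v → curve v ≅ E → ∃[ w ] curve w ≡ E′ × Connected v w
  lift-path [] E′∈ (inj₁ E≅E′) v α = isomorphicVertex v E′∈ (≅-trans α E≅E′) , ≡.refl , ≅⇒connected (≅-trans α E≅E′)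
  lift-path [] (A∈ , B∈) (inj₂ V) v α =
    w , ≡.refl , adjacent⇒connected (velu⇒adjacent {v} {w} V′)
    where
    V′ = velu-respˡ (≅-sym α) V
    w = veluVertex v A∈ B∈ V′
  lift-path (_  ∷ ms∈) E′∈ (inj₁ path) v α = lift-path ms∈ E′∈ path v α
  lift-path (m∈ ∷ ms∈) E′∈ (inj₂ (path , path′)) v α
    with u , ≡.refl , v~u ← lift-path ms∈ m∈ path v α
    with w , eq , u~w ← lift-path ms∈ E′∈ path′ u ≅-refl = w , eq , connected-trans v~u u~w

  connected⇒path : ∀ {v w} → Connected v w → Path models (model v) (model w)
  connected⇒path {v} Star.ε = step models (inj₁ ≅-refl)
  connected⇒path {v} (_◅_ {j = u} s rest) = Path-trans (model∈ u) (step models (first s)) (connected⇒path rest)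
    where
    forward : ∀ {v w} → v ≈ᵛ w ⊎ Adjacent v w → Step (model v) (model w)
    forward {v} {w} (inj₁ α)   = inj₁ (≅-trans (≅-sym (model-≅ v)) (≅-trans α (model-≅ w)))
    forward {v} {w} (inj₂ adj) = inj₂ (velu-respʳ (model-≅ w) (velu-respˡ (model-≅ v) (adjacent⇒velu {v} {w} adj)))
    backward : ∀ {v w} → w ≈ᵛ v ⊎ Adjacent w v → Step (model v) (model w)
    backward {v} {w} (inj₁ α)   = forward {v} {w} (inj₁ (≅-sym α))
    backward {v} {w} (inj₂ adj) = inj₂ (velu-respʳ (model-≅ w) (velu-respˡ (model-≅ v) (velu-dual (adjacent⇒velu {w} {v} adj))))
    first : SymClosure (λ v w → v ≈ᵛ w ⊎ Adjacent v w) v u → Step (model v) (model u)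
    first (fwd s) = forward {v} {u} s
    first (bwd s) = backward {v} {u} s

  path⇒connected : ∀ {v w} → Path models (model v) (model w) → Connected v w
  path⇒connected {v} {w} path
    with u , eq , v~u ← lift-path models-defined (All.lookup models-defined (model∈ w)) path v (model-≅ v) =
    connected-trans v~u (≅⇒connected (≡.subst (_≅ curve w) (≡.sym eq) (≅-sym (model-≅ w))))

  connected? : ∀ v w → Dec (Connected v w)
  connected? v w = map′ path⇒connected connected⇒path (path? models (model v) (model w))

  module _ (d : ∣K∣) (d∈ : InPrimeField d) (d≉0 : d ≉ 0#) where
    open Twist d d∈ d≉0

    twist-adjacent : ∀ {v w} → Adjacent v w → Adjacent (twistVertex v) (twistVertex w)
    twist-adjacent {v} {w} adj = velu⇒adjacent {twistVertex v} {twistVertex w} (twist-velu (adjacent⇒velu {v} {w} adj))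

    twist-connected : ∀ {v w} → Connected v w → Connected (twistVertex v) (twistVertex w)
    twist-connected = EqC.gmap twistVertex λ where
      (inj₁ α)   → inj₁ (twist-≅ α)
      {v} {w} (inj₂ adj) → inj₂ (twist-adjacent {v} {w} adj)

    private
      module Edges = Setoid edgeSetoid

      twistEdge-cong : ∀ {e f} → e Edges.≈ f → twistEdge e Edges.≈ twistEdge f
      twistEdge-cong = EqC.gmap twistEdge (λ {e} {f} → twist-generator e f)
        where
        twist-generator : ∀ e f → IsomorphicEdges e f ⊎ DualEdges e f →
                          IsomorphicEdges (twistEdge e) (twistEdge f) ⊎ DualEdges (twistEdge e) (twistEdge f)
        twist-generator e f (inj₁ I) = inj₁ (twist-isomorphic {e} {f} I)
        twist-generator e f (inj₂ D) = inj₂ (twist-dual {e} {f} D)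

      twist-twistEdge : ∀ e → twistEdge (twistEdge e) Edges.≈ e
      twist-twistEdge e = EqC.return (inj₁ (twist-twist-edge e))

      inverse′ : ∀ {e f} → f Edges.≈ twistEdge e → twistEdge f Edges.≈ e
      inverse′ {e} {f} eq = Edges.trans {twistEdge f} {twistEdge (twistEdge e)} {e} (twistEdge-cong {f} {twistEdge e} eq) (twist-twistEdge e)

      untwist-∈ : ∀ {v V} → v ∈ᶜ twistVertex V → twistVertex v ∈ᶜ V
      untwist-∈ {V = V} v∈ = connected-trans (twist-connected v∈) (≅⇒connected (twist-twist (curve V)))

    -- Twisting twice by d is isomorphic to the identity, on vertices and on edges, so the same
    -- operation serves in both directions.
    twist-isomorphism : ∀ V → LabelledIsomorphism V (twistVertex V)
    twist-isomorphism V = record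
      { vertices = record
        { to = λ (v , v∈) → twistVertex v , twist-connected v∈
        ; from = λ (v , v∈) → twistVertex v , untwist-∈ v∈
        ; to-cong = twist-≅
        ; from-cong = twist-≅
        ; inverse = (λ {v} α → ≅-trans (twist-≅ α) (twist-twist (curve (proj₁ v))))
                  , (λ {v} α → ≅-trans (twist-≅ α) (twist-twist (curve (proj₁ v)))) }
      ; edges = record
        { to = λ (e , s∈ , t∈) → twistEdge e , twist-connected s∈ , twist-connected t∈
        ; from = λ (e , s∈ , t∈) → twistEdge e , untwist-∈ s∈ , untwist-∈ t∈
        ; to-cong = λ {x} {y} eq → twistEdge-cong {proj₁ x} {proj₁ y} eq
        ; from-cong = λ {x} {y} eq → twistEdge-cong {proj₁ x} {proj₁ y} eq
        ; inverse = (λ {x} {y} eq → inverse′ {proj₁ x} {proj₁ y} eq) , (λ {x} {y} eq → inverse′ {proj₁ x} {proj₁ y} eq) }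
      ; labels = λ (v , _) → j-twist v
      ; incidence = λ e s∈ t∈ → inj₁ (≅-refl , ≅-refl)
      }

  stacks-or-folds : ∀ V → (∃[ W ] Stack V W) ⊎ Folds V
  stacks-or-folds V = decide (connected? V Vᵗ)
    where
    nonsquare = ∃-nonsquare (ℕ.<-trans (ℕ.n<1+n 2) 3<p)
    d = proj₁ nonsquare
    d∈ = proj₁ (proj₂ nonsquare)
    d≉0 : d ≉ 0#
    d≉0 d≈0 = proj₂ (proj₂ nonsquare) 0# 0-∈ (trans (zeroˡ _) (sym d≈0))
    open Twist d d∈ d≉0
    Vᵗ = twistVertex V
    decide : Dec (Connected V Vᵗ) → (∃[ W ] Stack V W) ⊎ Folds V
    decide (no  distinct) = inj₁ (Vᵗ , distinct , twist-isomorphism d d∈ d≉0 V)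
    decide (yes V~Vᵗ)     = inj₂ (λ v v∈ → twistVertex v , (d , d∈ , proj₂ (proj₂ nonsquare) , ≅-refl)
                              , connected-trans (twist-connected d d∈ d≉0 v∈) (connected-sym V~Vᵗ))

-- No attachment along a j-invariant

module Attachments {c ℓ : Level} {p : ℕ} (p-prime : Prime p) (3<p : 3 < p) (K : AlgebraicClosure𝔽 c ℓ p) where
  open Context p-prime 3<p K
  open Curves p-prime 3<p K
  open VeluHomomorphism p-prime 3<p K
  open VeluIsogeny p-prime 3<p K
  open Classification p-prime 3<p K
  open Twisting p-prime 3<p K
  open Components p-prime 3<p K using (twist-adjacent)

  -- Equality of j-invariants, with denominators cleared.
  SameJ : Weierstrass → Weierstrass → Set ℓ
  SameJ E E′ = A E ^ 3 * B E′ ^ 2 ≈ A E′ ^ 3 * B E ^ 2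

  -- Cross-multiplying j · disc = 1728 · 4A³ for the two curves produces the factor 1728 · 4 · 27 =
  -- 2⁸ · 3⁶, invertible as p > 3.
  j⇒sameJ : ∀ E E′ → IsElliptic E → IsElliptic E′ → jInv E ≈ jInv E′ → SameJ E E′
  j⇒sameJ E E′ elliptic elliptic′ j≈j′ = *-cancelˡ-≉0 (*-≉0 (^-≉0 8 2≉0) (^-≉0 6 3≉0))
    (solve 6 (λ j j′ A B A′ B′ → let D = :disc A B ; D′ = :disc A′ B′ in
        (:- D′ by j :* D := con 1728 :* (con 4 :* A :^ 3)) ∷ (D by j′ :* D′ := con 1728 :* (con 4 :* A′ :^ 3)) ∷ (D :* D′ by j := j′) ∷ []
      ⊢ con 2 :^ 8 :* con 3 :^ 6 :* (A :^ 3 :* B′ :^ 2) := con 2 :^ 8 :* con 3 :^ 6 :* (A′ :^ 3 :* B :^ 2))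
      (jInv E) (jInv E′) (A E) (B E) (A E′) (B E′) (j-* E elliptic) (j-* E′ elliptic′) j≈j′)

  sameJ⇒j : ∀ E E′ → IsElliptic E → IsElliptic E′ → SameJ E E′ → jInv E ≈ jInv E′
  sameJ⇒j E E′ elliptic elliptic′ same = /-unique elliptic (*-cancelˡ-≉0 elliptic′
    (solve 5 (λ j′ A B A′ B′ → let D = :disc A B ; D′ = :disc A′ B′ in
        (D by j′ :* D′ := con 1728 :* (con 4 :* A′ :^ 3)) ∷ (:- con 186624 by A :^ 3 :* B′ :^ 2 := A′ :^ 3 :* B :^ 2) ∷ []
      ⊢ D′ :* (j′ :* D) := D′ :* (con 1728 :* (con 4 :* A :^ 3)))
      (jInv E′) (A E) (B E) (A E′) (B E′) (j-* E′ elliptic′) same))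

  isVelu-j : ∀ {r δ E E′} → IsElliptic E → IsVelu r δ E E′ → jInv E′ ≈ jInv (velu E r)
  isVelu-j elliptic V = scaling-j (velu-elliptic _ _ elliptic root) scaling
    where open IsVelu V

  velu-sameJ : ∀ {E E′ r r′} → IsElliptic E → IsElliptic E′ → Root E r → Root E′ r′ →
               SameJ (velu E r) (velu E′ r′) → jInv (velu E r) ≈ jInv (velu E′ r′)
  velu-sameJ elliptic elliptic′ root root′ = sameJ⇒j _ _ (velu-elliptic _ _ elliptic root) (velu-elliptic _ _ elliptic′ root′)

  -- The neighbours of j = 0 all have j = 54000, those of j = 1728 have j = 1728
  -- (for r = 0) or j = 287496.
  velu-A≈0 : ∀ E E′ r r′ → A E ≈ 0# → A E′ ≈ 0# → SameJ (velu E r) (velu E′ r′)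
  velu-A≈0 E E′ r r′ A≈0 A′≈0 = solve-at (A E) (A E′) A≈0 A′≈0
    where
    solve-at : ∀ a a′ → a ≈ 0# → a′ ≈ 0# → (- (ι 4 * a + ι 15 * r ^ 2)) ^ 3 * (- (ι 8 * (a′ * r′) + ι 22 * r′ ^ 3)) ^ 2
                                      ≈ (- (ι 4 * a′ + ι 15 * r′ ^ 2)) ^ 3 * (- (ι 8 * (a * r) + ι 22 * r ^ 3)) ^ 2
    solve-at a a′ a≈0 a′≈0 = trans
      (*-cong (^-congˡ 3 (-‿cong (+-congʳ (*-congˡ a≈0)))) (^-congˡ 2 (-‿cong (+-congʳ (*-congˡ (*-congʳ a′≈0))))))
      (trans (solve 2 (λ r r′ → [] ⊢ (:- (con 4 :* con 0 :+ con 15 :* r :^ 2)) :^ 3 :* (:- (con 8 :* (con 0 :* r′) :+ con 22 :* r′ :^ 3)) :^ 2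
                 := (:- (con 4 :* con 0 :+ con 15 :* r′ :^ 2)) :^ 3 :* (:- (con 8 :* (con 0 :* r) :+ con 22 :* r :^ 3)) :^ 2) r r′)
        (sym (*-cong (^-congˡ 3 (-‿cong (+-congʳ (*-congˡ a′≈0)))) (^-congˡ 2 (-‿cong (+-congʳ (*-congˡ (*-congʳ a≈0))))))))

  velu-r≈0 : ∀ E E′ {r r′} → r ≈ 0# → r′ ≈ 0# → SameJ (velu E r) (velu E′ r′)
  velu-r≈0 E E′ {r} {r′} r≈0 r′≈0 = trans (vanish E′ (A (velu E r)) r′≈0) (sym (vanish E (A (velu E′ r′)) r≈0))
    where
    vanish : ∀ E a {r} → r ≈ 0# → a ^ 3 * B (velu E r) ^ 2 ≈ 0#
    vanish E a {r} r≈0 = solve 3 (λ a r x → let y = con 8 :* x :+ con 22 :* r :^ 2 in (a :^ 3 :* y :^ 2 :* r by r := con 0) ∷ []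
      ⊢ a :^ 3 :* (:veluB x r) :^ 2 := con 0) a r (A E) r≈0

  root-B≈0 : ∀ E {r} → B E ≈ 0# → r ≉ 0# → Root E r → A E ≈ - r ^ 2
  root-B≈0 E {r} B≈0 r≉0 root = *-cancelˡ-≉0 r≉0
    (solve 3 (λ r A B → (:1 by :cubic A B r := con 0) ∷ (:- :1 by B := con 0) ∷ [] ⊢ r :* A := r :* :- r :^ 2) r (A E) (B E) root B≈0)

  velu-B≈0 : ∀ E E′ r r′ → A E ≈ - r ^ 2 → A E′ ≈ - r′ ^ 2 → SameJ (velu E r) (velu E′ r′)
  velu-B≈0 E E′ r r′ A≈ A′≈ = trans
    (*-cong (^-congˡ 3 (-‿cong (+-congʳ (*-congˡ A≈)))) (^-congˡ 2 (-‿cong (+-congʳ (*-congˡ (*-congʳ A′≈))))))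
    (trans (solve 2 (λ r r′ → [] ⊢ (:- (con 4 :* :- r :^ 2 :+ con 15 :* r :^ 2)) :^ 3 :* (:- (con 8 :* (:- r′ :^ 2 :* r′) :+ con 22 :* r′ :^ 3)) :^ 2
               := (:- (con 4 :* :- r′ :^ 2 :+ con 15 :* r′ :^ 2)) :^ 3 :* (:- (con 8 :* (:- r :^ 2 :* r) :+ con 22 :* r :^ 3)) :^ 2) r r′)
      (sym (*-cong (^-congˡ 3 (-‿cong (+-congʳ (*-congˡ A′≈)))) (^-congˡ 2 (-‿cong (+-congʳ (*-congˡ (*-congʳ A≈))))))))

  velu-self : ∀ E r → Root E r → IsVelu r 1# E (velu E r)
  velu-self E r root = record { root = root ; scaling = record
    { δ≉0 = 1≉0 ; A-eq = sym (trans (*-congʳ (1^ 4)) (*-identityˡ _)) ; B-eq = sym (trans (*-congʳ (1^ 6)) (*-identityˡ _)) } }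

  neighbour : ∀ v r → InPrimeField r → Root (curve v) r → ∃[ w ] Adjacent v w × j w ≈ jInv (velu (curve v) r)
  neighbour v r r∈ root = w , velu⇒adjacent {v} {w} V , refl
    where
    V : VeluOver𝔽ₚ (curve v) (velu (curve v) r)
    V = record { r∈ = r∈ ; δ∈ = 1-∈ ; isVelu = velu-self (curve v) r root }
    in-field = velu-∈ {curve v} (Vertex.A∈𝔽ₚ v) r∈
    w = veluVertex v (proj₁ in-field) (proj₂ in-field) V

  neighbour-j : ∀ {v w} (V : VeluOver𝔽ₚ (curve v) (curve w)) → j w ≈ jInv (velu (curve v) (VeluOver𝔽ₚ.r V))
  neighbour-j {v} V = isVelu-j (Vertex.elliptic v) (VeluOver𝔽ₚ.isVelu V)

  sameJ-A≈0 : ∀ E E′ → IsElliptic E → SameJ E E′ → A E ≈ 0# → A E′ ≈ 0#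
  sameJ-A≈0 E E′ elliptic same A≈0 = ^≈0⇒≈0 3 (x*y≈0⇒y≈0 (^-≉0 2 B≉0) (trans (*-comm _ _) (trans (sym same) (trans (*-congʳ (trans (*-congʳ A≈0) (zeroˡ _))) (zeroˡ _)))))
    where
    B≉0 : B E ≉ 0#
    B≉0 B≈0 = elliptic (solve 2 (λ A B → (con 4 :* A :^ 2 by A := con 0) ∷ (con 27 :* B by B := con 0) ∷ []
      ⊢ :disc A B := con 0) (A E) (B E) A≈0 B≈0)

  sameJ-B≈0 : ∀ E E′ → A E ≉ 0# → SameJ E E′ → B E ≈ 0# → B E′ ≈ 0#
  sameJ-B≈0 E E′ A≉0 same B≈0 = ^≈0⇒≈0 2 (x*y≈0⇒y≈0 (^-≉0 3 A≉0) (trans same (trans (*-congˡ (trans (*-congʳ B≈0) (zeroˡ _))) (zeroʳ _))))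

  0-root : ∀ E → B E ≈ 0# → Root E 0#
  0-root E B≈0 = solve 2 (λ A B → (:1 by B := con 0) ∷ [] ⊢ con 0 :^ 3 :+ A :* con 0 :+ B := con 0) (A E) (B E) B≈0

  private
    unlike-twist : ∀ {v w} → j v ≈ j w → A (curve v) ≉ 0# → B (curve v) ≉ 0# → ¬ HasNeighbourUnlike v w
    unlike-twist {v} {w} jv≈jw A≉0 B≉0 (v′ , v-v′ , unlike) = unlike (twistVertex v′)
        (velu⇒adjacent {w} {twistVertex v′} (velu-respˡ w≅ (adjacent⇒velu {twistVertex v} {twistVertex v′} (twist-adjacent d d∈ d≉0 {v} {v′} v-v′)))) (sym (j-twist v′))
      where
      E = curve v
      E′ = curve w
      same = j⇒sameJ E E′ (Vertex.elliptic v) (Vertex.elliptic w) jv≈jw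
      A′≉0 : A E′ ≉ 0#
      A′≉0 A′≈0 = A≉0 (sameJ-A≈0 E′ E (Vertex.elliptic w) (sym same) A′≈0)
      B′≉0 : B E′ ≉ 0#
      B′≉0 B′≈0 = B≉0 (sameJ-B≈0 E′ E A′≉0 (sym same) B′≈0)
      q = A E′ * B E
      q≉0 : q ≉ 0#
      q≉0 = *-≉0 A′≉0 B≉0
      q⁻¹ = proj₁ (inverse q q≉0)
      qq⁻¹≈1 = proj₂ (inverse q q≉0)
      -- A twist by d multiplies A by d² and B by d³, so d has to be the quotient of B′/B by A′/A.
      d = B E′ * A E * q⁻¹
      d∈ : InPrimeField d
      d∈ = *-∈ (*-∈ (Vertex.B∈𝔽ₚ w) (Vertex.A∈𝔽ₚ v)) (inverse-∈ qq⁻¹≈1 (*-∈ (Vertex.A∈𝔽ₚ w) (Vertex.B∈𝔽ₚ v)))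
      d≉0 : d ≉ 0#
      d≉0 = *-≉0 (*-≉0 B′≉0 A≉0) (invertible⇒≉0 (trans (*-comm q⁻¹ q) qq⁻¹≈1))
      open Twist d d∈ d≉0
      dq≈ : d * q ≈ B E′ * A E
      dq≈ = solve 3 (λ x q k → (x by q :* k := :1) ∷ [] ⊢ x :* k :* q := x) (B E′ * A E) q q⁻¹ qq⁻¹≈1
      w≅ : twistCurve E ≅ E′
      w≅ = scaling⇒≅ 1-∈ (record
        { δ≉0 = 1≉0
        ; A-eq = trans (*-cancelˡ-≉0 (^-≉0 2 q≉0) (solve 5 (λ A B A′ B′ d → let q = A′ :* B in
              (:- :1 by A :^ 3 :* B′ :^ 2 := A′ :^ 3 :* B :^ 2)
            ∷ (:- A :* (d :* q :+ B′ :* A) by d :* q := B′ :* A) ∷ []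
            ⊢ q :^ 2 :* A′ := q :^ 2 :* (d :^ 2 :* A)) (A E) (B E) (A E′) (B E′) d same dq≈)) (sym (trans (*-congʳ (1^ 4)) (*-identityˡ _)))
        ; B-eq = trans (*-cancelˡ-≉0 (^-≉0 3 q≉0) (solve 5 (λ A B A′ B′ d → let q = A′ :* B ; m = B′ :* A in
              (:- B′ :* B by A :^ 3 :* B′ :^ 2 := A′ :^ 3 :* B :^ 2)
            ∷ (:- B :* ((d :* q) :^ 2 :+ d :* q :* m :+ m :^ 2) by d :* q := m) ∷ []
            ⊢ q :^ 3 :* B′ := q :^ 3 :* (d :^ 3 :* B)) (A E) (B E) (A E′) (B E′) d same dq≈)) (sym (trans (*-congʳ (1^ 6)) (*-identityˡ _))) })

    -- Both curves have the root 0, so a neighbour coming from it is matched on the other side.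
    -- Nonzero roots may be rational for only one of the two curves, which is why both unlike
    -- neighbours are used: if both come from nonzero roots, they have the same j-invariant.
    unlike-B≈0 : ∀ {v w} → B (curve v) ≈ 0# → B (curve w) ≈ 0# → HasNeighbourUnlike v w → ¬ HasNeighbourUnlike w v
    unlike-B≈0 {v} {w} B≈0 B′≈0 (v′ , v-v′ , unlike) (w′ , w-w′ , unlike′) = go (r ≟ 0#) (r′ ≟ 0#)
      where
      V = adjacent⇒velu {v} {v′} v-v′
      W = adjacent⇒velu {w} {w′} w-w′
      r = VeluOver𝔽ₚ.r V
      r′ = VeluOver𝔽ₚ.r W
      root = IsVelu.root (VeluOver𝔽ₚ.isVelu V)
      root′ = IsVelu.root (VeluOver𝔽ₚ.isVelu W)
      elliptic = Vertex.elliptic v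
      elliptic′ = Vertex.elliptic w
      jv′≈ = neighbour-j {v} {v′} V
      jw′≈ = neighbour-j {w} {w′} W
      go : Dec (r ≈ 0#) → Dec (r′ ≈ 0#) → ⊥
      go (no r≉0) (no r′≉0) = unlike w′ w-w′ (trans jv′≈ (trans (velu-sameJ elliptic elliptic′ root root′
        (velu-B≈0 (curve v) (curve w) r r′ (root-B≈0 (curve v) B≈0 r≉0 root) (root-B≈0 (curve w) B′≈0 r′≉0 root′))) (sym jw′≈)))
      go (yes r≈0) _ = unlike w″ w-w″ (trans jv′≈ (trans (velu-sameJ elliptic elliptic′ root (0-root (curve w) B′≈0)
        (velu-r≈0 (curve v) (curve w) r≈0 refl)) (sym jw″≈)))
        where
        n = neighbour w 0# 0-∈ (0-root (curve w) B′≈0)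
        w″ = proj₁ n
        w-w″ = proj₁ (proj₂ n)
        jw″≈ = proj₂ (proj₂ n)
      go (no _) (yes r′≈0) = unlike′ v″ v-v″ (trans jw′≈ (trans (velu-sameJ elliptic′ elliptic root′ (0-root (curve v) B≈0)
        (velu-r≈0 (curve w) (curve v) r′≈0 refl)) (sym jv″≈)))
        where
        n = neighbour v 0# 0-∈ (0-root (curve v) B≈0)
        v″ = proj₁ n
        v-v″ = proj₁ (proj₂ n)
        jv″≈ = proj₂ (proj₂ n)

    unlike-A≈0 : ∀ {v w} → A (curve v) ≈ 0# → A (curve w) ≈ 0# → HasNeighbourUnlike v w → ¬ HasNeighbourUnlike w v
    unlike-A≈0 {v} {w} A≈0 A′≈0 (v′ , v-v′ , unlike) (w′ , w-w′ , _) =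
      unlike w′ w-w′ (trans (neighbour-j {v} {v′} V) (trans (velu-sameJ (Vertex.elliptic v) (Vertex.elliptic w)
        (IsVelu.root (VeluOver𝔽ₚ.isVelu V)) (IsVelu.root (VeluOver𝔽ₚ.isVelu W))
        (velu-A≈0 (curve v) (curve w) _ _ A≈0 A′≈0)) (sym (neighbour-j {w} {w′} W))))
      where
      V = adjacent⇒velu {v} {v′} v-v′
      W = adjacent⇒velu {w} {w′} w-w′

  never-attach-along : ∀ V W a → ¬ AttachAlong V W a
  never-attach-along V W a (_ , v , w , _ , jv≈a , _ , jw≈a , unlike , unlike′) = go (A (curve v) ≟ 0#) (B (curve v) ≟ 0#)
    where
    jv≈jw = trans jv≈a (sym jw≈a)
    same = j⇒sameJ (curve v) (curve w) (Vertex.elliptic v) (Vertex.elliptic w) jv≈jw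
    go : Dec (A (curve v) ≈ 0#) → Dec (B (curve v) ≈ 0#) → ⊥
    go (yes A≈0) _         = unlike-A≈0 {v} {w} A≈0 (sameJ-A≈0 (curve v) (curve w) (Vertex.elliptic v) same A≈0) unlike unlike′
    go (no A≉0)  (yes B≈0) = unlike-B≈0 {v} {w} B≈0 (sameJ-B≈0 (curve v) (curve w) A≉0 same B≈0) unlike unlike′
    go (no A≉0)  (no B≉0)  = unlike-twist {v} {w} jv≈jw A≉0 B≉0 unlike

-- Uniqueness of the new edge

module NewEdges {c ℓ : Level} {p : ℕ} (p-prime : Prime p) (3<p : 3 < p) (K : AlgebraicClosure𝔽 c ℓ p) where
  open Context p-prime 3<p K
  open Curves p-prime 3<p K
  open VeluHomomorphism p-prime 3<p K
  open VeluIsogeny p-prime 3<p K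
  open Classification p-prime 3<p K
  open Twisting p-prime 3<p K
  open Attachments p-prime 3<p K

  frobenius-^ : ∀ n x → (x ^ n) ^ p ≈ (x ^ p) ^ n
  frobenius-^ zero    x = 1^ p
  frobenius-^ (suc n) x = trans (frobenius-* x (x ^ n)) (*-congˡ (frobenius-^ n x))

  frobenius-root : ∀ E {r} → InPrimeField (A E) → InPrimeField (B E) → Root E r → Root E (r ^ p)
  frobenius-root E {r} A∈ B∈ root = trans (sym (trans (frobenius-+ _ _) (+-cong
    (trans (frobenius-+ _ _) (+-cong (frobenius-^ 3 r) (trans (frobenius-* _ _) (*-congʳ (∈⇒fixed A∈))))) (∈⇒fixed B∈))))
    (trans (^-congˡ p root) 0^p)

  frobenius-velu : ∀ {E E′ r δ} → InPrimeField (A E) → InPrimeField (A E′) → InPrimeField (B E′) →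
                   Scaling δ (velu E r) E′ → Scaling (δ ^ p) (velu E (r ^ p)) E′
  frobenius-velu {E} {E′} {r} {δ} A∈ A′∈ B′∈ S = record
    { δ≉0 = ^-≉0 p δ≉0
    ; A-eq = trans (sym (∈⇒fixed A′∈)) (trans (^-congˡ p A-eq) (trans (frobenius-* _ _) (*-cong (frobenius-^ 4 δ)
        (trans (frobenius-- _) (-‿cong (trans (frobenius-+ _ _) (+-cong
          (trans (frobenius-* _ _) (*-cong (frobenius-ι 4) (∈⇒fixed A∈)))
          (trans (frobenius-* _ _) (*-cong (frobenius-ι 15) (frobenius-^ 2 r))))))))))
    ; B-eq = trans (sym (∈⇒fixed B′∈)) (trans (^-congˡ p B-eq) (trans (frobenius-* _ _) (*-cong (frobenius-^ 6 δ)
        (trans (frobenius-- _) (-‿cong (trans (frobenius-+ _ _) (+-cong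
          (trans (frobenius-* _ _) (*-cong (frobenius-ι 8) (trans (frobenius-* _ _) (*-congʳ (∈⇒fixed A∈)))))
          (trans (frobenius-* _ _) (*-cong (frobenius-ι 22) (frobenius-^ 3 r))))))))))
    }
    where open Scaling S

  -- The third root is -(r + q), so the curve and its quotients are given by homogeneous polynomials
  -- in r and q.
  module TwoRoots (E : Weierstrass) (r q : ∣K∣) (elliptic : IsElliptic E) (root : Root E r) (root′ : Root E q) (r≉q : r ≉ q) where
    A≈ : A E ≈ - (r ^ 2 + r * q + q ^ 2)
    A≈ = *-cancelˡ-≉0 (-≉0 r≉q) (solve 4 (λ r q A B →
        (:1 by :cubic A B r := con 0) ∷ (:- :1 by :cubic A B q := con 0) ∷ []
      ⊢ (r :- q) :* A := (r :- q) :* :- (r :^ 2 :+ r :* q :+ q :^ 2)) r q (A E) (B E) root root′)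

    B≈ : B E ≈ r * q * (r + q)
    B≈ = solve 4 (λ r q A B →
        (:1 by :cubic A B r := con 0) ∷ (:- r by A := :- (r :^ 2 :+ r :* q :+ q :^ 2)) ∷ []
      ⊢ B := r :* q :* (r :+ q)) r q (A E) (B E) root A≈

    -- j(E) = -3375 = j(velu E r)
    Q₇ : ∣K∣
    Q₇ = ι 2 * r ^ 2 - ι 3 * (r * q) + ι 2 * q ^ 2

    -- j(E) and j(velu E r) are the two roots of the Hilbert class polynomial
    -- H₋₁₅(X) = X² + 191025 X - 121287375, where 191025 = 675·283 and
    -- 121287375 = 495³.
    Q₁₅ : ∣K∣
    Q₁₅ = ι 196 * (r ^ 2 + q ^ 2) ^ 2 - ι 28 * ((r ^ 2 + q ^ 2) * (r * q)) - ι 719 * (r * q) ^ 2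

    private
      E′ = velu E r
      elliptic′ = velu-elliptic E r elliptic root

      A-factor : slope E r ≈ (r - q) * (ι 2 * r + q)
      A-factor = solve 3 (λ r q A → (:1 by A := :- (r :^ 2 :+ r :* q :+ q :^ 2)) ∷ []
        ⊢ :slope A r := (r :- q) :* (con 2 :* r :+ q)) r q (A E) A≈

      A-factor′ : slope E q ≈ (q - r) * (r + ι 2 * q)
      A-factor′ = solve 3 (λ r q A → (:1 by A := :- (r :^ 2 :+ r :* q :+ q :^ 2)) ∷ []
        ⊢ :slope A q := (q :- r) :* (r :+ con 2 :* q)) r q (A E) A≈

    -- The difference of the two sides is a form of degree 12 that factors. Of its factors, r - q,
    -- 2r + q and r + 2q are differences of roots, r + q is minus the third root and so divides B,
    -- and one factor is A; all of these are nonzero, which leaves `Q₇` and `Q₁₅`.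
    sameJ⇒Q₇Q₁₅ : A E ≉ 0# → B E ≉ 0# → SameJ (velu E r) (velu E q) → Q₇ ≈ 0# ⊎ Q₁₅ ≈ 0#
    sameJ⇒Q₇Q₁₅ A≉0 B≉0 same = integral (x*y≈0⇒y≈0 (*-≉0 (*-≉0 (*-≉0 (*-≉0 (*-≉0 (^-≉0 4 2≉0) (-≉0 r≉q))
        (factor-≉0ʳ (≉0-resp B≈ B≉0))) A≉0) (factor-≉0ʳ (≉0-resp A-factor (slope≉0 E r elliptic root))))
        (factor-≉0ʳ (≉0-resp A-factor′ (slope≉0 E q elliptic root′))))
      (trans (*-congʳ (*-congʳ (*-congʳ (*-congˡ A≈)))) (identity (trans (sym (substituted r q A≈)) (trans same (substituted q r A≈))))))
      where
      A₀ = - (r ^ 2 + r * q + q ^ 2)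
      -- Vélu's parameters are expressed through A and the root, so `0#` can fill the place of B.
      substituted : ∀ r q {a} → A E ≈ a → A (velu E r) ^ 3 * B (velu E q) ^ 2 ≈ A (velu (weierstrass a 0#) r) ^ 3 * B (velu (weierstrass a 0#) q) ^ 2
      substituted r q A≈a = *-cong (^-congˡ 3 (-‿cong (+-congʳ (*-congˡ A≈a)))) (^-congˡ 2 (-‿cong (+-congʳ (*-congˡ (*-congʳ A≈a)))))
      identity : A (velu (weierstrass A₀ 0#) r) ^ 3 * B (velu (weierstrass A₀ 0#) q) ^ 2 ≈ A (velu (weierstrass A₀ 0#) q) ^ 3 * B (velu (weierstrass A₀ 0#) r) ^ 2 →
                 ι 2 ^ 4 * (r - q) * (r + q) * A₀ * (ι 2 * r + q) * (r + ι 2 * q) * (Q₇ * Q₁₅) ≈ 0#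
      identity = solve 2 (λ r q → let A = :- (r :^ 2 :+ r :* q :+ q :^ 2) ; s = r :^ 2 :+ q :^ 2
                                      α = λ x → :veluA A x ; β = λ x → :veluB A x in
          (:1 by α r :^ 3 :* β q :^ 2 := α q :^ 3 :* β r :^ 2) ∷ []
        ⊢ con 2 :^ 4 :* (r :- q) :* (r :+ q) :* A :* (con 2 :* r :+ q) :* (r :+ con 2 :* q)
            :* ((con 2 :* r :^ 2 :- con 3 :* (r :* q) :+ con 2 :* q :^ 2) :* (con 196 :* s :^ 2 :- con 28 :* (s :* (r :* q)) :- con 719 :* (r :* q) :^ 2)) := con 0) r q

    Q₇⇒j≈ : Q₇ ≈ 0# → jInv E ≈ jInv (velu E r)
    Q₇⇒j≈ Q₇≈0 = sameJ⇒j E E′ elliptic elliptic′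
      (trans (*-cong (^-congˡ 3 A≈) (^-congˡ 2 (-‿cong (+-congʳ (*-congˡ (*-congʳ A≈))))))
      (trans (solve 2 (λ r q → let A = :- (r :^ 2 :+ r :* q :+ q :^ 2) ; α = :veluA A r ; β = :veluB A r in
          (con 98 :* q :^ 2 :* r :^ 8 :+ con 1243 :* q :^ 3 :* r :^ 7 :+ con 970 :* q :^ 4 :* r :^ 6 :- con 329 :* q :* r :^ 9 :- con 484 :* q :^ 5 :* r :^ 5
             :- con 920 :* q :^ 6 :* r :^ 4 :- con 416 :* q :^ 7 :* r :^ 3 :- con 64 :* q :^ 8 :* r :^ 2 :- con 98 :* r :^ 10
           by con 2 :* r :^ 2 :- con 3 :* (r :* q) :+ con 2 :* q :^ 2 := con 0) ∷ []
        ⊢ A :^ 3 :* β :^ 2 := α :^ 3 :* (r :* q :* (r :+ q)) :^ 2) r q Q₇≈0)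
      (sym (*-cong (^-congˡ 3 (-‿cong (+-congʳ (*-congˡ A≈)))) (^-congˡ 2 B≈)))))

    private
      D D′ : ∣K∣
      D = ι 4 * (- (r ^ 2 + r * q + q ^ 2)) ^ 3 + ι 27 * (r * q * (r + q)) ^ 2
      D′ = disc (velu (weierstrass (- (r ^ 2 + r * q + q ^ 2)) 0#) r)
      N N′ : ∣K∣
      N = ι 1728 * (ι 4 * (- (r ^ 2 + r * q + q ^ 2)) ^ 3)
      N′ = ι 1728 * (ι 4 * A (velu (weierstrass (- (r ^ 2 + r * q + q ^ 2)) 0#) r) ^ 3)

      disc≈D : disc E ≈ D
      disc≈D = +-cong (*-congˡ (^-congˡ 3 A≈)) (*-congˡ (^-congˡ 2 B≈))

      disc≈D′ : disc E′ ≈ D′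
      disc≈D′ = +-cong (*-congˡ (^-congˡ 3 (-‿cong (+-congʳ (*-congˡ A≈))))) (*-congˡ (^-congˡ 2 (-‿cong (+-congʳ (*-congˡ (*-congʳ A≈))))))

      jD≈N : jInv E * D ≈ N
      jD≈N = trans (*-congˡ (sym disc≈D)) (trans (j-* E elliptic) (*-congˡ (*-congˡ (^-congˡ 3 A≈))))

      jD′≈N′ : jInv E′ * D′ ≈ N′
      jD′≈N′ = trans (*-congˡ (sym disc≈D′)) (trans (j-* E′ elliptic′) (*-congˡ (*-congˡ (^-congˡ 3 (-‿cong (+-congʳ (*-congˡ A≈)))))))

      DD′≉0 : D * D′ ≉ 0#
      DD′≉0 = *-≉0 (≉0-resp disc≈D elliptic) (≉0-resp disc≈D′ elliptic′)

    private
      -- As j = N/D and j′ = N′/D′, this is j + j′ = -191025 with denominators cleared. The cofactor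
      -- is the polynomial quotient by `Q₁₅`.
      sum : Q₁₅ ≈ 0# → N * D′ + N′ * D ≈ D * D′ * - (ι 675 * ι 283)
      sum Q₁₅≈0 =
        solve 2 (λ r q → let A = :- (r :^ 2 :+ r :* q :+ q :^ 2) ; B = r :* q :* (r :+ q) ; s = r :^ 2 :+ q :^ 2
                             α = :veluA A r ; β = :veluB A r
                             D = :disc A B ; D′ = :disc α β in
            (con 1724976 :* q :* r :^ 7 :+ con 5084208 :* q :^ 2 :* r :^ 6 :+ con 10255248 :* q :^ 3 :* r :^ 5 :+ con 8365680 :* q :^ 4 :* r :^ 4 :+ con 313632 :* r :^ 8
               :- con 5992704 :* q :^ 5 :* r :^ 3 :- con 12493440 :* q :^ 6 :* r :^ 2 :- con 6241536 :* q :^ 7 :* r :- con 1016064 :* q :^ 8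
             by con 196 :* s :^ 2 :- con 28 :* (s :* (r :* q)) :- con 719 :* (r :* q) :^ 2 := con 0) ∷ []
          ⊢ con 1728 :* (con 4 :* A :^ 3) :* D′ :+ con 1728 :* (con 4 :* α :^ 3) :* D := D :* D′ :* :- (con 675 :* con 283)) r q Q₁₅≈0

      sum-j : D * D′ * (jInv E + jInv E′) ≈ N * D′ + N′ * D
      sum-j = solve 6 (λ j j′ D D′ N N′ → (D′ by j :* D := N) ∷ (D by j′ :* D′ := N′) ∷ [] ⊢ D :* D′ :* (j :+ j′) := N :* D′ :+ N′ :* D)
        (jInv E) (jInv E′) D D′ N N′ jD≈N jD′≈N′

      product : Q₁₅ ≈ 0# → N * N′ ≈ D * D′ * - (ι 495 ^ 3)
      product Q₁₅≈0 =
        solve 2 (λ r q → let A = :- (r :^ 2 :+ r :* q :+ q :^ 2) ; B = r :* q :* (r :+ q) ; s = r :^ 2 :+ q :^ 2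
                             α = :veluA A r ; β = :veluB A r
                             D = :disc A B ; D′ = :disc α β in
            (con 1508726736 :* q :* r :^ 7 :+ con 4815890640 :* q :^ 2 :* r :^ 6 :+ con 7916951664 :* q :^ 3 :* r :^ 5 :+ con 5674874256 :* q :^ 4 :* r :^ 4 :+ con 403644384 :* r :^ 8
               :- con 3829337856 :* q :^ 5 :* r :^ 3 :- con 7983308160 :* q :^ 6 :* r :^ 2 :- con 3988341504 :* q :^ 7 :* r :- con 649264896 :* q :^ 8
             by con 196 :* s :^ 2 :- con 28 :* (s :* (r :* q)) :- con 719 :* (r :* q) :^ 2 := con 0) ∷ []
          ⊢ con 1728 :* (con 4 :* A :^ 3) :* (con 1728 :* (con 4 :* α :^ 3)) := D :* D′ :* (:- con 495 :^ 3)) r q Q₁₅≈0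

      product-j : D * D′ * (jInv E * jInv E′) ≈ N * N′
      product-j = solve 6 (λ j j′ D D′ N N′ → (j′ :* D′ by j :* D := N) ∷ (N by j′ :* D′ := N′) ∷ [] ⊢ D :* D′ :* (j :* j′) := N :* N′)
        (jInv E) (jInv E′) D D′ N N′ jD≈N jD′≈N′

    Q₁₅⇒j+ : Q₁₅ ≈ 0# → jInv E + jInv (velu E r) ≈ - (ι 675 * ι 283)
    Q₁₅⇒j+ Q₁₅≈0 = *-cancelˡ-≉0 DD′≉0 (trans sum-j (sum Q₁₅≈0))

    Q₁₅⇒j* : Q₁₅ ≈ 0# → jInv E * jInv (velu E r) ≈ - (ι 495 ^ 3)
    Q₁₅⇒j* Q₁₅≈0 = *-cancelˡ-≉0 DD′≉0 (trans product-j (product Q₁₅≈0))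

  module _ {a b : ∣K∣} (a≉b : a ≉ b) (unjoined : ¬ (∃[ v ] ∃[ w ] j v ≈ a × j w ≈ b × Adjacent v w)) (v w : Vertex) (jv≈a : j v ≈ a) (jw≈b : j w ≈ b)
           (φ : Isogeny (curve v) (curve w)) (degree≡2 : Isogeny.degree φ ≡ 2) where
    private
      E = curve v
      E′ = curve w
      elliptic = Vertex.elliptic v
      elliptic′ = Vertex.elliptic w
      r = kernelRoot elliptic elliptic′ φ degree≡2
      V : IsVelu r (multiplier elliptic elliptic′ φ degree≡2) E E′
      V = degree2-isVelu elliptic elliptic′ φ degree≡2
      open IsVelu V

      jE′≈b : jInv (velu E r) ≈ b
      jE′≈b = trans (sym (isVelu-j elliptic V)) jw≈b

      -- Such a root would give an edge over the prime field from j-invariant a to b. The vertex u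
      -- may be any one above a, which matters for a = 0 and a = 1728.
      no-rational-root : ∀ u ρ → InPrimeField ρ → Root (curve u) ρ → j u ≈ a → ¬ jInv (velu (curve u) ρ) ≈ b
      no-rational-root u ρ ρ∈ rootᵤ ju≈a jρ≈b = unjoined
        (u , proj₁ n , ju≈a , trans (proj₂ (proj₂ n)) jρ≈b , proj₁ (proj₂ n))
        where n = neighbour u ρ ρ∈ rootᵤ

      r∉ : ¬ InPrimeField r
      r∉ r∈ = no-rational-root v r r∈ root jv≈a jE′≈b

      -- Over the closure, E is isomorphic to E₀, which has the root 1.
      no-scaled-root : ∀ E₀ {δ} → InPrimeField (A E₀) → InPrimeField (B E₀) → Scaling δ E E₀ → Root E₀ 1# →
                       ¬ SameJ (velu E₀ 1#) (velu E r)
      no-scaled-root E₀ A∈ B∈ S root₁ same = no-rational-root u 1# 1-∈ root₁ (trans (scaling-j elliptic S) jv≈a)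
          (trans (velu-sameJ elliptic₀ elliptic root₁ root same) jE′≈b)
        where
        elliptic₀ = Scaling.scaling-elliptic S elliptic
        u : Vertex
        u = record { curve = E₀ ; A∈𝔽ₚ = A∈ ; B∈𝔽ₚ = B∈ ; elliptic = elliptic₀
                   ; supersingular = scaling-supersingular′ S elliptic (Vertex.supersingular v) }

      scaled-inverse : ∀ {n δ k x} → δ ^ n ≈ - k → x * k ≈ 1# → - 1# ≈ δ ^ n * x
      scaled-inverse {n} {δ} {k} {x} δⁿ≈ xk≈1 = solve 3 (λ y k x → (:- x by y := :- k) ∷ (:1 by x :* k := :1) ∷ [] ⊢ :- :1 := y :* x) (δ ^ n) k x δⁿ≈ xk≈1

      -1-root-≉0 : ∀ {n x k} → x ^ suc n ≈ - k → k ≉ 0# → x ≉ 0#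
      -1-root-≉0 {n} {x} {k} xⁿ≈ k≉0 x≈0 = k≉0 (solve 2 (λ y k → (:1 by y := :- k) ∷ (:- :1 by y := con 0) ∷ [] ⊢ k := con 0) (x ^ suc n) k xⁿ≈ (trans (*-congʳ x≈0) (zeroˡ _)))

      -- For a = 0, the curve y² = x³ - 1 is isomorphic to E over the closure and has the rational
      -- root 1. All neighbours of 0 share one j-invariant, so b is already reached over the prime
      -- field.
      A≉0 : A E ≉ 0#
      A≉0 A≈0 = no-scaled-root (weierstrass 0# (- 1#)) {δ} 0-∈ (-‿∈ 1-∈)
          (record { δ≉0 = -1-root-≉0 {5} δ⁶≈ k≉0 ; A-eq = sym (trans (*-congˡ A≈0) (zeroʳ _)) ; B-eq = scaled-inverse {6} δ⁶≈ Bk≈1 })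
          (solve 0 ([] ⊢ :1 :^ 3 :+ con 0 :* :1 :+ :- :1 := con 0))
          (velu-A≈0 (weierstrass 0# (- 1#)) E 1# r refl A≈0)
        where
        B≉0 : B E ≉ 0#
        B≉0 B≈0 = elliptic (solve 2 (λ A B → (con 4 :* A :^ 2 by A := con 0) ∷ (con 27 :* B by B := con 0) ∷ []
          ⊢ :disc A B := con 0) (A E) (B E) A≈0 B≈0)
        k = proj₁ (inverse (B E) B≉0)
        Bk≈1 = proj₂ (inverse (B E) B≉0)
        k≉0 = invertible⇒≉0 (trans (*-comm k (B E)) Bk≈1)
        δ = proj₁ (nth-root 6 (- k))
        δ⁶≈ = proj₂ (nth-root 6 (- k))

      -- For a = 1728, the curve y² = x³ - x takes this part, again with the root 1. The irrational
      -- root r is nonzero, and all nonzero roots lead to the same j-invariant.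
      B≉0 : B E ≉ 0#
      B≉0 B≈0 = no-scaled-root (weierstrass (- 1#) 0#) {δ} (-‿∈ 1-∈) 0-∈
          (record { δ≉0 = -1-root-≉0 {3} δ⁴≈ k≉0 ; A-eq = scaled-inverse {4} δ⁴≈ Ak≈1 ; B-eq = sym (trans (*-congˡ B≈0) (zeroʳ _)) })
          (solve 0 ([] ⊢ :1 :^ 3 :+ :- :1 :* :1 :+ con 0 := con 0))
          (velu-B≈0 (weierstrass (- 1#) 0#) E 1# r (-‿cong (sym (1^ 2))) (root-B≈0 E B≈0 (λ r≈0 → r∉ (0 , r≈0)) root))
        where
        k = proj₁ (inverse (A E) A≉0)
        Ak≈1 = proj₂ (inverse (A E) A≉0)
        k≉0 = invertible⇒≉0 (trans (*-comm k (A E)) Ak≈1)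
        δ = proj₁ (nth-root 4 (- k))
        δ⁴≈ = proj₂ (nth-root 4 (- k))

      -- The conjugate root gives the same j-invariant, because b lies in 𝔽ₚ.
      q = r ^ p

      r≉q : r ≉ q
      r≉q r≈q = r∉ (fixed⇒∈ (sym r≈q))

      root′ : Root E q
      root′ = frobenius-root E (Vertex.A∈𝔽ₚ v) (Vertex.B∈𝔽ₚ v) root

      conjugates : SameJ (velu E r) (velu E q)
      conjugates = j⇒sameJ (velu E r) (velu E q) (velu-elliptic E r elliptic root) (velu-elliptic E q elliptic root′)
        (trans (sym (isVelu-j elliptic V)) (scaling-j (velu-elliptic E q elliptic root′)
          (frobenius-velu {E} {E′} (Vertex.A∈𝔽ₚ v) (Vertex.A∈𝔽ₚ w) (Vertex.B∈𝔽ₚ w) scaling)))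

      open TwoRoots E r q elliptic root root′ r≉q

    new-edge-j : a + b ≈ - (ι 675 * ι 283) × a * b ≈ - (ι 495 ^ 3)
    new-edge-j = go (sameJ⇒Q₇Q₁₅ A≉0 B≉0 conjugates)
      where
      go : Q₇ ≈ 0# ⊎ Q₁₅ ≈ 0# → _
      go (inj₁ Q₇≈0)  = contradiction (trans (sym jv≈a) (trans (Q₇⇒j≈ Q₇≈0) jE′≈b)) a≉b
      go (inj₂ Q₁₅≈0) = trans (+-cong (sym jv≈a) (sym jE′≈b)) (Q₁₅⇒j+ Q₁₅≈0)
                      , trans (*-cong (sym jv≈a) (sym jE′≈b)) (Q₁₅⇒j* Q₁₅≈0)

  -- Both pairs are the roots of X² - σX + π, so (a - a′)(a - b′) = a² - σa + π = 0.
  same-roots : ∀ {a b a′ b′ σ π} → a + b ≈ σ × a * b ≈ π → a′ + b′ ≈ σ × a′ * b′ ≈ π → SameUnorderedPair a b a′ b′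
  same-roots {a} {b} {a′} {b′} {σ} {π} (s , t) (s′ , t′) with integral (solve 6 (λ a b a′ b′ σ π →
        (a by a :+ b := σ) ∷ (:- :1 by a :* b := π) ∷ (:- a by a′ :+ b′ := σ) ∷ (:1 by a′ :* b′ := π) ∷ []
      ⊢ (a :- a′) :* (a :- b′) := con 0) a b a′ b′ σ π s t s′ t′)
  ... | inj₁ a-a′≈0 = inj₁ (x∙y⁻¹≈ε⇒x≈y _ _ a-a′≈0 , solve 5 (λ a b a′ b′ σ →
        (:1 by a :+ b := σ) ∷ (:- :1 by a′ :+ b′ := σ) ∷ (:- :1 by a :- a′ := con 0) ∷ [] ⊢ b := b′) a b a′ b′ σ s s′ a-a′≈0)
  ... | inj₂ a-b′≈0 = inj₂ (x∙y⁻¹≈ε⇒x≈y _ _ a-b′≈0 , solve 5 (λ a b a′ b′ σ →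
        (:1 by a :+ b := σ) ∷ (:- :1 by a′ :+ b′ := σ) ∷ (:- :1 by a :- b′ := con 0) ∷ [] ⊢ b := a′) a b a′ b′ σ s s′ a-b′≈0)

  attached-j : ∀ V W {a b} → AttachedByNewEdge V W a b → a + b ≈ - (ι 675 * ι 283) × a * b ≈ - (ι 495 ^ 3)
  attached-j V W att = new-edge-j (proj₁ (proj₂ (proj₂ new))) (proj₂ (proj₂ (proj₂ (proj₂ new)))) v w
      (proj₁ (proj₂ witnesses)) (proj₁ (proj₂ (proj₂ (proj₂ witnesses)))) (proj₁ φ) (proj₁ (proj₂ φ))
    where
    new = proj₁ att
    v = proj₁ (proj₂ att)
    w = proj₁ (proj₂ (proj₂ att))
    witnesses = proj₂ (proj₂ (proj₂ att))
    φ = proj₂ (proj₂ (proj₂ (proj₂ witnesses)))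

  at-most-one-new-edge : ∀ V W a b V′ W′ a′ b′ → AttachedByNewEdge V W a b → AttachedByNewEdge V′ W′ a′ b′ →
                         SameUnorderedPair a b a′ b′
  at-most-one-new-edge V W a b V′ W′ a′ b′ att att′ = same-roots (attached-j V W att) (attached-j V′ W′ att′)

theorem3p26 : {c ℓ : Level} (p : ℕ) → Prime p → 3 < p →
    (K : AlgebraicClosure𝔽 c ℓ p) →
    let open SupersingularGraphs p K in
    (∀ V → (∃[ W ] Stack V W) ⊎ Folds V)
    × (∀ V W a b V′ W′ a′ b′ →
    AttachedByNewEdge V W a b → AttachedByNewEdge V′ W′ a′ b′ →
    SameUnorderedPair a b a′ b′)
    × (∀ V W a → ¬ AttachAlong V W a)
theorem3p26 p p-prime 3<p K =
    stacks-or-folds , at-most-one-new-edge , never-attach-along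
  where
  open Components p-prime 3<p K
  open Attachments p-prime 3<p K
  open NewEdges p-prime 3<p K
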